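{- Let $A,B$ and $S$ be non-empty subsets of a finite Abelian group $G$ with $|A|+|B|=|G|+L_S$ and $L_S=|S|\,L(G)$. Let $2b_s+s$ be an $A\wedge^S B$-exception with $s\in S$ and $b_s\in (A-s)\cap B$. Then the equality $|A\wedge^S B|=|G|-2|S|$ holds if and only if the following conditions hold: (i) $\Sigma=S-s$ is a subgroup of $G$; and, letting $\pi:G\to G/\Sigma$ be the natural projection, $A'=\pi(A-b_s-s)$ and $B'=\pi(B-b_s)$, (ii) there exists $b\in A'\cap B'$ such that $H=\langle 2b\rangle$ is a subgroup of $G/\Sigma$ of odd order $d$ greater than $1$; (iii) (for this $b$, $H$, $d$) there exist distinct elements $x_1,\ldots,x_k,x_{k+1},\ldots,x_l,x_{l+1},\ldots,x_m$ of $(G/\Sigma)\setminus (K(G/\Sigma)+H)$, where $m=(|G/\Sigma|/d-L(G/\Sigma))/2$ and $0\le k\le l\le m$, such that $$(G/\Sigma)\setminus (K(G/\Sigma)+H)=\bigcup_{i=1}^m\big((x_i+H)\cup(-x_i+H)\big),$$ $$A'=\big(\{0,b,3b,\ldots,(d-2)b\}+K(G/\Sigma)\big)\cup\big(\{x_1,\ldots,x_k,\pm x_{k+1},\ldots,\pm x_l\}+H\big),$$ $$B'=\big(\{0,b,3b,\ldots,(d-2)b\}+K(G/\Sigma)\big)\cup\big(\{x_1,\ldots,x_k,\pm x_{l+1},\ldots,\pm x_m\}+H\big);$$ (iv) $A=b_s+s+\pi^{ -1}(A')$ and $B=b_s+\pi^{ -1}(B')$.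
   Context: Groups are written additively. For subsets $A,B,S$ of a finite Abelian group $G$: $A+B=\{a+b: a\in A, b\in B\}$, $A-g=\{a-g:a\in A\}$ and $A\wedge^S B=\{a+b:\ a\in A,\ b\in B,\ a-b\notin S\}$. An $A\wedge^S B$-exception is an element of $(A+B)\setminus (A\wedge^S B)$. For $z\in G$, $L_S(z)=|\{(x,y)\in G\times G:\ x+y=z,\ x-y\in S\}|$, and $L_S=\max_{z\in G}L_S(z)$. For any finite Abelian group $\Gamma$, $K(\Gamma)=\{g\in \Gamma: 2g=0\}$ and $L(\Gamma)=|K(\Gamma)|$. The set $\{0,b,3b,\ldots,(d-2)b\}$ consists of $0$ and the odd multiples $jb$ with $1\le j\le d-2$, $j$ odd. -}

module Defs where

open import Algebra.Bundles using (AbelianGroup)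
import Algebra.Definitions.RawMonoid as RawMult
import Algebra.Properties.AbelianGroup as AbelianGroupProperties
import Algebra.Properties.CommutativeSemigroup as CommutativeSemigroupProperties
import Algebra.Properties.Monoid.Mult as Mult
open import Data.Fin.Base as Fin using (Fin; toℕ)
import Data.Fin.Properties as Fin
open import Data.Integer.Base as ℤ using (ℤ; -[1+_])
open import Data.List.Base using (List; cartesianProduct; deduplicate; filter; length; lookup; map)
open import Data.List.Extrema.Nat using (max)
import Data.List.Membership.Setoid as Membership
open import Data.List.Relation.Unary.Any as Any using (any?; index)
open import Data.List.Relation.Unary.Any.Properties using (lookup-index)
open import Data.List.Relation.Unary.Enumerates.Setoid using (IsEnumeration)
open import Data.List.Relation.Unary.Enumerates.Setoid.Properties using (cartesianProduct⁺)
open import Data.Nat.Base as ℕ using (ℕ; zero; suc)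
import Data.Nat.DivMod as ℕ
import Data.Nat.Properties as ℕ
open import Data.Product.Base using (∃; ∃₂; ∃-syntax; _×_; _,_; proj₁; proj₂)
open import Data.Product.Relation.Binary.Pointwise.NonDependent using (×-decSetoid)
open import Data.Sum.Base using (_⊎_)
open import Function.Base using (_∘_; id)
open import Function.Definitions using (Injective)
open import Level using (Level; _⊔_) renaming (suc to lsuc)
open import Relation.Binary.Bundles using (DecSetoid)
open import Relation.Binary.Core using (Rel)
open import Relation.Binary.Definitions using (_Respects_)
import Relation.Binary.Definitions as Binary
open import Relation.Binary.PropositionalEquality.Core as ≡ using (_≡_)
import Relation.Binary.Reasoning.Setoid as SetoidReasoning
open import Relation.Nullary.Decidable using (Dec; map′; _×-dec_; ¬?)
open import Relation.Unary using (Pred; Decidable; _∈_; _∉_; _≐_; _∪_; _∖_; ⋃; U; _⊢_)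
open import Relation.Unary.Properties using (U?)

private
  variable
    c ℓ p q r : Level

Odd : ℕ → Set
Odd n = n ℕ.% 2 ≡ 1

-- The enumeration may list an element several times, so that one list serves
-- both a setoid and its quotients; cardinalities remove duplicates.
record FiniteSetoid c ℓ : Set (lsuc (c ⊔ ℓ)) where
  field
    decSetoid   : DecSetoid c ℓ
  open DecSetoid decSetoid public
  field
    elements    : List Carrier
    enumeration : IsEnumeration setoid elements

  ∣_∣ : {P : Pred Carrier p} → Decidable P → ℕ
  ∣ P? ∣ = length (deduplicate _≟_ (filter P? elements))

  order : ℕ
  order = ∣ U? {A = Carrier} ∣

  ∃? : {P : Pred Carrier p} → P Respects _≈_ → Decidable P → Dec (∃ P)
  ∃? resp P? = map′
    (λ any → let x , _ , px = find any in x , px)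
    (λ (x , px) → lose resp (enumeration x) px)
    (any? P? elements)
    where open Membership setoid

_×ᶠ_ : FiniteSetoid c ℓ → FiniteSetoid p q → FiniteSetoid (c ⊔ p) (ℓ ⊔ q)
X ×ᶠ Y = record
  { decSetoid   = ×-decSetoid X.decSetoid Y.decSetoid
  ; elements    = cartesianProduct X.elements Y.elements
  ; enumeration = cartesianProduct⁺ X.setoid Y.setoid X.enumeration Y.enumeration
  }
  where
  module X = FiniteSetoid X
  module Y = FiniteSetoid Y

record FiniteAbelianGroup c ℓ : Set (lsuc (c ⊔ ℓ)) where
  field
    abelianGroup : AbelianGroup c ℓ
  open AbelianGroup abelianGroup public
    renaming
      ( _∙_ to infixl 6 _+_
      ; ε   to 0#
      ; _⁻¹ to infix 8 -_
      ; ∙-cong to +-cong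
      ; ∙-congˡ to +-congˡ
      ; ∙-congʳ to +-congʳ
      )
  infix 4 _≟_
  field
    _≟_          : Binary.Decidable _≈_
    elements     : List Carrier
    enumeration  : IsEnumeration setoid elements

  finiteSetoid : FiniteSetoid c ℓ
  finiteSetoid = record
    { decSetoid   = record { isDecEquivalence = record
                      { isEquivalence = isEquivalence ; _≟_ = _≟_ } }
    ; elements    = elements
    ; enumeration = enumeration
    }

  open FiniteSetoid finiteSetoid public using (∣_∣; order; ∃?)

module Subsets (Γ : FiniteAbelianGroup c ℓ) where
  open FiniteAbelianGroup Γ

  infixr 7 _·ℤ_

  open RawMult rawMonoid public using () renaming (_×_ to infixr 7 _·_)

  _·ℤ_ : ℤ → Carrier → Carrier
  (ℤ.+ n)  ·ℤ g = n · g
  -[1+ n ] ·ℤ g = - (suc n · g)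

  minus-cong : ∀ {x x′ y y′} → x ≈ x′ → y ≈ y′ → x - y ≈ x′ - y′
  minus-cong x≈x′ y≈y′ = +-cong x≈x′ (⁻¹-cong y≈y′)

  infixl 6 _∔_ _⊟_
  infixr 6 _⊞_

  _∔_ : Pred Carrier p → Pred Carrier q → Pred Carrier (c ⊔ ℓ ⊔ p ⊔ q)
  (A ∔ B) z = ∃₂ λ a b → a ∈ A × b ∈ B × z ≈ a + b

  _⊟_ : Pred Carrier p → Carrier → Pred Carrier (c ⊔ ℓ ⊔ p)
  (A ⊟ g) z = ∃[ a ] a ∈ A × z ≈ a - g

  _⊞_ : Carrier → Pred Carrier p → Pred Carrier (c ⊔ ℓ ⊔ p)
  (g ⊞ A) z = ∃[ a ] a ∈ A × z ≈ g + a

  _∧[_]_ : Pred Carrier p → Pred Carrier q → Pred Carrier r →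
           Pred Carrier (c ⊔ ℓ ⊔ p ⊔ q ⊔ r)
  (A ∧[ S ] B) z = ∃₂ λ a b → a ∈ A × b ∈ B × a - b ∉ S × z ≈ a + b

  IsException : Pred Carrier p → Pred Carrier q → Pred Carrier r →
                Pred Carrier (c ⊔ ℓ ⊔ p ⊔ q ⊔ r)
  IsException A S B = (A ∔ B) ∖ (A ∧[ S ] B)

  K : Pred Carrier ℓ
  K g = 2 · g ≈ 0#

  K? : Decidable K
  K? g = 2 · g ≟ 0#

  L : ℕ
  L = ∣ K? ∣

  Pairs : Pred Carrier p → Carrier → Pred (Carrier × Carrier) (ℓ ⊔ p)
  Pairs S z (x , y) = x + y ≈ z × x - y ∈ S

  pairs? : {S : Pred Carrier p} → Decidable S → ∀ z → Decidable (Pairs S z)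
  pairs? S? z (x , y) = (x + y ≟ z) ×-dec S? (x - y)

  -- L_S(z) is Lᶻ S? z; L_S is Lᴹ S? (the bound 0 is harmless: elements is
  -- non-empty); L(Γ) = |K(Γ)| is L.
  Lᶻ : {S : Pred Carrier p} → Decidable S → Carrier → ℕ
  Lᶻ S? z = FiniteSetoid.∣_∣ (finiteSetoid ×ᶠ finiteSetoid) (pairs? S? z)

  Lᴹ : {S : Pred Carrier p} → Decidable S → ℕ
  Lᴹ S? = max 0 (map (Lᶻ S?) elements)

  ⟨_⟩ : Carrier → Pred Carrier ℓ
  ⟨ g ⟩ x = ∃[ n ] x ≈ n ·ℤ g

  record IsSubgroup (P : Pred Carrier p) : Set (c ⊔ ℓ ⊔ p) where
    field
      resp     : P Respects _≈_
      0∈       : 0# ∈ P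
      +-closed : ∀ {x y} → x ∈ P → y ∈ P → x + y ∈ P
      -‿closed : ∀ {x} → x ∈ P → - x ∈ P

  module _ {A : Pred Carrier p} {S : Pred Carrier q} {B : Pred Carrier r}
           (A-resp : A Respects _≈_) (S-resp : S Respects _≈_) (B-resp : B Respects _≈_)
           (A? : Decidable A) (S? : Decidable S) (B? : Decidable B) where

    ∧-dec : Decidable (A ∧[ S ] B)
    ∧-dec z = ∃? outer-resp λ a → ∃? inner-resp λ b →
              A? a ×-dec B? b ×-dec ¬? (S? (a - b)) ×-dec (z ≟ a + b)
      where
      inner-resp : ∀ {a} → (λ b → a ∈ A × b ∈ B × a - b ∉ S × z ≈ a + b) Respects _≈_
      inner-resp b≈b′ (a∈A , b∈B , a-b∉S , z≈) =
        a∈A , B-resp b≈b′ b∈B , a-b∉S ∘ S-resp (minus-cong refl (sym b≈b′)) ,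
        trans z≈ (+-congˡ b≈b′)

      outer-resp : (λ a → ∃[ b ] a ∈ A × b ∈ B × a - b ∉ S × z ≈ a + b) Respects _≈_
      outer-resp a≈a′ (b , a∈A , b∈B , a-b∉S , z≈) =
        b , A-resp a≈a′ a∈A , b∈B , a-b∉S ∘ S-resp (minus-cong (sym a≈a′) refl) ,
        trans z≈ (+-congʳ a≈a′)

  ⊟-dec : {A : Pred Carrier p} → A Respects _≈_ → Decidable A → ∀ g → Decidable (A ⊟ g)
  ⊟-dec A-resp A? g z = ∃?
    (λ a≈a′ (a∈A , z≈) → A-resp a≈a′ a∈A , trans z≈ (minus-cong a≈a′ refl))
    (λ a → A? a ×-dec (z ≟ a - g))

  open Mult monoid using (×-homo-+; ×-assocˡ; ×-congˡ)
  open AbelianGroupProperties abelianGroup using (inverseʳ-unique; identityʳ-unique)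
  open SetoidReasoning setoid

  finite-order : ∀ g → ∃[ k ] suc k · g ≈ 0#
  finite-order g = k , identityʳ-unique _ _ (begin
    i · g + suc k · g      ≈⟨ ×-homo-+ g i (suc k) ⟨
    (i ℕ.+ suc k) · g      ≈⟨ ×-congˡ {x = g} i+k≡j ⟩
    j · g                  ≈⟨ at j′ ⟩
    lookup elements (f j′) ≡⟨ ≡.cong (lookup elements) fi≡fj ⟨
    lookup elements (f i′) ≈⟨ at i′ ⟨
    i · g                  ∎)
    where
    f : Fin (suc (length elements)) → Fin (length elements)
    f n = index (enumeration (toℕ n · g))

    at : ∀ n → toℕ n · g ≈ lookup elements (f n)
    at n = lookup-index (enumeration (toℕ n · g))

    collision = Fin.pigeonhole ℕ.≤-refl f
    i′ = proj₁ collision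
    j′ = proj₁ (proj₂ collision)
    fi≡fj = proj₂ (proj₂ (proj₂ collision))
    i = toℕ i′
    j = toℕ j′
    k = j ℕ.∸ suc i

    i+k≡j : i ℕ.+ suc k ≡ j
    i+k≡j = ≡.trans (ℕ.+-suc i k) (ℕ.m+[n∸m]≡n (proj₁ (proj₂ (proj₂ collision))))

  ·-zeroʳ : ∀ n → n · 0# ≈ 0#
  ·-zeroʳ zero    = refl
  ·-zeroʳ (suc n) = trans (identityˡ _) (·-zeroʳ n)

  module _ (g : Carrier) (k : ℕ) (kg≈0 : suc k · g ≈ 0#) where

    ·-multiple : ∀ n → (n ℕ.* suc k) · g ≈ 0#
    ·-multiple n = begin
      (n ℕ.* suc k) · g ≈⟨ ×-assocˡ g n (suc k) ⟨
      n · suc k · g     ≈⟨ Mult.×-congʳ monoid n kg≈0 ⟩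
      n · 0#            ≈⟨ ·-zeroʳ n ⟩
      0#                ∎

    ·-reduce : ∀ n → n · g ≈ (n ℕ.% suc k) · g
    ·-reduce n = begin
      n · g ≈⟨ ×-congˡ {x = g} (ℕ.m≡m%n+[m/n]*n n (suc k)) ⟩
      (n ℕ.% suc k ℕ.+ n ℕ./ suc k ℕ.* suc k) · g
            ≈⟨ ×-homo-+ g (n ℕ.% suc k) _ ⟩
      (n ℕ.% suc k) · g + (n ℕ./ suc k ℕ.* suc k) · g
            ≈⟨ +-congˡ (·-multiple (n ℕ./ suc k)) ⟩
      (n ℕ.% suc k) · g + 0# ≈⟨ identityʳ _ ⟩
      (n ℕ.% suc k) · g ∎

    ·-neg : ∀ n → - (n · g) ≈ (n ℕ.* k) · g
    ·-neg n = sym (inverseʳ-unique (n · g) _ (begin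
      n · g + (n ℕ.* k) · g ≈⟨ ×-homo-+ g n (n ℕ.* k) ⟨
      (n ℕ.+ n ℕ.* k) · g   ≈⟨ ×-congˡ {x = g} (ℕ.*-suc n k) ⟨
      (n ℕ.* suc k) · g     ≈⟨ ·-multiple n ⟩
      0#                    ∎))

  ⟨_⟩? : ∀ g → Decidable ⟨ g ⟩
  ⟨ g ⟩? x = map′
    (λ (n , _ , x≈ng) → ℤ.+ n , x≈ng)
    (λ { (ℤ.+ n    , x≈) → below n x≈
       ; (-[1+ n ] , x≈) → below (suc n ℕ.* k) (trans x≈ (·-neg g k kg≈0 (suc n))) })
    (ℕ.anyUpTo? (λ n → x ≟ n · g) (suc k))
    where
    k = proj₁ (finite-order g)
    kg≈0 = proj₂ (finite-order g)

    below : ∀ n → x ≈ n · g → ∃[ m ] m ℕ.< suc k × x ≈ m · g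
    below n x≈ng = n ℕ.% suc k , ℕ.m%n<n n (suc k) , trans x≈ng (·-reduce g k kg≈0 n)

-- The quotient by P has the carrier of Γ, with x ≈ y meaning x - y ∈ P.
module Quotient (Γ : FiniteAbelianGroup c ℓ) {P : Pred (FiniteAbelianGroup.Carrier Γ) p}
                (P? : Decidable P) (P-sub : Subsets.IsSubgroup Γ P) where
  open FiniteAbelianGroup Γ
  open Subsets Γ
  open IsSubgroup P-sub

  open AbelianGroupProperties abelianGroup using (⁻¹-anti-homo-//; ⁻¹-∙-comm)
  open CommutativeSemigroupProperties commutativeSemigroup using (interchange)
  open SetoidReasoning setoid

  infix 4 _∼_

  _∼_ : Rel Carrier p
  x ∼ y = x - y ∈ P

  ≈⇒∼ : ∀ {x y} → x ≈ y → x ∼ y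
  ≈⇒∼ {x} {y} x≈y = resp (sym (trans (+-congʳ x≈y) (inverseʳ y))) 0∈

  ∼-sym : ∀ {x y} → x ∼ y → y ∼ x
  ∼-sym {x} {y} x∼y = resp (⁻¹-anti-homo-// x y) (-‿closed x∼y)

  ∼-trans : ∀ {x y z} → x ∼ y → y ∼ z → x ∼ z
  ∼-trans {x} {y} {z} x∼y y∼z = resp eq (+-closed x∼y y∼z)
    where
    eq : (x - y) + (y - z) ≈ x - z
    eq = begin
      (x - y) + (y - z)     ≈⟨ assoc x (- y) (y - z) ⟩
      x + (- y + (y - z))   ≈⟨ +-congˡ (assoc (- y) y (- z)) ⟨
      x + ((- y + y) + - z) ≈⟨ +-congˡ (+-congʳ (inverseˡ y)) ⟩
      x + (0# + - z)        ≈⟨ +-congˡ (identityˡ (- z)) ⟩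
      x - z                 ∎

  ∼-+-cong : ∀ {x y u v} → x ∼ y → u ∼ v → x + u ∼ y + v
  ∼-+-cong {x} {y} {u} {v} x∼y u∼v = resp eq (+-closed x∼y u∼v)
    where
    eq : (x - y) + (u - v) ≈ (x + u) - (y + v)
    eq = trans (interchange x (- y) u (- v)) (+-congˡ (⁻¹-∙-comm y v))

  ∼-neg-cong : ∀ {x y} → x ∼ y → - x ∼ - y
  ∼-neg-cong {x} {y} x∼y = resp (sym (⁻¹-∙-comm x (- y))) (-‿closed x∼y)

  quotient : FiniteAbelianGroup c p
  quotient = record
    { abelianGroup = record
      { Carrier = Carrier
      ; _≈_     = _∼_
      ; _∙_     = _+_
      ; ε       = 0#
      ; _⁻¹     = -_
      ; isAbelianGroup = record
        { isGroup = record
          { isMonoid = record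
            { isSemigroup = record
              { isMagma = record
                { isEquivalence = record
                  { refl = ≈⇒∼ refl ; sym = ∼-sym ; trans = ∼-trans }
                ; ∙-cong = ∼-+-cong
                }
              ; assoc = λ x y z → ≈⇒∼ (assoc x y z)
              }
            ; identity = (λ x → ≈⇒∼ (identityˡ x)) , (λ x → ≈⇒∼ (identityʳ x))
            }
          ; inverse = (λ x → ≈⇒∼ (inverseˡ x)) , (λ x → ≈⇒∼ (inverseʳ x))
          ; ⁻¹-cong = ∼-neg-cong
          }
        ; comm = λ x y → ≈⇒∼ (comm x y)
        }
      }
    ; _≟_         = λ x y → P? (x - y)
    ; elements    = elements
    ; enumeration = λ x → Any.map ≈⇒∼ (enumeration x)
    }

  π : Carrier → FiniteAbelianGroup.Carrier quotient
  π = id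

  π[_] : Pred Carrier q → Pred (FiniteAbelianGroup.Carrier quotient) (c ⊔ p ⊔ q)
  π[ A ] y = ∃[ a ] a ∈ A × FiniteAbelianGroup._≈_ quotient y (π a)

module CosetStructure (Γ : FiniteAbelianGroup c ℓ) where
  open FiniteAbelianGroup Γ
  open Subsets Γ

  -- {0, b, 3b, …, (d-2)b}
  OddMultiples : Carrier → ℕ → Pred Carrier ℓ
  OddMultiples b d y = y ≈ 0# ⊎ (∃[ j ] Odd j × j ℕ.+ 2 ℕ.≤ d × y ≈ j · b)

  -- Below, the elements x₁, …, xₘ are x : Fin m → Carrier, so that xᵢ is the
  -- value of x at the index with toℕ equal to i - 1.

  -- {x₁, …, xₖ, ±x_{k+1}, …, ±x_l}
  Reps-A : ∀ {m} → (Fin m → Carrier) → (k l : ℕ) → Pred Carrier ℓ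
  Reps-A x k l y = (∃[ i ] toℕ i ℕ.< k × y ≈ x i)
                 ⊎ (∃[ i ] k ℕ.≤ toℕ i × toℕ i ℕ.< l × (y ≈ x i ⊎ y ≈ - x i))

  -- {x₁, …, xₖ, ±x_{l+1}, …, ±xₘ}
  Reps-B : ∀ {m} → (Fin m → Carrier) → (k l : ℕ) → Pred Carrier ℓ
  Reps-B x k l y = (∃[ i ] toℕ i ℕ.< k × y ≈ x i)
                 ⊎ (∃[ i ] l ℕ.≤ toℕ i × (y ≈ x i ⊎ y ≈ - x i))

  record HasCosetDecomposition (b : Carrier) (A B : Pred Carrier p) : Set (c ⊔ ℓ ⊔ p) where
    H : Pred Carrier ℓ
    H = ⟨ 2 · b ⟩

    d : ℕ
    d = ∣ ⟨ 2 · b ⟩? ∣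

    field
      m k l      : ℕ
      -- m = (|Γ|/d - L(Γ))/2 as an equation of rationals, cleared of denominators
      m-def      : d ℕ.* (2 ℕ.* m ℕ.+ L) ≡ order
      k≤l        : k ℕ.≤ l
      l≤m        : l ℕ.≤ m
      x          : Fin m → Carrier
      x-distinct : Injective _≡_ _≈_ x
      x∉K+H      : ∀ i → x i ∉ K ∔ H
      covering   : U ∖ (K ∔ H) ≐ ⋃[ i ∶ Fin m ] ((x i ⊞ H) ∪ ((- x i) ⊞ H))
      A-eq       : A ≐ (OddMultiples b d ∔ K) ∪ (Reps-A x k l ∔ H)
      B-eq       : B ≐ (OddMultiples b d ∔ K) ∪ (Reps-B x k l ∔ H)

  HasStructure : (A B : Pred Carrier p) → Set (c ⊔ ℓ ⊔ p)
  HasStructure A B = ∃[ b ] b ∈ A × b ∈ B ×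
    (let d = ∣ ⟨ 2 · b ⟩? ∣ in Odd d × 1 ℕ.< d) ×
    HasCosetDecomposition b A B

{-# OPTIONS --safe #-}
-- Since |A| + |B| = |G| + L_S, an element z is an exception exactly when
-- x ↦ z - x exchanges A with the complement of B up to the pairs with x - y ∈ S;
-- as L_S = |S| L(G), this forces S + z ⊆ 2G, so halves exist.  Reflecting through three exceptions in turn shows that the
-- relation "e′ - e ∈ S - s" on the set E of exceptions has an edge inside every
-- ordered triple.  The non-neighbours of e ∈ E therefore have all their
-- differences in S - s, whence |E| ≤ 2|S|; equality forces S - s = Σ to be a
-- subgroup and E to be the union of two of its cosets, at distance 2b.  Modulo Σ,
-- composing the reflections at the exceptions 0 and 2b gives the translation by
-- 2b, which preserves A and B outside K + H and interleaves them inside K + H.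
-- Conversely the structure makes both cosets exceptional.
module Submission where

import Algebra.Properties.AbelianGroup as AbelianGroupProperties
import Algebra.Properties.CommutativeSemigroup as CommutativeSemigroupProperties
import Algebra.Properties.Monoid.Mult as Mult
open import Data.Empty using (⊥-elim)
open import Data.Fin.Base as Fin using (Fin; zero; suc; toℕ; punchIn; punchOut)
import Data.Fin.Properties as Fin
open import Data.Integer.Base as ℤ using (ℤ; -[1+_]; _⊖_)
import Data.Integer.Properties as ℤ
open import Data.List.Base using
  (List; []; _∷_; _++_; concatMap; deduplicate; filter; length; lookup; map; tabulate)
import Data.List.Extrema.Nat as Extrema
open import Data.List.Membership.Propositional using () renaming (_∈_ to _∈≡_)
open import Data.List.Membership.Propositional.Properties using (∈-lookup)
import Data.List.Membership.Setoid as Membership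
import Data.List.Membership.Setoid.Properties as Membershipₚ
import Data.List.Properties as List
open import Data.List.Relation.Unary.All as All using (All; []; _∷_)
import Data.List.Relation.Unary.All.Properties as All
open import Data.List.Relation.Unary.AllPairs as AllPairs using (AllPairs; []; _∷_)
import Data.List.Relation.Unary.AllPairs.Properties as AllPairs
open import Data.List.Relation.Unary.Any as Any using (Any; any?; here; index; there)
import Data.List.Relation.Unary.Any.Properties as Any
import Data.List.Relation.Unary.Unique.DecSetoid.Properties as UniqueDec
open import Data.List.Relation.Unary.Unique.Setoid using (Unique)
import Data.List.Relation.Unary.Unique.Setoid.Properties as Unique
open import Data.Nat.Base as ℕ using (ℕ; zero; suc)
import Data.Nat.DivMod as ℕ
open import Data.Nat.Divisibility as ℕ using (_∣_)
open import Data.Nat.Induction using (<-rec)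
import Data.Nat.Properties as ℕ
open import Data.Product.Base using (∃; ∃-syntax; Σ-syntax; _×_; _,_; proj₁; proj₂)
open import Data.Sum.Base as Sum using (_⊎_; inj₁; inj₂; [_,_]′)
open import Data.Vec.Base as Vec using (Vec; []; _∷_; replicate; zipWith)
open import Data.Vec.N-ary using (Eq; N-ary; curryⁿ; curryⁿ-cong)
open import Defs
open import Function.Base using (_∘_; id)
open import Function.Bundles using (_⇔_; mk⇔)
open import Level using (Level; _⊔_)
open import Relation.Binary.Bundles using (DecSetoid; Setoid)
open import Relation.Binary.Core using (Rel)
open import Relation.Binary.Definitions using (_Respects_)
open import Relation.Binary.PropositionalEquality as ≡ using (_≡_)
import Relation.Binary.Reasoning.Setoid as SetoidReasoning
import Relation.Binary.Reflection as Reflection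
open import Relation.Nullary using (Dec; ¬_; yes; no)
open import Relation.Nullary.Decidable using (map′; decidable-stable; toSum; ¬?; _×-dec_; _⊎-dec_)
open import Relation.Unary using (Pred; Decidable; Satisfiable; _∈_; _∉_; _≐_; _⊆_; _⊢_)
open import Relation.Unary.Properties using (U?)

-- Why the counts are tight: for an exception z, the pairs of A × B with sum z all have their
-- difference in S, so |A ∩ (z - B)| ≤ L_S, and |A ∪ (z - B)| ≤ |G|; these two sizes add up to |G| +
-- L_S. Each σ ∈ S is the difference of at most L(G) pairs with sum z, because 2x = z + σ, so L_S =
-- |S| L(G) leaves no σ out. The obstacle is that S - s is not known to be symmetric before the
-- extremal count is finished: until then the relation on exceptions is directed, and the order
-- inside a triple matters. The shape of A′ and B′ in K + H comes from following κ, κ + 2b, κ + 4b,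
-- ... for κ ∈ K. Membership in A′ is lost in the step after κ and can be regained only past a point
-- x with x + b ∈ K, which makes an odd multiple of 2b vanish. So d is odd, and after about half a
-- turn the orbit is back in A′, at the odd multiples b, 3b, ..., (d - 2)b up to elements of K.

private
  variable
    a c ℓ ℓ′ p q r : Level

-- Linear identities in abelian groups

infixl 6 _⊕_ _⊝_
infixr 7 _⊗_

data Expr (n : ℕ) : Set where
  var : Fin n → Expr n
  𝟘   : Expr n
  _⊕_ : Expr n → Expr n → Expr n
  ⊝_  : Expr n → Expr n

_⊝_ : ∀ {n} → Expr n → Expr n → Expr n
e ⊝ f = e ⊕ (⊝ f)

-- Unfolds exactly as `_·_` does, so that `2 ⊗ e` evaluates definitionally to a `2 · x`.
_⊗_ : ∀ {n} → ℕ → Expr n → Expr n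
zero  ⊗ e = 𝟘
suc k ⊗ e = e ⊕ k ⊗ e

module AbelianGroupSolver (Γ : FiniteAbelianGroup c ℓ) where
  open FiniteAbelianGroup Γ
  open Subsets Γ using (_·_; _·ℤ_)
  open AbelianGroupProperties abelianGroup
    using (⁻¹-∙-comm; ⁻¹-involutive; ε⁻¹≈ε)
  open CommutativeSemigroupProperties commutativeSemigroup using (interchange)
  open Mult monoid using (×-homo-+)
  open SetoidReasoning setoid

  ⊖-·ℤ : ∀ m n a → (m ⊖ n) ·ℤ a ≈ m · a - n · a
  ⊖-·ℤ m zero a = sym (trans (+-congˡ ε⁻¹≈ε) (identityʳ _))
  ⊖-·ℤ zero (suc n) a = sym (identityˡ _)
  ⊖-·ℤ (suc m) (suc n) a = begin
    (suc m ⊖ suc n) ·ℤ a      ≡⟨ ≡.cong (_·ℤ a) (ℤ.[1+m]⊖[1+n]≡m⊖n m n) ⟩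
    (m ⊖ n) ·ℤ a              ≈⟨ ⊖-·ℤ m n a ⟩
    m · a - n · a             ≈⟨ identityˡ _ ⟨
    0# + (m · a - n · a)      ≈⟨ +-congʳ (inverseʳ a) ⟨
    (a - a) + (m · a - n · a) ≈⟨ interchange _ _ _ _ ⟩
    suc m · a + (- a - n · a) ≈⟨ +-congˡ (⁻¹-∙-comm _ _) ⟩
    suc m · a - suc n · a     ∎

  +-·ℤ : ∀ i j a → (i ℤ.+ j) ·ℤ a ≈ i ·ℤ a + j ·ℤ a
  +-·ℤ (ℤ.+ m)  (ℤ.+ n)  a = ×-homo-+ a m n
  +-·ℤ (ℤ.+ m)  -[1+ n ] a = ⊖-·ℤ m (suc n) a
  +-·ℤ -[1+ m ] (ℤ.+ n)  a = trans (⊖-·ℤ n (suc m) a) (comm _ _)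
  +-·ℤ -[1+ m ] -[1+ n ] a = begin
    - (suc (suc (m ℕ.+ n)) · a)   ≡⟨ ≡.cong (λ k → - (k · a)) (ℕ.+-suc (suc m) n) ⟨
    - ((suc m ℕ.+ suc n) · a)     ≈⟨ ⁻¹-cong (×-homo-+ a (suc m) (suc n)) ⟩
    - (suc m · a + suc n · a)     ≈⟨ ⁻¹-∙-comm _ _ ⟨
    - (suc m · a) - suc n · a     ∎

  neg-·ℤ : ∀ i a → (ℤ.- i) ·ℤ a ≈ - (i ·ℤ a)
  neg-·ℤ (ℤ.+ zero)  a = sym ε⁻¹≈ε
  neg-·ℤ (ℤ.+ suc n) a = refl
  neg-·ℤ -[1+ n ]    a = sym (⁻¹-involutive _)

  private
    variable
      n : ℕ

    ⟦_⟧ : Expr n → Vec Carrier n → Carrier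
    ⟦ var i ⟧ ρ = Vec.lookup ρ i
    ⟦ 𝟘 ⟧     ρ = 0#
    ⟦ e ⊕ f ⟧ ρ = ⟦ e ⟧ ρ + ⟦ f ⟧ ρ
    ⟦ ⊝ e ⟧   ρ = - ⟦ e ⟧ ρ

    linear : Vec ℤ n → Vec Carrier n → Carrier
    linear []       []       = 0#
    linear (i ∷ is) (a ∷ ρ) = i ·ℤ a + linear is ρ

    unit : Fin n → Vec ℤ n
    unit zero    = ℤ.+ 1 ∷ replicate _ (ℤ.+ 0)
    unit (suc i) = ℤ.+ 0 ∷ unit i

    normalise : Expr n → Vec ℤ n
    normalise (var i) = unit i
    normalise 𝟘       = replicate _ (ℤ.+ 0)
    normalise (e ⊕ f) = zipWith ℤ._+_ (normalise e) (normalise f)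
    normalise (⊝ e)   = Vec.map ℤ.-_ (normalise e)

    ⟦_⇓⟧ : Expr n → Vec Carrier n → Carrier
    ⟦ e ⇓⟧ ρ = linear (normalise e) ρ

    linear-0 : (ρ : Vec Carrier n) → linear (replicate n (ℤ.+ 0)) ρ ≈ 0#
    linear-0 []      = refl
    linear-0 (a ∷ ρ) = trans (identityˡ _) (linear-0 ρ)

    linear-unit : ∀ i (ρ : Vec Carrier n) → linear (unit i) ρ ≈ Vec.lookup ρ i
    linear-unit zero    (a ∷ ρ) = trans (+-cong (identityʳ a) (linear-0 ρ)) (identityʳ a)
    linear-unit (suc i) (a ∷ ρ) = trans (identityˡ _) (linear-unit i ρ)

    linear-+ : ∀ is js (ρ : Vec Carrier n) →
               linear (zipWith ℤ._+_ is js) ρ ≈ linear is ρ + linear js ρ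
    linear-+ []       []       []      = sym (identityˡ 0#)
    linear-+ (i ∷ is) (j ∷ js) (a ∷ ρ) =
      trans (+-cong (+-·ℤ i j a) (linear-+ is js ρ)) (interchange _ _ _ _)

    linear-neg : ∀ is (ρ : Vec Carrier n) → linear (Vec.map ℤ.-_ is) ρ ≈ - linear is ρ
    linear-neg []       []      = sym ε⁻¹≈ε
    linear-neg (i ∷ is) (a ∷ ρ) =
      trans (+-cong (neg-·ℤ i a) (linear-neg is ρ)) (⁻¹-∙-comm _ _)

    correct : ∀ (e : Expr n) ρ → ⟦ e ⇓⟧ ρ ≈ ⟦ e ⟧ ρ
    correct (var i) ρ = linear-unit i ρ
    correct 𝟘       ρ = linear-0 ρ
    correct (e ⊕ f) ρ =
      trans (linear-+ (normalise e) (normalise f) ρ) (+-cong (correct e ρ) (correct f ρ))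
    correct (⊝ e)   ρ = trans (linear-neg (normalise e) ρ) (⁻¹-cong (correct e ρ))

  open Reflection setoid var ⟦_⟧ ⟦_⇓⟧ correct using (close)
  open Reflection setoid var ⟦_⟧ ⟦_⇓⟧ correct public using (_⊜_)

  -- Unlike Reflection.solve, this compares the coefficient vectors, which are
  -- closed terms, and not their values.
  solve : ∀ n (f : N-ary n (Expr n) (Expr n × Expr n)) (let lhs = proj₁ (close n f) ; rhs = proj₂ (close n f)) →
          normalise lhs ≡ normalise rhs → Eq n _≈_ (curryⁿ ⟦ lhs ⟧) (curryⁿ ⟦ rhs ⟧)
  solve n f eq = curryⁿ-cong _≈_ ⟦ lhs ⟧ ⟦ rhs ⟧ λ ρ → begin
    ⟦ lhs ⟧ ρ                ≈⟨ correct lhs ρ ⟨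
    linear (normalise lhs) ρ ≡⟨ ≡.cong (λ is → linear is ρ) eq ⟩
    linear (normalise rhs) ρ ≈⟨ correct rhs ρ ⟩
    ⟦ rhs ⟧ ρ                ∎
    where
    lhs = proj₁ (close n f)
    rhs = proj₂ (close n f)

  -- An equation x ≈ y follows from u ≈ v when x + v ≈ y + u holds identically;
  -- this is how hypotheses are passed to the solver.
  by-hyp : ∀ {u v x y} → u ≈ v → x + v ≈ y + u → x ≈ y
  by-hyp {u} {v} {x} {y} u≈v eq = begin
    x             ≈⟨ solve 2 (λ x v → x ⊜ x ⊕ v ⊝ v) ≡.refl x v ⟩
    x + v - v     ≈⟨ +-congʳ (trans eq (+-congˡ u≈v)) ⟩
    y + v - v     ≈⟨ solve 2 (λ y v → y ⊕ v ⊝ v ⊜ y) ≡.refl y v ⟩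
    y             ∎

-- Cardinalities

all-lookup : {A : Set a} {P : Pred A p} {xs : List A} → All P xs → ∀ i → P (lookup xs i)
all-lookup pxs i = All.lookup pxs (∈-lookup i)

module _ (S : Setoid c ℓ) where
  open Setoid S

  lookup-injective : ∀ {xs} → Unique S xs → ∀ i j → lookup xs i ≈ lookup xs j → i ≡ j
  lookup-injective (x∉ ∷ u) zero    zero    eq = ≡.refl
  lookup-injective (x∉ ∷ u) zero    (suc j) eq = ⊥-elim (all-lookup x∉ j eq)
  lookup-injective (x∉ ∷ u) (suc i) zero    eq = ⊥-elim (all-lookup x∉ i (sym eq))
  lookup-injective (x∉ ∷ u) (suc i) (suc j) eq = ≡.cong suc (lookup-injective u i j eq)

  -- Meant for an equivalence coarser than equality, where only propositional equality of two
  -- entries lets a property pass from one to the other.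
  unique⇒≡ : ∀ {xs} → Unique S xs → ∀ {x y} → x ∈≡ xs → y ∈≡ xs → x ≈ y → x ≡ y
  unique⇒≡ {xs} u x∈ y∈ x≈y = ≡.trans (Any.lookup-index x∈)
    (≡.trans (≡.cong (lookup xs) (lookup-injective u _ _
      (trans (sym (reflexive (Any.lookup-index x∈))) (trans x≈y (reflexive (Any.lookup-index y∈))))))
    (≡.sym (Any.lookup-index y∈)))

  module _ {P : Pred Carrier p} {Y : Set q} (R : Carrier → Y → Set r)
           (R-inj : ∀ {x x′ y} → x ∈ P → x′ ∈ P → R x y → R x′ y → x ≈ x′) where

    -- Pigeonhole on positions. A relation stands in place of a map so that both plain equality and
    -- `f x ≈ y` along a map `f` between setoids are instances.
    unique⇒length≤ : ∀ {xs ys} → Unique S xs → All P xs → (∀ {x} → x ∈ P → Any (R x) ys) →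
                     length xs ℕ.≤ length ys
    unique⇒length≤ {xs} {ys} u pxs total = Fin.injective⇒≤ f-injective
      where
      f : Fin (length xs) → Fin (length ys)
      f i = index (total (all-lookup pxs i))

      at : ∀ i → R (lookup xs i) (lookup ys (f i))
      at i = Any.lookup-index (total (all-lookup pxs i))

      f-injective : ∀ {i j} → f i ≡ f j → i ≡ j
      f-injective {i} {j} fi≡fj = lookup-injective u i j
        (R-inj (all-lookup pxs i) (all-lookup pxs j)
          (≡.subst (R (lookup xs i) ∘ lookup ys) fi≡fj (at i)) (at j))

module Cardinality (X : FiniteSetoid c ℓ) where
  open FiniteSetoid X
  open Membership setoid using () renaming (_∈_ to _∈ˡ_)

  members : {P : Pred Carrier p} → Decidable P → List Carrier
  members P? = deduplicate _≟_ (filter P? elements)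

  members-unique : {P : Pred Carrier p} (P? : Decidable P) → Unique setoid (members P?)
  members-unique P? = UniqueDec.deduplicate-! decSetoid (filter P? elements)

  members-all : {P : Pred Carrier p} (P? : Decidable P) → All P (members P?)
  members-all P? = All.deduplicate⁺ _≟_ (All.all-filter P? elements)

  ∈-members : {P : Pred Carrier p} (P? : Decidable P) → P Respects _≈_ →
              ∀ {x} → x ∈ P → x ∈ˡ members P?
  ∈-members P? P-resp x∈P = Membershipₚ.∈-deduplicate⁺ setoid _≟_ (λ y≈x y≈z → trans y≈z (sym y≈x))
    (Membershipₚ.∈-filter⁺ setoid P? P-resp (enumeration _) x∈P)

  unique⇒length≤card : {P : Pred Carrier p} (P? : Decidable P) → P Respects _≈_ →
                       ∀ {xs} → Unique setoid xs → All P xs → length xs ℕ.≤ ∣ P? ∣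
  unique⇒length≤card P? P-resp u pxs =
    unique⇒length≤ setoid _≈_ (λ _ _ x≈y x′≈y → trans x≈y (sym x′≈y))
      u pxs (∈-members P? P-resp)

  card≤length : {P : Pred Carrier p} (P? : Decidable P) →
                ∀ {ys} → (∀ {x} → x ∈ P → x ∈ˡ ys) → ∣ P? ∣ ℕ.≤ length ys
  card≤length P? = unique⇒length≤ setoid _≈_ (λ _ _ x≈y x′≈y → trans x≈y (sym x′≈y))
    (members-unique P?) (members-all P?)

  card-mono : {P : Pred Carrier p} (P? : Decidable P) {Q : Pred Carrier q} (Q? : Decidable Q) →
              Q Respects _≈_ → P ⊆ Q → ∣ P? ∣ ℕ.≤ ∣ Q? ∣
  card-mono P? Q? Q-resp P⊆Q = card≤length P? (∈-members Q? Q-resp ∘ P⊆Q)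

  card-inhabited : {P : Pred Carrier p} (P? : Decidable P) → P Respects _≈_ →
                   ∀ {x} → x ∈ P → 1 ℕ.≤ ∣ P? ∣
  card-inhabited P? P-resp x∈P = unique⇒length≤card P? P-resp ([] ∷ []) (x∈P ∷ [])

  card-cover : {P : Pred Carrier p} (P? : Decidable P) {Q : Pred Carrier q} (Q? : Decidable Q)
               {R : Pred Carrier r} (R? : Decidable R) →
               Q Respects _≈_ → R Respects _≈_ → (∀ {x} → x ∈ P → x ∈ Q ⊎ x ∈ R) →
               ∣ P? ∣ ℕ.≤ ∣ Q? ∣ ℕ.+ ∣ R? ∣
  card-cover P? Q? R? Q-resp R-resp P⊆Q∪R = ≡.subst (∣ P? ∣ ℕ.≤_) (List.length-++ (members Q?))
    (card≤length P? ([ Any.++⁺ˡ ∘ ∈-members Q? Q-resp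
                     , Any.++⁺ʳ (members Q?) ∘ ∈-members R? R-resp ]′ ∘ P⊆Q∪R))

  card-disjoint : {P : Pred Carrier p} (P? : Decidable P) {Q : Pred Carrier q} (Q? : Decidable Q)
                  {R : Pred Carrier r} (R? : Decidable R) →
                  P Respects _≈_ → R Respects _≈_ →
                  P ⊆ R → Q ⊆ R → (∀ {x} → x ∈ P → x ∉ Q) →
                  ∣ P? ∣ ℕ.+ ∣ Q? ∣ ℕ.≤ ∣ R? ∣
  card-disjoint P? Q? R? P-resp R-resp P⊆R Q⊆R disj =
    ≡.subst (ℕ._≤ ∣ R? ∣) (List.length-++ (members P?))
      (unique⇒length≤card R? R-resp
        (Unique.++⁺ setoid (members-unique P?) (members-unique Q?)
          λ (x∈P , x∈Q) → let y , y∈Q , x≈y = find x∈Q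
                              z , z∈P , x≈z = find x∈P
                          in disj (P-resp (trans (sym x≈z) x≈y) z∈P) y∈Q)
        (All.++⁺ (All.map P⊆R (members-all P?)) (All.map Q⊆R (members-all Q?))))
    where
    find : ∀ {S : Pred Carrier a} {S? : Decidable S} {x} → x ∈ˡ members S? → ∃[ y ] y ∈ S × x ≈ y
    find {S? = S?} x∈ = Any.lookup x∈ , All.lookupAny (members-all S?) x∈

  -- A point of `Q` outside `P` would give, together with `P`, at least one element too many in `Q`.
  -- Through this lemma each equality case of a count becomes a statement about membership.
  ⊆-card⇒⊇ : {P : Pred Carrier p} (P? : Decidable P) {Q : Pred Carrier q} (Q? : Decidable Q) →
             P Respects _≈_ → Q Respects _≈_ → P ⊆ Q → ∣ Q? ∣ ℕ.≤ ∣ P? ∣ → Q ⊆ P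
  ⊆-card⇒⊇ P? Q? P-resp Q-resp P⊆Q ∣Q∣≤∣P∣ {x} x∈Q with P? x
  ... | yes x∈P = x∈P
  ... | no  x∉P = ⊥-elim (ℕ.<-irrefl ≡.refl (begin-strict
    ∣ P? ∣                ≡⟨ ℕ.+-identityʳ _ ⟨
    ∣ P? ∣ ℕ.+ 0          <⟨ ℕ.+-monoʳ-< ∣ P? ∣ (card-inhabited (_≟ x) (λ y≈z y≈x → trans (sym y≈z) y≈x) refl) ⟩
    ∣ P? ∣ ℕ.+ ∣ _≟ x ∣   ≤⟨ card-disjoint P? (_≟ x) Q? P-resp Q-resp P⊆Q
                             (λ y≈x → Q-resp (sym y≈x) x∈Q) (λ y∈P y≈x → x∉P (P-resp y≈x y∈P)) ⟩
    ∣ Q? ∣                ≤⟨ ∣Q∣≤∣P∣ ⟩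
    ∣ P? ∣                ∎))
    where open ℕ.≤-Reasoning

  card-complement : {P : Pred Carrier p} (P? : Decidable P) → P Respects _≈_ →
                    ∣ P? ∣ ℕ.+ ∣ ¬? ∘ P? ∣ ≡ order
  card-complement P? P-resp = ℕ.≤-antisym
    (card-disjoint P? (¬? ∘ P?) U? P-resp _ _ _ (λ x∈P x∉P → x∉P x∈P))
    (card-cover U? P? (¬? ∘ P?) P-resp (λ x≈y x∉P y∈P → x∉P (P-resp (sym x≈y) y∈P))
      (λ {x} _ → toSum (P? x)))

  card-⋃ : {Y : Set a} {P : Pred Carrier p} (P? : Decidable P)
           {F : Y → Pred Carrier q} (F? : ∀ y → Decidable (F y)) → (∀ y → F y Respects _≈_) →
           ∀ {n} ys → (∀ {x} → x ∈ P → Any (λ y → x ∈ F y) ys) → (∀ y → ∣ F? y ∣ ℕ.≤ n) →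
           ∣ P? ∣ ℕ.≤ length ys ℕ.* n
  card-⋃ P? {F} F? F-resp {n} ys P⊆⋃ F≤n =
    ℕ.≤-trans (card≤length P? (collect ys ∘ P⊆⋃)) (length-bound ys)
    where
    all = concatMap (members ∘ F?)

    collect : ∀ ys {x} → Any (λ y → x ∈ F y) ys → x ∈ˡ all ys
    collect (y ∷ ys) (here x∈)  = Any.++⁺ˡ (∈-members (F? y) (F-resp y) x∈)
    collect (y ∷ ys) (there x∈) = Any.++⁺ʳ (members (F? y)) (collect ys x∈)

    length-bound : ∀ ys → length (all ys) ℕ.≤ length ys ℕ.* n
    length-bound []       = ℕ.z≤n
    length-bound (y ∷ ys) = ≡.subst (ℕ._≤ n ℕ.+ length ys ℕ.* n)
      (≡.sym (List.length-++ (members (F? y)))) (ℕ.+-mono-≤ (F≤n y) (length-bound ys))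

  -- The lower bound that matches `card-⋃` when the pieces are disjoint; the two together give the
  -- index of a subgroup.
  length*≤card : {Y : Set a} {F : Y → Pred Carrier q} (F? : ∀ y → Decidable (F y)) →
                 (∀ y → F y Respects _≈_) →
                 ∀ {n} → (∀ y → n ℕ.≤ ∣ F? y ∣) →
                 ∀ {ys} → AllPairs.AllPairs (λ y z → ∀ {x} → x ∈ F y → x ∉ F z) ys →
                 length ys ℕ.* n ℕ.≤ ∣ (λ x → any? (λ y → F? y x) ys) ∣
  length*≤card F? F-resp n≤ [] = ℕ.z≤n
  length*≤card F? F-resp n≤ {y ∷ ys} (y# ∷ ys#) = ℕ.≤-trans
    (ℕ.+-mono-≤ (n≤ y) (length*≤card F? F-resp n≤ ys#))
    (card-disjoint (F? y) (λ x → any? (λ z → F? z x) ys) (λ x → any? (λ z → F? z x) (y ∷ ys))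
      (F-resp y) (λ x≈x′ → Any.map (F-resp _ x≈x′)) here there
      (λ x∈Fy x∈ → let disj , x∈Fz = All.lookupAny y# x∈ in disj x∈Fy x∈Fz))

module _ (X : FiniteSetoid c ℓ) (Y : FiniteSetoid a ℓ′) where
  private
    module X = FiniteSetoid X
    module Y = FiniteSetoid Y

  card-injection : {P : Pred X.Carrier p} (P? : Decidable P) {Q : Pred Y.Carrier q} (Q? : Decidable Q) →
                   Q Respects Y._≈_ → (f : X.Carrier → Y.Carrier) → (∀ {x} → x ∈ P → f x ∈ Q) →
                   (∀ {x x′} → x ∈ P → x′ ∈ P → f x Y.≈ f x′ → x X.≈ x′) →
                   X.∣ P? ∣ ℕ.≤ Y.∣ Q? ∣
  card-injection P? Q? Q-resp f f∈ f-inj =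
    unique⇒length≤ X.setoid (λ x y → f x Y.≈ y)
      (λ x∈P x′∈P fx≈y fx′≈y → f-inj x∈P x′∈P (Y.trans fx≈y (Y.sym fx′≈y)))
      (members-unique P?) (members-all P?)
      (λ x∈P → Cardinality.∈-members Y Q? Q-resp (f∈ x∈P))
    where open Cardinality X

-- Exceptions

module _ (Γ : FiniteAbelianGroup c ℓ) where
  open FiniteAbelianGroup Γ

  -- The equality case of the count for an exception. The relation is a parameter because it is
  -- `x - y ∈ S` in the group `G` but plain equality in the quotient, after recentring.
  record Balanced (A : Pred Carrier p) (B : Pred Carrier q) (_~_ : Rel Carrier r) (z : Carrier) :
                  Set (c ⊔ ℓ ⊔ p ⊔ q ⊔ r) where
    field
      both  : ∀ {x y} → x + y ≈ z → x ~ y → x ∈ A × y ∈ B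
      only  : ∀ {x y} → x + y ≈ z → x ∈ A → y ∈ B → x ~ y
      cover : ∀ {x y} → x + y ≈ z → x ∈ A ⊎ y ∈ B

module _ (G : FiniteAbelianGroup c ℓ) where
  open FiniteAbelianGroup G
  open Subsets G
  open AbelianGroupSolver G

  -- The three alternatives arise by reflecting a half h₀ of e₀ successively
  -- through e₁, e₂, e₀, e₁ (x ↦ eᵢ - x swaps membership in A and B up to S).
  balanced-triple :
    ∀ {A : Pred Carrier p} {B : Pred Carrier q} {S : Pred Carrier r} →
    Decidable A → S Respects _≈_ →
    ∀ {s} → s ∈ S → ∀ {e₀ e₁ e₂ h₀ h₂} →
    (let Bal = Balanced G A B (λ x y → x - y ∈ S)) →
    Bal e₀ → Bal e₁ → Bal e₂ → 2 · h₀ ≈ e₀ + s → 2 · h₂ ≈ e₂ + s →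
    e₁ - e₂ + s ∈ S ⊎ e₁ - e₀ + s ∈ S ⊎ e₀ - e₂ + s ∈ S
  balanced-triple {A = A} {B} {S} A? S-resp {s} s∈S {e₀} {e₁} {e₂} {h₀} {h₂} bal₀ bal₁ bal₂ 2h₀≈ 2h₂≈ =
    reflect₁ (A? x₁)
    where
    open Balanced
    x₁ = e₁ - (e₀ - h₀)
    x₂ = h₀ + (e₁ - e₂)
    x₃ = h₂ + (e₁ - e₂)

    half : ∀ {e h} → Balanced G A B (λ x y → x - y ∈ S) e → 2 · h ≈ e + s → h ∈ A × e - h ∈ B
    half {e} {h} bal 2h≈ = both bal
      (solve 2 (λ e h → h ⊕ (e ⊝ h) ⊜ e) ≡.refl e h)
      (S-resp (by-hyp (sym 2h≈) (solve 3 (λ e h s → s ⊕ 2 ⊗ h ⊜ h ⊝ (e ⊝ h) ⊕ (e ⊕ s)) ≡.refl e h s)) s∈S)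

    reflect₃ : e₁ - x₂ ∈ B → e₀ - e₂ + s ∈ S
    reflect₃ ∈B = S-resp
      (by-hyp 2h₀≈ (solve 5 (λ e₀ e₁ e₂ h₀ s →
        h₀ ⊝ (e₁ ⊝ (h₀ ⊕ (e₁ ⊝ e₂))) ⊕ (e₀ ⊕ s) ⊜ e₀ ⊝ e₂ ⊕ s ⊕ 2 ⊗ h₀) ≡.refl e₀ e₁ e₂ h₀ s))
      (only bal₂ (solve 3 (λ e₁ e₂ h₀ → h₀ ⊕ (e₁ ⊝ (h₀ ⊕ (e₁ ⊝ e₂))) ⊜ e₂) ≡.refl e₁ e₂ h₀)
        (proj₁ (half bal₀ 2h₀≈)) ∈B)

    reflect₂ : Dec (x₂ ∈ A) → e₂ - x₁ ∈ B → e₁ - e₂ + s ∈ S ⊎ e₁ - e₀ + s ∈ S ⊎ e₀ - e₂ + s ∈ S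
    reflect₂ (no x₂∉A) _ = inj₂ (inj₂ (reflect₃ ([ ⊥-elim ∘ x₂∉A , id ]′ (cover bal₁
      (solve 3 (λ e₁ e₂ h₀ → h₀ ⊕ (e₁ ⊝ e₂) ⊕ (e₁ ⊝ (h₀ ⊕ (e₁ ⊝ e₂))) ⊜ e₁) ≡.refl e₁ e₂ h₀)))))
    reflect₂ (yes x₂∈A) ∈B = inj₁ (S-resp
      (by-hyp 2h₂≈ (solve 4 (λ e₁ e₂ h₂ s →
        h₂ ⊕ (e₁ ⊝ e₂) ⊝ (e₂ ⊝ h₂) ⊕ (e₂ ⊕ s) ⊜ e₁ ⊝ e₂ ⊕ s ⊕ 2 ⊗ h₂) ≡.refl e₁ e₂ h₂ s))
      (only bal₁ (solve 3 (λ e₁ e₂ h₂ → h₂ ⊕ (e₁ ⊝ e₂) ⊕ (e₂ ⊝ h₂) ⊜ e₁) ≡.refl e₁ e₂ h₂)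
        x₃∈A (proj₂ (half bal₂ 2h₂≈))))
      where
      2[e₁-e₂]+s∈S : x₂ - (e₂ - x₁) ∈ S
      2[e₁-e₂]+s∈S = only bal₀
        (solve 4 (λ e₀ e₁ e₂ h₀ → h₀ ⊕ (e₁ ⊝ e₂) ⊕ (e₂ ⊝ (e₁ ⊝ (e₀ ⊝ h₀))) ⊜ e₀) ≡.refl e₀ e₁ e₂ h₀)
        x₂∈A ∈B
      -- The difference just found equals `2(e₁ - e₂) + s`, from which `e₀` has disappeared. The
      -- half `h₂`, moved by `e₁ - e₂`, realises the same difference with sum `e₂`, so balance at
      -- `e₂` applies.
      x₃∈A : x₃ ∈ A
      x₃∈A = proj₁ (both bal₂
        (solve 3 (λ e₁ e₂ h₂ → h₂ ⊕ (e₁ ⊝ e₂) ⊕ (e₂ ⊝ (h₂ ⊕ (e₁ ⊝ e₂))) ⊜ e₂) ≡.refl e₁ e₂ h₂)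
        (S-resp (by-hyp (+-cong 2h₀≈ (sym 2h₂≈)) (solve 6 (λ e₀ e₁ e₂ h₀ h₂ s →
          h₀ ⊕ (e₁ ⊝ e₂) ⊝ (e₂ ⊝ (e₁ ⊝ (e₀ ⊝ h₀))) ⊕ (e₀ ⊕ s ⊕ 2 ⊗ h₂) ⊜
          h₂ ⊕ (e₁ ⊝ e₂) ⊝ (e₂ ⊝ (h₂ ⊕ (e₁ ⊝ e₂))) ⊕ (2 ⊗ h₀ ⊕ (e₂ ⊕ s))) ≡.refl e₀ e₁ e₂ h₀ h₂ s))
          2[e₁-e₂]+s∈S))

    reflect₁ : Dec (x₁ ∈ A) → e₁ - e₂ + s ∈ S ⊎ e₁ - e₀ + s ∈ S ⊎ e₀ - e₂ + s ∈ S
    reflect₁ (yes x₁∈A) = inj₂ (inj₁ (S-resp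
      (by-hyp 2h₀≈ (solve 4 (λ e₀ e₁ h₀ s →
        e₁ ⊝ (e₀ ⊝ h₀) ⊝ (e₀ ⊝ h₀) ⊕ (e₀ ⊕ s) ⊜ e₁ ⊝ e₀ ⊕ s ⊕ 2 ⊗ h₀) ≡.refl e₀ e₁ h₀ s))
      (only bal₁ (solve 3 (λ e₀ e₁ h₀ → e₁ ⊝ (e₀ ⊝ h₀) ⊕ (e₀ ⊝ h₀) ⊜ e₁) ≡.refl e₀ e₁ h₀)
        x₁∈A (proj₂ (half bal₀ 2h₀≈)))))
    reflect₁ (no x₁∉A) = reflect₂ (A? x₂) ([ ⊥-elim ∘ x₁∉A , id ]′ (cover bal₂
      (solve 4 (λ e₀ e₁ e₂ h₀ → e₁ ⊝ (e₀ ⊝ h₀) ⊕ (e₂ ⊝ (e₁ ⊝ (e₀ ⊝ h₀))) ⊜ e₂) ≡.refl e₀ e₁ e₂ h₀)))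

module _ {c ℓ p : Level} (G : FiniteAbelianGroup c ℓ) where
  open FiniteAbelianGroup G
  open Subsets G

  module Exceptions
    {A B S : Pred Carrier p}
    (A-resp : A Respects _≈_) (B-resp : B Respects _≈_) (S-resp : S Respects _≈_)
    (A? : Decidable A) (B? : Decidable B) (S? : Decidable S)
    (∣A∣+∣B∣ : ∣ A? ∣ ℕ.+ ∣ B? ∣ ≡ order ℕ.+ Lᴹ S?)
    (Lᴹ≡ : Lᴹ S? ≡ ∣ S? ∣ ℕ.* L)
    where

    open AbelianGroupSolver G
    open Cardinality finiteSetoid
    private
      module G² = FiniteSetoid (finiteSetoid ×ᶠ finiteSetoid)
      module C² = Cardinality (finiteSetoid ×ᶠ finiteSetoid)

    -- Taken as the plain complement of `A ∧[ S ] B`, so that the two sizes add up to `order`. Since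
    -- `S` is inhabited, its members do lie in `A ∔ B`: `halves` gives a pair with difference in
    -- `S`, and `both` puts that pair into `A` and `B`.
    E : Pred Carrier _
    E z = z ∉ A ∧[ S ] B

    Pairs-resp : ∀ z → Pairs S z Respects G²._≈_
    Pairs-resp z (x≈x′ , y≈y′) (x+y≈z , x-y∈S) =
      trans (+-cong (sym x≈x′) (sym y≈y′)) x+y≈z , S-resp (minus-cong x≈x′ y≈y′) x-y∈S

    Lᶻ≤Lᴹ : ∀ z → Lᶻ S? z ℕ.≤ Lᴹ S?
    Lᶻ≤Lᴹ z = Extrema.v≤max⁺ 0 _ (inj₂ (Any.map⁺ (Any.map (λ {w} z≈w →
      C².card-mono (pairs? S? z) (pairs? S? w) (Pairs-resp w)
        (λ (x+y≈z , x-y∈S) → trans x+y≈z z≈w , x-y∈S)) (enumeration z))))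

    module _ {z} (z∈E : z ∈ E) where
      private
        B∗ : Pred Carrier _
        B∗ x = z - x ∈ B

        B∗-resp : B∗ Respects _≈_
        B∗-resp x≈y = B-resp (minus-cong refl x≈y)

        B∗? : Decidable B∗
        B∗? x = B? (z - x)

        ∩? : Decidable (λ x → x ∈ A × x ∈ B∗)
        ∩? x = A? x ×-dec B∗? x

        ∪? : Decidable (λ x → x ∈ A ⊎ x ∈ B∗)
        ∪? x = A? x ⊎-dec B∗? x

        ∖? : Decidable (λ x → x ∈ A × x ∉ B∗)
        ∖? x = A? x ×-dec ¬? (B∗? x)

        ∩-resp : (λ x → x ∈ A × x ∈ B∗) Respects _≈_
        ∩-resp x≈y (x∈A , x∈B∗) = A-resp x≈y x∈A , B∗-resp x≈y x∈B∗

        ∪-resp : (λ x → x ∈ A ⊎ x ∈ B∗) Respects _≈_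
        ∪-resp x≈y = Sum.map (A-resp x≈y) (B∗-resp x≈y)

        ∖-resp : (λ x → x ∈ A × x ∉ B∗) Respects _≈_
        ∖-resp x≈y (x∈A , x∉B∗) = A-resp x≈y x∈A , x∉B∗ ∘ B∗-resp (sym x≈y)

        x+[z-x]≈z : ∀ x → x + (z - x) ≈ z
        x+[z-x]≈z x = solve 2 (λ x z → x ⊕ (z ⊝ x) ⊜ z) ≡.refl x z

        P : Pred (Carrier × Carrier) _
        P (x , y) = x + y ≈ z × x ∈ A × y ∈ B

        P? : Decidable P
        P? (x , y) = (x + y ≟ z) ×-dec (A? x ×-dec B? y)

        P-resp : P Respects G²._≈_
        P-resp (x≈x′ , y≈y′) (x+y≈z , x∈A , y∈B) =
          trans (+-cong (sym x≈x′) (sym y≈y′)) x+y≈z , A-resp x≈x′ x∈A , B-resp y≈y′ y∈B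

        only′ : ∀ {x y} → x + y ≈ z → x ∈ A → y ∈ B → x - y ∈ S
        only′ {x} {y} x+y≈z x∈A y∈B with S? (x - y)
        ... | yes x-y∈S = x-y∈S
        ... | no  x-y∉S = ⊥-elim (z∈E (x , y , x∈A , y∈B , x-y∉S , sym x+y≈z))

        P⊆Pairs : P ⊆ Pairs S z
        P⊆Pairs (x+y≈z , x∈A , y∈B) = x+y≈z , only′ x+y≈z x∈A y∈B

        ∣∩∣≤∣P∣ : ∣ ∩? ∣ ℕ.≤ G².∣ P? ∣
        ∣∩∣≤∣P∣ = card-injection finiteSetoid (finiteSetoid ×ᶠ finiteSetoid) ∩? P? P-resp
          (λ x → x , z - x) (λ {x} (x∈A , x∈B∗) → x+[z-x]≈z x , x∈A , x∈B∗) (λ _ _ → proj₁)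

        ∣P∣≤Lᶻ : G².∣ P? ∣ ℕ.≤ Lᶻ S? z
        ∣P∣≤Lᶻ = C².card-mono P? (pairs? S? z) (Pairs-resp z) P⊆Pairs

        -- Inclusion-exclusion for `A` and the reflected set `z - B`: the map `y ↦ z - y` compares
        -- `B` with `B∗`, and `A` is split along `B∗`.
        order+Lᴹ≤ : order ℕ.+ Lᴹ S? ℕ.≤ ∣ ∪? ∣ ℕ.+ ∣ ∩? ∣
        order+Lᴹ≤ = begin
          order ℕ.+ Lᴹ S?                       ≡⟨ ∣A∣+∣B∣ ⟨
          ∣ A? ∣ ℕ.+ ∣ B? ∣                     ≤⟨ ℕ.+-mono-≤
            (card-cover A? ∖? ∩? ∖-resp ∩-resp (λ {x} → split x))
            (card-injection finiteSetoid finiteSetoid B? B∗? B∗-resp (λ y → z - y)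
              (λ {y} → B-resp (solve 2 (λ y z → y ⊜ z ⊝ (z ⊝ y)) ≡.refl y z))
              λ {y} {y′} _ _ eq → by-hyp (sym eq) (solve 3 (λ y y′ z → y ⊕ (z ⊝ y) ⊜ y′ ⊕ (z ⊝ y′)) ≡.refl y y′ z)) ⟩
          (∣ ∖? ∣ ℕ.+ ∣ ∩? ∣) ℕ.+ ∣ B∗? ∣       ≡⟨ ℕ.+-assoc ∣ ∖? ∣ _ _ ⟩
          ∣ ∖? ∣ ℕ.+ (∣ ∩? ∣ ℕ.+ ∣ B∗? ∣)       ≡⟨ ≡.cong (∣ ∖? ∣ ℕ.+_) (ℕ.+-comm ∣ ∩? ∣ _) ⟩
          ∣ ∖? ∣ ℕ.+ (∣ B∗? ∣ ℕ.+ ∣ ∩? ∣)       ≡⟨ ℕ.+-assoc ∣ ∖? ∣ _ _ ⟨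
          (∣ ∖? ∣ ℕ.+ ∣ B∗? ∣) ℕ.+ ∣ ∩? ∣       ≤⟨ ℕ.+-monoˡ-≤ ∣ ∩? ∣
            (card-disjoint ∖? B∗? ∪? ∖-resp ∪-resp (inj₁ ∘ proj₁) inj₂ proj₂) ⟩
          ∣ ∪? ∣ ℕ.+ ∣ ∩? ∣                     ∎
          where
          open ℕ.≤-Reasoning
          split : ∀ x → x ∈ A → (x ∈ A × x ∉ B∗) ⊎ (x ∈ A × x ∈ B∗)
          split x x∈A with B∗? x
          ... | yes x∈B∗ = inj₂ (x∈A , x∈B∗)
          ... | no  x∉B∗ = inj₁ (x∈A , x∉B∗)

        -- Here and in `order≤∣∪∣`, the sum of the sizes of union and intersection reaches
        -- `order + Lᴹ`, while the union has at most `order` elements and the intersection at most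
        -- `Lᴹ`. Inserting either bound forces the other to be attained.
        Lᴹ≤∣P∣ : Lᴹ S? ℕ.≤ G².∣ P? ∣
        Lᴹ≤∣P∣ = ℕ.+-cancelˡ-≤ order _ _ (ℕ.≤-trans order+Lᴹ≤
          (ℕ.+-mono-≤ (card-mono ∪? U? _ _) ∣∩∣≤∣P∣))

        order≤∣∪∣ : order ℕ.≤ ∣ ∪? ∣
        order≤∣∪∣ = ℕ.+-cancelʳ-≤ (Lᴹ S?) _ _ (ℕ.≤-trans order+Lᴹ≤
          (ℕ.+-monoʳ-≤ ∣ ∪? ∣ (ℕ.≤-trans ∣∩∣≤∣P∣ (ℕ.≤-trans ∣P∣≤Lᶻ (Lᶻ≤Lᴹ z)))))

      balanced : Balanced G A B (λ x y → x - y ∈ S) z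
      balanced = record
        { both  = λ x+y≈z x-y∈S → proj₂ (C².⊆-card⇒⊇ P? (pairs? S? z) P-resp (Pairs-resp z)
                    P⊆Pairs (ℕ.≤-trans (Lᶻ≤Lᴹ z) Lᴹ≤∣P∣) (x+y≈z , x-y∈S))
        ; only  = only′
        ; cover = λ {x} {y} x+y≈z → Sum.map₂
                    (B-resp (by-hyp (sym x+y≈z) (solve 3 (λ x y z → z ⊝ x ⊕ (x ⊕ y) ⊜ y ⊕ z) ≡.refl x y z)))
                    (⊆-card⇒⊇ ∪? U? ∪-resp _ _ order≤∣∪∣ {x} _)
        }

      private
        Hit : Pred Carrier _
        Hit σ = σ ∈ S × ∃[ h ] 2 · h ≈ z + σ

        Hit-resp : Hit Respects _≈_
        Hit-resp σ≈τ (σ∈S , h , 2h≈) = S-resp σ≈τ σ∈S , h , trans 2h≈ (+-congˡ σ≈τ)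

        Hit? : Decidable Hit
        Hit? σ = S? σ ×-dec ∃? (λ h≈h′ → trans (+-cong (sym h≈h′) (+-congʳ (sym h≈h′))))
                               (λ h → 2 · h ≟ z + σ)

        Fibre : Carrier → Pred (Carrier × Carrier) _
        Fibre σ (x , y) = x + y ≈ z × x - y ≈ σ

        Fibre? : ∀ σ → Decidable (Fibre σ)
        Fibre? σ (x , y) = (x + y ≟ z) ×-dec (x - y ≟ σ)

        Fibre-resp : ∀ σ → Fibre σ Respects G²._≈_
        Fibre-resp σ (x≈x′ , y≈y′) (x+y≈z , x-y≈σ) =
          trans (+-cong (sym x≈x′) (sym y≈y′)) x+y≈z , trans (minus-cong (sym x≈x′) (sym y≈y′)) x-y≈σ

        -- Sum and difference determine `2 · x`, so the first components of two pairs in a fibre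
        -- differ by an element of `K`. Subtracting a fixed `x₀` therefore embeds the fibre in `K`,
        -- and an empty fibre needs no `x₀`.
        ∣Fibre∣≤L : ∀ σ → G².∣ Fibre? σ ∣ ℕ.≤ L
        ∣Fibre∣≤L σ with G².∃? (Fibre-resp σ) (Fibre? σ)
        ... | no  empty = ℕ.≤-trans (C².card≤length (Fibre? σ) {[]} (λ {w} w∈ → ⊥-elim (empty (w , w∈)))) ℕ.z≤n
        ... | yes ((x₀ , y₀) , x₀+y₀≈z , x₀-y₀≈σ) =
          card-injection (finiteSetoid ×ᶠ finiteSetoid) finiteSetoid (Fibre? σ) K?
            (λ x≈y → trans (+-cong (sym x≈y) (+-congʳ (sym x≈y))))
            (λ (x , y) → x - x₀)
            (λ {(x , y)} (x+y≈z , x-y≈σ) → by-hyp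
              (+-cong (trans x+y≈z (sym x₀+y₀≈z)) (trans x-y≈σ (sym x₀-y₀≈σ)))
              (solve 4 (λ x y x₀ y₀ → 2 ⊗ (x ⊝ x₀) ⊕ ((x₀ ⊕ y₀) ⊕ (x₀ ⊝ y₀)) ⊜ 𝟘 ⊕ ((x ⊕ y) ⊕ (x ⊝ y)))
                ≡.refl x y x₀ y₀))
            λ {(x , y)} {(x′ , y′)} (x+y≈z , _) (x′+y′≈z , _) eq →
              let x≈x′ = by-hyp eq (solve 3 (λ x x′ x₀ → x ⊕ (x′ ⊝ x₀) ⊜ x′ ⊕ (x ⊝ x₀)) ≡.refl x x′ x₀)
              in x≈x′ , by-hyp (+-cong (trans x+y≈z (sym x′+y′≈z)) (sym x≈x′))
                   (solve 4 (λ x y x′ y′ → y ⊕ (x′ ⊕ y′ ⊕ x) ⊜ y′ ⊕ (x ⊕ y ⊕ x′)) ≡.refl x y x′ y′)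

        Hit⊇fibres : ∀ {w} → w ∈ Pairs S z → Any (λ σ → w ∈ Fibre σ) (members Hit?)
        Hit⊇fibres {x , y} (x+y≈z , x-y∈S) = Any.map (λ x-y≈σ → x+y≈z , x-y≈σ)
          (∈-members Hit? Hit-resp (x-y∈S , x , by-hyp x+y≈z
            (solve 3 (λ x y z → 2 ⊗ x ⊕ z ⊜ z ⊕ (x ⊝ y) ⊕ (x ⊕ y)) ≡.refl x y z)))

        -- This is where `L_S = |S| L(G)` enters: the exception attains `Lᴹ` pairs, these are spread
        -- over the differences in `Hit`, and each difference carries at most `L` of them.
        -- Cancelling `L` is allowed because `0#` lies in `K`.
        ∣S∣≤∣Hit∣ : ∣ S? ∣ ℕ.≤ ∣ Hit? ∣
        ∣S∣≤∣Hit∣ = ℕ.*-cancelʳ-≤ _ _ L {{ℕ.>-nonZero L>0}} (begin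
          ∣ S? ∣ ℕ.* L   ≡⟨ Lᴹ≡ ⟨
          Lᴹ S?          ≤⟨ ℕ.≤-trans Lᴹ≤∣P∣ ∣P∣≤Lᶻ ⟩
          Lᶻ S? z        ≤⟨ C².card-⋃ (pairs? S? z) Fibre? Fibre-resp (members Hit?) Hit⊇fibres ∣Fibre∣≤L ⟩
          ∣ Hit? ∣ ℕ.* L ∎)
          where
          open ℕ.≤-Reasoning
          L>0 : 0 ℕ.< L
          L>0 = card-inhabited K? (λ x≈y → trans (+-cong (sym x≈y) (+-congʳ (sym x≈y)))) (·-zeroʳ 2)

      halves : ∀ {σ} → σ ∈ S → ∃[ h ] 2 · h ≈ z + σ
      halves σ∈S = proj₂ (⊆-card⇒⊇ Hit? S? Hit-resp S-resp proj₁ ∣S∣≤∣Hit∣ σ∈S)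

    E? : Decidable E
    E? z = ¬? (∧-dec A-resp S-resp B-resp A? S? B? z)

    ∧-resp : (A ∧[ S ] B) Respects _≈_
    ∧-resp z≈w (a , b , a∈A , b∈B , a-b∉S , z≈a+b) = a , b , a∈A , b∈B , a-b∉S , trans (sym z≈w) z≈a+b

    E-resp : E Respects _≈_
    E-resp z≈w z∈E = z∈E ∘ ∧-resp (sym z≈w)

    module Cosets {s} (s∈S : s ∈ S) where

      -- The translate `a + (S - s)`, named in anticipation: `S - s` becomes a subgroup only in the
      -- extremal case, so `e ∈ Coset a` may not be exchanged with `a ∈ Coset e`.
      Coset : Carrier → Pred Carrier p
      Coset a e = e - a + s ∈ S

      Coset? : ∀ a → Decidable (Coset a)
      Coset? a e = S? (e - a + s)

      Coset-resp : ∀ a → Coset a Respects _≈_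
      Coset-resp a e≈f = S-resp (+-congʳ (+-congʳ e≈f))

      ∣⊆Coset∣≤∣S∣ : {P : Pred Carrier r} (P? : Decidable P) → ∀ a → P ⊆ Coset a → ∣ P? ∣ ℕ.≤ ∣ S? ∣
      ∣⊆Coset∣≤∣S∣ P? a P⊆ = card-injection finiteSetoid finiteSetoid P? S? S-resp (λ e → e - a + s) P⊆
        (λ {x} {y} _ _ eq → by-hyp eq
          (solve 4 (λ x y a s → x ⊕ (y ⊝ a ⊕ s) ⊜ y ⊕ (x ⊝ a ⊕ s)) ≡.refl x y a s))

      ∣S∣≤∣Coset∣ : ∀ a → ∣ S? ∣ ℕ.≤ ∣ Coset? a ∣
      ∣S∣≤∣Coset∣ a = card-injection finiteSetoid finiteSetoid S? (Coset? a) (Coset-resp a) (λ σ → σ - s + a)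
        (λ {σ} → S-resp (solve 3 (λ σ s a → σ ⊜ σ ⊝ s ⊕ a ⊝ a ⊕ s) ≡.refl σ s a))
        (λ {x} {y} _ _ eq → by-hyp eq
          (solve 4 (λ x y a s → x ⊕ (y ⊝ s ⊕ a) ⊜ y ⊕ (x ⊝ s ⊕ a)) ≡.refl x y a s))

      triple : ∀ {e₀ e₁ e₂} → e₀ ∈ E → e₁ ∈ E → e₂ ∈ E →
               e₁ ∈ Coset e₂ ⊎ e₁ ∈ Coset e₀ ⊎ e₀ ∈ Coset e₂
      triple e₀∈E e₁∈E e₂∈E =
        balanced-triple G A? S-resp s∈S (balanced e₀∈E) (balanced e₁∈E) (balanced e₂∈E)
          (proj₂ (halves e₀∈E s∈S)) (proj₂ (halves e₂∈E s∈S))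

      Near Far : Carrier → Pred Carrier _
      Near a e = e ∈ E × e ∈ Coset a
      Far  a e = e ∈ E × e ∉ Coset a

      Near? : ∀ a → Decidable (Near a)
      Near? a e = E? e ×-dec Coset? a e

      Far? : ∀ a → Decidable (Far a)
      Far? a e = E? e ×-dec ¬? (Coset? a e)

      Near-resp : ∀ a → Near a Respects _≈_
      Near-resp a e≈f (e∈E , e∈) = E-resp e≈f e∈E , Coset-resp a e≈f e∈

      Far-resp : ∀ a → Far a Respects _≈_
      Far-resp a e≈f (e∈E , e∉) = E-resp e≈f e∈E , e∉ ∘ Coset-resp a (sym e≈f)

      -- Of the three alternatives for the triple `w`, `e`, `a`, two would place `e` or `w` near
      -- `a`. The order of the triple is chosen for this, as the relation is directed.
      Far⊆Coset : ∀ {a w} → a ∈ E → w ∈ Far a → Far a ⊆ Coset w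
      Far⊆Coset a∈E (w∈E , w∉) (e∈E , e∉) =
        [ ⊥-elim ∘ e∉ , [ id , ⊥-elim ∘ w∉ ]′ ]′ (triple w∈E e∈E a∈E)

      ∣Near∣≤∣S∣ : ∀ a → ∣ Near? a ∣ ℕ.≤ ∣ S? ∣
      ∣Near∣≤∣S∣ a = ∣⊆Coset∣≤∣S∣ (Near? a) a proj₂

      ∣E∣≤∣Near∣+∣Far∣ : ∀ a → ∣ E? ∣ ℕ.≤ ∣ Near? a ∣ ℕ.+ ∣ Far? a ∣
      ∣E∣≤∣Near∣+∣Far∣ a = card-cover E? (Near? a) (Far? a) (Near-resp a) (Far-resp a) split
        where
        split : ∀ {e} → e ∈ E → e ∈ Near a ⊎ e ∈ Far a
        split {e} e∈E = Sum.map (e∈E ,_) (e∈E ,_) (toSum (Coset? a e))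

      -- Bounding `Far a` requires one of its members as the centre of a translate, hence the
      -- separate empty case.
      ∣Far∣-cases : ∀ {a} → a ∈ E → ∣ Far? a ∣ ≡ 0 ⊎ (∃[ w ] w ∈ Far a × ∣ Far? a ∣ ℕ.≤ ∣ S? ∣)
      ∣Far∣-cases {a} a∈E = [ inj₂ ∘ bounded , inj₁ ∘ empty ]′ (toSum (∃? (Far-resp a) (Far? a)))
        where
        bounded : ∃ (Far a) → ∃[ w ] w ∈ Far a × ∣ Far? a ∣ ℕ.≤ ∣ S? ∣
        bounded (w , w∈) = w , w∈ , ∣⊆Coset∣≤∣S∣ (Far? a) w (Far⊆Coset a∈E w∈)

        empty : ¬ ∃ (Far a) → ∣ Far? a ∣ ≡ 0
        empty ∄ = ℕ.n≤0⇒n≡0 (card≤length (Far? a) {[]} λ {w} w∈ → ⊥-elim (∄ (w , w∈)))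

      ∣E∣≤2∣S∣ : ∀ {a} → a ∈ E → ∣ E? ∣ ℕ.≤ 2 ℕ.* ∣ S? ∣
      ∣E∣≤2∣S∣ {a} a∈E = ℕ.≤-trans (∣E∣≤∣Near∣+∣Far∣ a)
        (ℕ.+-mono-≤ (∣Near∣≤∣S∣ a) (ℕ.≤-trans ([ (λ ∣Far∣≡0 → ≡.subst (ℕ._≤ ∣ S? ∣) (≡.sym ∣Far∣≡0) ℕ.z≤n)
                                               , proj₂ ∘ proj₂ ]′ (∣Far∣-cases a∈E))
                                              (ℕ.m≤m+n _ 0)))

      module Extremal (2∣S∣≤∣E∣ : 2 ℕ.* ∣ S? ∣ ℕ.≤ ∣ E? ∣) where
        private
          ∣S∣+∣S∣≤ : ∀ a → ∣ S? ∣ ℕ.+ ∣ S? ∣ ℕ.≤ ∣ Near? a ∣ ℕ.+ ∣ Far? a ∣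
          ∣S∣+∣S∣≤ a = ℕ.≤-trans
            (ℕ.≤-reflexive (≡.cong (∣ S? ∣ ℕ.+_) (≡.sym (ℕ.+-identityʳ ∣ S? ∣))))
            (ℕ.≤-trans 2∣S∣≤∣E∣ (∣E∣≤∣Near∣+∣Far∣ a))

        -- If `Far a` were empty, `E` would have at most `|S|` elements, fewer than `2|S|` since `s`
        -- lies in `S`.
        far : ∀ {a} → a ∈ E → ∃[ w ] w ∈ Far a × ∣ Far? a ∣ ℕ.≤ ∣ S? ∣
        far {a} a∈E = [ ⊥-elim ∘ nonempty , id ]′ (∣Far∣-cases a∈E)
          where
          nonempty : ¬ ∣ Far? a ∣ ≡ 0
          nonempty ∣Far∣≡0 = ℕ.<⇒≱ (card-inhabited S? S-resp s∈S)
            (ℕ.+-cancelˡ-≤ ∣ S? ∣ _ _ (ℕ.≤-trans (∣S∣+∣S∣≤ a)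
              (ℕ.+-mono-≤ (∣Near∣≤∣S∣ a) (ℕ.≤-reflexive ∣Far∣≡0))))

        -- Near and far elements number at most `|S|` each and at least `2|S|` together, so `Near a`
        -- fills the whole translate; `Coset⊆Far` is the same count for the other half.
        Coset⊆E : ∀ {a} → a ∈ E → Coset a ⊆ E
        Coset⊆E {a} a∈E = proj₁ ∘ ⊆-card⇒⊇ (Near? a) (Coset? a) (Near-resp a) (Coset-resp a) proj₂
          (ℕ.≤-trans (∣⊆Coset∣≤∣S∣ (Coset? a) a id) (ℕ.+-cancelʳ-≤ ∣ S? ∣ _ _
            (ℕ.≤-trans (∣S∣+∣S∣≤ a) (ℕ.+-monoʳ-≤ _ (proj₂ (proj₂ (far a∈E)))))))

        Coset⊆Far : ∀ {a w} → a ∈ E → w ∈ Far a → Coset w ⊆ Far a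
        Coset⊆Far {a} {w} a∈E w∈ = ⊆-card⇒⊇ (Far? a) (Coset? w) (Far-resp a) (Coset-resp w) (Far⊆Coset a∈E w∈)
          (ℕ.≤-trans (∣⊆Coset∣≤∣S∣ (Coset? w) w id) (ℕ.+-cancelˡ-≤ ∣ S? ∣ _ _
            (ℕ.≤-trans (∣S∣+∣S∣≤ a) (ℕ.+-monoˡ-≤ _ (∣Near∣≤∣S∣ a)))))

        -- Every member of `Far a` can serve as centre. Both `w + x` and `w + y` lie in `Far a`,
        -- which is contained in the translate centred at `w + y`; their difference is `x - y`. Here
        -- `x + s ∈ S` expresses that `x` lies in `S - s`.
        subtract : ∀ {a} → a ∈ E → ∀ {x y} → x + s ∈ S → y + s ∈ S → x - y + s ∈ S
        subtract {a} a∈E {x} {y} x∈ y∈ =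
          let w , w∈ , _ = far a∈E
              shift = λ {x} (x∈ : x + s ∈ S) → Coset⊆Far a∈E w∈
                (S-resp (solve 3 (λ w x s → x ⊕ s ⊜ w ⊕ x ⊝ w ⊕ s) ≡.refl w x s) x∈)
          in S-resp (solve 4 (λ w x y s → w ⊕ x ⊝ (w ⊕ y) ⊕ s ⊜ x ⊝ y ⊕ s) ≡.refl w x y s)
               (Far⊆Coset a∈E (shift y∈) (shift x∈))

      ∈⊟⁺ : ∀ {x} → x + s ∈ S → x ∈ S ⊟ s
      ∈⊟⁺ {x} x+s∈S = x + s , x+s∈S , solve 2 (λ x s → x ⊜ x ⊕ s ⊝ s) ≡.refl x s

      ∈⊟⁻ : ∀ {x} → x ∈ S ⊟ s → x + s ∈ S
      ∈⊟⁻ {x} (σ , σ∈S , x≈) = S-resp (by-hyp (sym x≈) (solve 3 (λ σ x s → σ ⊕ x ⊜ x ⊕ s ⊕ (σ ⊝ s)) ≡.refl σ x s)) σ∈S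

      ⊟-subgroup : (∀ {x y} → x + s ∈ S → y + s ∈ S → x - y + s ∈ S) → IsSubgroup (S ⊟ s)
      ⊟-subgroup sub = record
        { resp     = λ x≈y → ∈⊟⁺ ∘ S-resp (+-congʳ x≈y) ∘ ∈⊟⁻
        ; 0∈       = ∈⊟⁺ 0∈
        ; +-closed = λ {x} {y} x∈ y∈ → ∈⊟⁺ (S-resp
            (solve 3 (λ x y s → x ⊝ (𝟘 ⊝ y) ⊕ s ⊜ x ⊕ y ⊕ s) ≡.refl x y s)
            (sub (∈⊟⁻ x∈) (sub 0∈ (∈⊟⁻ y∈))))
        ; -‿closed = λ {x} x∈ → ∈⊟⁺ (S-resp
            (solve 2 (λ x s → 𝟘 ⊝ x ⊕ s ⊜ (⊝ x) ⊕ s) ≡.refl x s) (sub 0∈ (∈⊟⁻ x∈)))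
        }
        where
        0∈ : 0# + s ∈ S
        0∈ = S-resp (sym (identityˡ s)) s∈S

-- Cyclic subgroups and cosets

least : {P : Pred ℕ p} → Decidable P → ∀ n → P n → ∃[ m ] P m × (∀ {j} → j ℕ.< m → ¬ P j)
least {P = P} P? = <-rec _ λ n rec Pn → search n rec Pn (ℕ.anyUpTo? P? n)
  where
  search : ∀ n → (∀ {k} → k ℕ.< n → P k → _) → P n → Dec _ → ∃[ m ] P m × (∀ {j} → j ℕ.< m → ¬ P j)
  search n rec Pn (yes (k , k<n , Pk)) = rec k<n Pk
  search n rec Pn (no ∄)               = n , Pn , λ j<n Pj → ∄ (_ , j<n , Pj)

module CyclicSubgroup {c ℓ} (Γ : FiniteAbelianGroup c ℓ) (g : FiniteAbelianGroup.Carrier Γ) where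
  open FiniteAbelianGroup Γ
  open Subsets Γ
  open AbelianGroupSolver Γ
  open AbelianGroupProperties abelianGroup using (identityʳ-unique)
  open Mult monoid using (×-homo-+; ×-congˡ; ×-congʳ)
  open Cardinality finiteSetoid

  subgroup : IsSubgroup ⟨ g ⟩
  subgroup = record
    { resp     = λ x≈y (n , x≈) → n , trans (sym x≈y) x≈
    ; 0∈       = ℤ.+ 0 , refl
    ; +-closed = λ (i , x≈) (j , y≈) → i ℤ.+ j , trans (+-cong x≈ y≈) (sym (+-·ℤ i j g))
    ; -‿closed = λ (i , x≈) → ℤ.- i , trans (⁻¹-cong x≈) (sym (neg-·ℤ i g))
    }

  private
    minimal = least (λ k → suc k · g ≟ 0#) (proj₁ (finite-order g)) (proj₂ (finite-order g))

    k = proj₁ minimal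

    kg≈0 : suc k · g ≈ 0#
    kg≈0 = proj₁ (proj₂ minimal)

    <k : ∀ {j} → j ℕ.< k → ¬ suc j · g ≈ 0#
    <k = proj₂ (proj₂ minimal)

    apart : ∀ {i j} → i ℕ.< j → j ℕ.< suc k → ¬ i · g ≈ j · g
    apart {i} {j} i<j j<1+k ig≈jg = <k (ℕ.≤-trans (ℕ.s≤s (ℕ.m∸n≤m _ i)) (ℕ.≤-trans (ℕ.≤-reflexive eq′) (ℕ.s≤s⁻¹ j<1+k)))
      (identityʳ-unique (i · g) _ (trans (sym (×-homo-+ g i _)) (trans (×-congˡ eq) (sym ig≈jg))))
      where
      j′ = ℕ.pred j
      eq′ : suc j′ ≡ j
      eq′ = ℕ.suc-pred j {{ℕ.>-nonZero (ℕ.≤-<-trans ℕ.z≤n i<j)}}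
      eq : i ℕ.+ suc (j′ ℕ.∸ i) ≡ j
      eq = ≡.trans (ℕ.+-suc i _) (≡.trans (≡.cong suc (ℕ.m+[n∸m]≡n
        (ℕ.s≤s⁻¹ (≡.subst (i ℕ.<_) (≡.sym eq′) i<j)))) eq′)

    below : ∀ n → ∃[ m ] m ℕ.< suc k × n · g ≈ m · g
    below n = n ℕ.% suc k , ℕ.m%n<n n (suc k) , ·-reduce g k kg≈0 n

    natural : ∀ {x} → x ∈ ⟨ g ⟩ → ∃[ n ] x ≈ n · g
    natural (ℤ.+ n    , x≈) = n , x≈
    natural (-[1+ n ] , x≈) = suc n ℕ.* k , trans x≈ (·-neg g k kg≈0 (suc n))

    bounded : ∀ {x} → x ∈ ⟨ g ⟩ → ∃[ m ] m ℕ.< suc k × x ≈ m · g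
    bounded x∈ = let n , x≈ng = natural x∈ ; m , m< , ng≈mg = below n in m , m< , trans x≈ng ng≈mg

    -- Links the number of elements of the subgroup with the least positive exponent killing `g`,
    -- written `suc k` so that division by it is always defined.
    ∣⟨g⟩∣≡ : ∣ ⟨ g ⟩? ∣ ≡ suc k
    ∣⟨g⟩∣≡ = ≡.trans (ℕ.≤-antisym
      (card≤length ⟨ g ⟩? (λ x∈ → let m , m< , x≈ = bounded x∈ in Any.applyUpTo⁺ (_· g) x≈ m<))
      (unique⇒length≤card ⟨ g ⟩? (IsSubgroup.resp subgroup)
        (Unique.applyUpTo⁺₁ setoid (_· g) (suc k) apart)
        (All.applyUpTo⁺₂ (_· g) (suc k) (λ n → ℤ.+ n , refl))))
      (List.length-applyUpTo (_· g) (suc k))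

    divides : ∀ n → n · g ≈ 0# → suc k ∣ n
    divides n ng≈0 = ℕ.m%n≡0⇒n∣m n (suc k) (zero? (n ℕ.% suc k) (ℕ.m%n<n n (suc k))
      (trans (sym (·-reduce g k kg≈0 n)) ng≈0))
      where
      zero? : ∀ m → m ℕ.< suc k → m · g ≈ 0# → m ≡ 0
      zero? zero    _  _    = ≡.refl
      zero? (suc m) m< mg≈0 = ⊥-elim (<k (ℕ.s≤s⁻¹ m<) mg≈0)

  d : ℕ
  d = ∣ ⟨ g ⟩? ∣

  d·g≈0 : d · g ≈ 0#
  d·g≈0 = trans (×-congˡ ∣⟨g⟩∣≡) kg≈0

  ·≈0⇒d∣ : ∀ n → n · g ≈ 0# → d ∣ n
  ·≈0⇒d∣ n = ≡.subst (_∣ n) (≡.sym ∣⟨g⟩∣≡) ∘ divides n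

  ⟨⟩⇒· : ∀ {x} → x ∈ ⟨ g ⟩ → ∃[ m ] m ℕ.< d × x ≈ m · g
  ⟨⟩⇒· x∈ = let m , m< , x≈ = bounded x∈ in m , ≡.subst (m ℕ.<_) (≡.sym ∣⟨g⟩∣≡) m< , x≈

  ·∈⟨⟩ : ∀ n → n · g ∈ ⟨ g ⟩
  ·∈⟨⟩ n = ℤ.+ n , refl

module _ {c ℓ p : Level} (Γ : FiniteAbelianGroup c ℓ) where
  open FiniteAbelianGroup Γ
  open Subsets Γ

  module Lagrange {H : Pred Carrier p} (H? : Decidable H) (H-sub : IsSubgroup H) where
    open IsSubgroup H-sub
    open AbelianGroupSolver Γ
    open Cardinality finiteSetoid

    private
      Coset : Carrier → Pred Carrier p
      Coset a x = x - a ∈ H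

      Coset? : ∀ a → Decidable (Coset a)
      Coset? a x = H? (x - a)

      Coset-resp : ∀ a → Coset a Respects _≈_
      Coset-resp a x≈y = resp (+-congʳ x≈y)

      ∣Coset∣≤ : ∀ a → ∣ Coset? a ∣ ℕ.≤ ∣ H? ∣
      ∣Coset∣≤ a = card-injection finiteSetoid finiteSetoid (Coset? a) H? resp (_- a) id
        (λ {x} {y} _ _ eq → by-hyp eq (solve 3 (λ x y a → x ⊕ (y ⊝ a) ⊜ y ⊕ (x ⊝ a)) ≡.refl x y a))

      ≤∣Coset∣ : ∀ a → ∣ H? ∣ ℕ.≤ ∣ Coset? a ∣
      ≤∣Coset∣ a = card-injection finiteSetoid finiteSetoid H? (Coset? a) (Coset-resp a) (_+ a)
        (λ {x} → resp (solve 2 (λ x a → x ⊜ x ⊕ a ⊝ a) ≡.refl x a))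
        (λ {x} {y} _ _ eq → by-hyp eq (solve 3 (λ x y a → x ⊕ (y ⊕ a) ⊜ y ⊕ (x ⊕ a)) ≡.refl x y a))

    -- Several representatives may share a coset here. This form refutes coverings by too few
    -- cosets.
    order≤ : ∀ reps → (∀ x → Any (λ r → x - r ∈ H) reps) → order ℕ.≤ length reps ℕ.* ∣ H? ∣
    order≤ reps complete = card-⋃ U? Coset? Coset-resp reps (λ {x} _ → complete x) ∣Coset∣≤

    order≡ : ∀ {reps} → AllPairs (λ r r′ → r - r′ ∉ H) reps → (∀ x → Any (λ r → x - r ∈ H) reps) →
             order ≡ length reps ℕ.* ∣ H? ∣
    order≡ {reps} distinct complete = ℕ.≤-antisym (order≤ reps complete)
      (ℕ.≤-trans
        (length*≤card Coset? Coset-resp ≤∣Coset∣ (AllPairs.map (λ {r} {r′} r-r′∉H {x} x-r∈H x-r′∈H →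
          r-r′∉H (resp (solve 3 (λ x r r′ → (x ⊝ r′) ⊝ (x ⊝ r) ⊜ r ⊝ r′) ≡.refl x r r′)
            (+-closed x-r′∈H (-‿closed x-r∈H)))) distinct))
        (card-mono (λ x → any? (λ r → Coset? r x) reps) U? _ _))

-- The structure of A and B inside K + H

odd≡ : ∀ {n} → Odd n → n ≡ suc (n ℕ./ 2 ℕ.* 2)
odd≡ {n} odd = ≡.trans (ℕ.m≡m%n+[m/n]*n n 2) (≡.cong (ℕ._+ n ℕ./ 2 ℕ.* 2) odd)

odd-suc-*2 : ∀ n → Odd (suc (n ℕ.* 2))
odd-suc-*2 n = ℕ.[m+kn]%n≡m%n 1 n 2

module Multiples {c ℓ} (Γ : FiniteAbelianGroup c ℓ) where
  open FiniteAbelianGroup Γ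
  open Subsets Γ
  open AbelianGroupSolver Γ
  open Mult monoid using (×-assocˡ; ×-congˡ; ×-congʳ; ×-homo-+) public

  2·-cong : ∀ {x y} → x ≈ y → 2 · x ≈ 2 · y
  2·-cong x≈y = +-cong x≈y (+-congʳ x≈y)

  ·-*2 : ∀ n x → (n ℕ.* 2) · x ≈ n · 2 · x
  ·-*2 n x = sym (×-assocˡ x n 2)

  ·-2* : ∀ n x → (n ℕ.* 2) · x ≈ 2 · n · x
  ·-2* n x = trans (×-congˡ (ℕ.*-comm n 2)) (sym (×-assocˡ x 2 n))

  ·-swap : ∀ m n x → m · n · x ≈ n · m · x
  ·-swap m n x = trans (×-assocˡ x m n) (trans (×-congˡ (ℕ.*-comm m n)) (sym (×-assocˡ x n m)))

  K-resp : K Respects _≈_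
  K-resp x≈y x∈K = trans (2·-cong (sym x≈y)) x∈K

  ∈K⇒x+x≈0 : ∀ {x} → x ∈ K → x + x ≈ 0#
  ∈K⇒x+x≈0 {x} x∈K = trans (+-congˡ (sym (identityʳ x))) x∈K

  ≈-⇒∈K : ∀ {x} → x ≈ - x → x ∈ K
  ≈-⇒∈K {x} eq = by-hyp eq (solve 1 (λ x → 2 ⊗ x ⊕ (⊝ x) ⊜ 𝟘 ⊕ x) ≡.refl x)

module _ {c ℓ} (Γ : FiniteAbelianGroup c ℓ) where
  open FiniteAbelianGroup Γ
  open Subsets Γ

  module OddOrder (b : Carrier) (d-odd : Odd (CyclicSubgroup.d Γ (2 · b))) where
    open CyclicSubgroup Γ (2 · b)
    open AbelianGroupSolver Γ
    open IsSubgroup subgroup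
    open Multiples Γ

    g : Carrier
    g = 2 · b

    H : Pred Carrier ℓ
    H = ⟨ g ⟩

    -- As `d = 2t + 1`, multiplication by `suc t` halves elements of `H`, and `t` is also the number
    -- of odd multiples `b, 3b, …, (d-2)b`.
    t : ℕ
    t = d ℕ./ 2

    d≡ : d ≡ suc (t ℕ.* 2)
    d≡ = odd≡ {d} d-odd

    g∈H : g ∈ H
    g∈H = ℤ.+ 1 , sym (identityʳ g)

    ·-closed : ∀ n {x} → x ∈ H → n · x ∈ H
    ·-closed zero    x∈H = 0∈
    ·-closed (suc n) x∈H = +-closed x∈H (·-closed n x∈H)

    odd-bound : ∀ {n} → Odd n → n ℕ.+ 2 ℕ.≤ d → n ℕ./ 2 ℕ.< t
    odd-bound {n} n-odd n+2≤d = ℕ.*-cancelʳ-≤ (suc j) t 2 (ℕ.s≤s⁻¹ (≡.subst₂ ℕ._≤_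
      (≡.trans (≡.cong (ℕ._+ 2) (odd≡ {n} n-odd)) (≡.cong suc (ℕ.+-comm (j ℕ.* 2) 2))) d≡ n+2≤d))
      where j = n ℕ./ 2

    odd<d : ∀ {i} → i ℕ.< t → suc (i ℕ.* 2) ℕ.< d
    odd<d i<t = ≡.subst (suc _ ℕ.<_) (≡.sym d≡) (ℕ.s≤s (ℕ.*-monoˡ-< 2 i<t))

    ·≉0 : ∀ n .{{_ : ℕ.NonZero n}} → n ℕ.< d → ¬ n · g ≈ 0#
    ·≉0 n n<d ng≈0 = ℕ.<⇒≱ n<d (ℕ.∣⇒≤ (·≈0⇒d∣ n ng≈0))

    torsion : ∀ {h} → h ∈ H → h + 2 · t · h ≈ 0#
    torsion {h} h∈H = let n , _ , h≈ng = ⟨⟩⇒· h∈H in begin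
      h + 2 · t · h       ≈⟨ +-congˡ (·-2* t h) ⟨
      suc (t ℕ.* 2) · h   ≡⟨ ≡.cong (_· h) d≡ ⟨
      d · h               ≈⟨ ×-congʳ d h≈ng ⟩
      d · n · g           ≈⟨ ·-swap d n g ⟩
      n · d · g           ≈⟨ ×-congʳ n d·g≈0 ⟩
      n · 0#              ≈⟨ ·-zeroʳ n ⟩
      0#                  ∎
      where open SetoidReasoning setoid

    -- A group of odd order has no element of order two: from `h + 2(t h) = 0` and `2h = 0` only `h`
    -- survives. Equivalently, doubling is injective on `H`.
    K∩H : ∀ {h} → h ∈ H → h ∈ K → h ≈ 0#
    K∩H {h} h∈H 2h≈0 = begin
      h             ≈⟨ identityʳ h ⟨
      h + 0#        ≈⟨ +-congˡ (trans (×-congʳ t 2h≈0) (·-zeroʳ t)) ⟨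
      h + t · 2 · h ≈⟨ +-congˡ (·-swap t 2 h) ⟩
      h + 2 · t · h ≈⟨ torsion h∈H ⟩
      0#            ∎
      where open SetoidReasoning setoid

    halve : ∀ {h} → h ∈ H → 2 · suc t · h ≈ h
    halve {h} h∈H = by-hyp (torsion h∈H)
      (solve 2 (λ h th → 2 ⊗ (h ⊕ th) ⊕ 𝟘 ⊜ h ⊕ (h ⊕ 2 ⊗ th)) ≡.refl h (t · h))

    -- Removing from `x` the half of `2 · x` that lies in `H` leaves an element of `K`. With `∈K∔H⁻`
    -- this makes `2 · x ∈ H` a decidable test for membership in `K ∔ H`, used from here on.
    ∈K∔H⁺ : ∀ {x} → 2 · x ∈ H → x ∈ K ∔ H
    ∈K∔H⁺ {x} 2x∈H = x - y , y , by-hyp (sym (halve 2x∈H))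
      (solve 2 (λ x y → 2 ⊗ (x ⊝ y) ⊕ 2 ⊗ y ⊜ 𝟘 ⊕ 2 ⊗ x) ≡.refl x y) , ·-closed (suc t) 2x∈H ,
      solve 2 (λ x y → x ⊜ x ⊝ y ⊕ y) ≡.refl x y
      where y = suc t · 2 · x

    ∈K∔H⁻ : ∀ {x} → x ∈ K ∔ H → 2 · x ∈ H
    ∈K∔H⁻ {x} (κ , h , 2κ≈0 , h∈H , x≈) = resp (by-hyp (+-cong (2·-cong (sym x≈)) (sym 2κ≈0))
      (solve 3 (λ x κ h → 2 ⊗ h ⊕ (2 ⊗ x ⊕ 2 ⊗ κ) ⊜ 2 ⊗ x ⊕ (2 ⊗ (κ ⊕ h) ⊕ 𝟘)) ≡.refl x κ h)) (·-closed 2 h∈H)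

    odd-multiple : ∀ j → suc (j ℕ.* 2) · b ≈ b + j · g
    odd-multiple j = +-congˡ (·-*2 j b)

    -- b + t · g is d b.
    b+t·g∈K : b + t · g ∈ K
    b+t·g∈K = trans (solve 2 (λ b tg → 2 ⊗ (b ⊕ tg) ⊜ 2 ⊗ b ⊕ 2 ⊗ tg) ≡.refl b (t · g)) (torsion g∈H)

module _ (Γ : FiniteAbelianGroup c ℓ) where
  open FiniteAbelianGroup Γ

  -- The relation is now an equality, hence symmetric; this lets results about `A` be reused for
  -- `B`.
  balanced-swap : {A : Pred Carrier p} {B : Pred Carrier q} →
                  ∀ {z} → Balanced Γ A B _≈_ z → Balanced Γ B A _≈_ z
  balanced-swap bal = record
    { both  = λ x+y≈z x≈y → let y∈A , x∈B = both (trans (comm _ _) x+y≈z) (sym x≈y) in x∈B , y∈A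
    ; only  = λ x+y≈z x∈B y∈A → sym (only (trans (comm _ _) x+y≈z) y∈A x∈B)
    ; cover = λ x+y≈z → Sum.swap (cover (trans (comm _ _) x+y≈z))
    }
    where open Balanced bal

module _ {c ℓ p : Level} (Γ : FiniteAbelianGroup c ℓ) where
  open FiniteAbelianGroup Γ
  open Subsets Γ

  module Reflecting
    {A B : Pred Carrier p} (A-resp : A Respects _≈_) (A? : Decidable A)
    {b : Carrier} (g≉0 : ¬ 2 · b ≈ 0#)
    (bal₀ : Balanced Γ A B _≈_ 0#) (bal₂ : Balanced Γ A B _≈_ (2 · b)) where
    open AbelianGroupSolver Γ
    open Multiples Γ
    open CyclicSubgroup Γ (2 · b)
    private
      g : Carrier
      g = 2 · b

      module Bal₀ = Balanced bal₀
      module Bal₂ = Balanced bal₂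

    K⊆A : K ⊆ A
    K⊆A {x} x∈K = proj₁ (Bal₀.both (∈K⇒x+x≈0 x∈K) refl)

    K+b⊆A : ∀ {x} → x ∈ K → x + b ∈ A
    K+b⊆A {x} x∈K = proj₁ (Bal₂.both
      (by-hyp x∈K (solve 2 (λ x b → x ⊕ b ⊕ (x ⊕ b) ⊕ 𝟘 ⊜ 2 ⊗ b ⊕ 2 ⊗ x) ≡.refl x b)) refl)

    -- The two reflections composed: at `2 · b` the missing `x + g` puts `- x` into `B`, and at `0#`
    -- the pair `x`, `- x` can lie in `A` and `B` only if its two members coincide.
    step↓ : ∀ {x} → x + g ∉ A → x ∉ A ⊎ x ∈ K
    step↓ {x} x+g∉A = Sum.swap (Sum.map₁ (λ x∈A → ≈-⇒∈K (Bal₀.only (inverseʳ x) x∈A -x∈B)) (toSum (A? x)))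
      where
      -x∈B = [ ⊥-elim ∘ x+g∉A , id ]′ (Bal₂.cover (solve 2 (λ x g → x ⊕ g ⊕ (⊝ x) ⊜ g) ≡.refl x g))

    -- The same composition read backwards. At `2 · b` the pair `x + g`, `- x` could lie in `A` and
    -- `B` only if its members coincide, which means `x + b ∈ K`; so such `x` are the only places
    -- where the orbit enters `A`.
    step↑ : ∀ {x} → x ∉ A ⊎ x ∈ K → x + b ∉ K → x + g ∉ A
    step↑ {x} x∈ x+b∉K x+g∈A = x+b∉K
      (by-hyp (Bal₂.only (solve 2 (λ x g → x ⊕ g ⊕ (⊝ x) ⊜ g) ≡.refl x g) x+g∈A (-x∈B x∈))
        (solve 2 (λ x b → 2 ⊗ (x ⊕ b) ⊕ (⊝ x) ⊜ 𝟘 ⊕ (x ⊕ 2 ⊗ b)) ≡.refl x b))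
      where
      -x∈B : x ∉ A ⊎ x ∈ K → - x ∈ B
      -x∈B (inj₁ x∉A) = [ ⊥-elim ∘ x∉A , id ]′ (Bal₀.cover (inverseʳ x))
      -x∈B (inj₂ x∈K) = proj₂ (Bal₀.both (inverseʳ x)
        (by-hyp x∈K (solve 1 (λ x → x ⊕ 𝟘 ⊜ (⊝ x) ⊕ 2 ⊗ x) ≡.refl x)))

    module _ {κ} (κ∈K : κ ∈ K) where

      odd-·g : ∀ j → κ + j · g + b ∈ K → suc (j ℕ.* 2) · g ≈ 0#
      odd-·g j ∈K = trans (+-congˡ (·-2* j g)) (by-hyp (+-cong ∈K (sym κ∈K))
        (solve 3 (λ κ b jg → 2 ⊗ b ⊕ 2 ⊗ jg ⊕ (𝟘 ⊕ 2 ⊗ κ) ⊜ 𝟘 ⊕ (2 ⊗ (κ ⊕ jg ⊕ b) ⊕ 𝟘)) ≡.refl κ b (j · g)))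

      -- Starting from `κ` in `K`, the points `κ + g`, `κ + 2g`, ... stay outside `A` until some
      -- `κ + i · g + b` falls into `K`, and by `odd-·g` that makes `(2i + 1)g` vanish. They are the
      -- even multiples of `b`, shifted by `κ`.
      even∉A : ∀ j → (∀ {i} → i ℕ.≤ j → ¬ suc (i ℕ.* 2) · g ≈ 0#) → κ + suc j · g ∉ A
      even∉A j odd≉0 = step↑ (previous j odd≉0) (odd≉0 ℕ.≤-refl ∘ odd-·g j) ∘
        A-resp (solve 3 (λ κ g jg → κ ⊕ (g ⊕ jg) ⊜ κ ⊕ jg ⊕ g) ≡.refl κ g (j · g))
        where
        previous : ∀ j → (∀ {i} → i ℕ.≤ j → ¬ suc (i ℕ.* 2) · g ≈ 0#) → κ + j · g ∉ A ⊎ κ + j · g ∈ K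
        previous zero    _     = inj₂ (K-resp (sym (identityʳ κ)) κ∈K)
        previous (suc j) odd≉0 = inj₁ (even∉A j (odd≉0 ∘ ℕ.m≤n⇒m≤1+n))

    -- Were d even, then no odd multiple of g would vanish and even∉A would
    -- give d g = 0 ∉ A.
    d-odd : Odd d
    d-odd = parity (d ℕ.% 2) ≡.refl (ℕ.m%n<n d 2)
      where
      d>0 : 0 ℕ.< d
      d>0 = Cardinality.card-inhabited finiteSetoid ⟨ g ⟩? (IsSubgroup.resp subgroup) (IsSubgroup.0∈ subgroup)

      d≡ : suc (ℕ.pred d) ≡ d
      d≡ = ℕ.suc-pred d {{ℕ.>-nonZero d>0}}

      parity : ∀ m → d ℕ.% 2 ≡ m → m ℕ.< 2 → m ≡ 1
      parity 1             eq _ = ≡.refl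
      parity (suc (suc m)) eq (ℕ.s≤s (ℕ.s≤s ()))
      parity 0             eq _ = ⊥-elim (even∉A (·-zeroʳ 2) (ℕ.pred d)
        (λ {i} _ odd≈0 → 0≢1 (≡.trans (≡.sym (ℕ.n∣m⇒m%n≡0 (suc (i ℕ.* 2)) 2
          (ℕ.∣-trans (ℕ.m%n≡0⇒n∣m d 2 eq) (·≈0⇒d∣ (suc (i ℕ.* 2)) odd≈0)))) (odd-suc-*2 i)))
        (A-resp (sym (trans (identityˡ _) (trans (×-congˡ d≡) d·g≈0))) (K⊆A (·-zeroʳ 2))))
        where
        0≢1 : ¬ 0 ≡ 1
        0≢1 ()

    open OddOrder Γ b d-odd hiding (g)

    1<d : 1 ℕ.< d
    1<d = ≡.subst (1 ℕ.<_) (≡.sym d≡) (ℕ.s≤s (positive t d≡))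
      where
      positive : ∀ t → d ≡ suc (t ℕ.* 2) → 0 ℕ.< t ℕ.* 2
      positive (suc t) _   = ℕ.s≤s ℕ.z≤n
      positive zero    d≡1 = ⊥-elim (g≉0 (trans (sym (identityʳ g)) (trans (×-congˡ (≡.sym d≡1)) d·g≈0)))

    -- Read contrapositively, `step↓` keeps a point of `A` in `A` under translation by `g` unless it
    -- lies in `K`. From `κ + b` on, that would require `(2j + 1)g` to vanish with `2j + 1 < d`.
    odd∈A : ∀ {κ} → κ ∈ K → ∀ j → j ℕ.< t → κ + (b + j · g) ∈ A
    odd∈A {κ} κ∈K zero    _   = A-resp (+-congˡ (sym (identityʳ b))) (K+b⊆A κ∈K)
    odd∈A {κ} κ∈K (suc j) j<t = decidable-stable (A? _) λ ∉A →
      [ (λ ∉A → ∉A (odd∈A κ∈K j (ℕ.<-trans (ℕ.n<1+n j) j<t)))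
      , (λ ∈K → ·≉0 (suc (j ℕ.* 2)) (odd<d (ℕ.<-trans (ℕ.n<1+n j) j<t))
          (odd-·g κ∈K j (K-resp (solve 3 (λ κ b jg → κ ⊕ (b ⊕ jg) ⊜ κ ⊕ jg ⊕ b) ≡.refl κ b (j · g)) ∈K)))
      ]′ (step↓ (∉A ∘ A-resp (solve 4 (λ κ b g jg → κ ⊕ (b ⊕ jg) ⊕ g ⊜ κ ⊕ (b ⊕ (g ⊕ jg))) ≡.refl κ b g (j · g))))

    open CosetStructure Γ using (OddMultiples)

    K+H∩A⇒ : ∀ {x} → x ∈ A → 2 · x ∈ H → x ∈ OddMultiples b d ∔ K
    K+H∩A⇒ {x} x∈A 2x∈H =
      let κ , h , κ∈K , h∈H , x≈κ+h = ∈K∔H⁺ 2x∈H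
          i , i<d , h≈ig = ⟨⟩⇒· h∈H
      in position κ∈K i i<d (trans x≈κ+h (+-congˡ h≈ig))
      where
      open SetoidReasoning setoid

      position : ∀ {κ} → κ ∈ K → ∀ i → i ℕ.< d → x ≈ κ + i · g → x ∈ OddMultiples b d ∔ K
      position {κ} κ∈K zero    _     x≈ = 0# , κ , inj₁ refl , κ∈K , trans x≈ (comm κ 0#)
      position {κ} κ∈K (suc i) 1+i<d x≈ = [ low , high ]′ (toSum (i ℕ.<? t))
        where
        -- The multiples `g, …, t g` have not yet met a vanishing odd multiple, so they are absent
        -- from `A`.
        low : i ℕ.< t → x ∈ OddMultiples b d ∔ K
        low i<t = ⊥-elim (even∉A κ∈K i
          (λ {j} j≤i → ·≉0 (suc (j ℕ.* 2)) (odd<d (ℕ.≤-<-trans j≤i i<t))) (A-resp x≈ x∈A))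

        -- With `i = t + j`, the multiple `(suc t + j)g` equals `(2j + 1)b + d b`, and `d b` lies in
        -- `K`. So the upper half of the multiples of `g` consists of the odd multiples of `b`,
        -- shifted by elements of `K`.
        high : ¬ i ℕ.< t → x ∈ OddMultiples b d ∔ K
        high i≮t = suc (j ℕ.* 2) · b , κ + (b + t · g) , inj₂ (suc (j ℕ.* 2) , odd-suc-*2 j , j-bound , refl) ,
              trans (solve 2 (λ κ y → 2 ⊗ (κ ⊕ y) ⊜ 2 ⊗ κ ⊕ 2 ⊗ y) ≡.refl κ (b + t · g))
                (trans (+-cong κ∈K b+t·g∈K) (identityʳ 0#)) ,
              (begin
                x                                ≈⟨ x≈ ⟩
                κ + (g + i · g)                  ≈⟨ +-congˡ (+-congˡ (×-congˡ i≡)) ⟨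
                κ + (g + (t ℕ.+ j) · g)          ≈⟨ +-congˡ (+-congˡ (×-homo-+ g t j)) ⟩
                κ + (g + (t · g + j · g))        ≈⟨ solve 4 (λ κ b tg jg → κ ⊕ (2 ⊗ b ⊕ (tg ⊕ jg)) ⊜ b ⊕ jg ⊕ (κ ⊕ (b ⊕ tg))) ≡.refl κ b (t · g) (j · g) ⟩
                b + j · g + (κ + (b + t · g))    ≈⟨ +-congʳ (odd-multiple j) ⟨
                suc (j ℕ.* 2) · b + (κ + (b + t · g)) ∎)
          where
          j = i ℕ.∸ t
          i≡ : t ℕ.+ j ≡ i
          i≡ = ℕ.m+[n∸m]≡n (ℕ.≮⇒≥ i≮t)
          j<t : j ℕ.< t
          j<t = ℕ.+-cancelˡ-< t _ _ (≡.subst (ℕ._< t ℕ.+ t) (≡.sym i≡)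
            (ℕ.s≤s⁻¹ (≡.subst (suc i ℕ.<_) (≡.trans d≡ (≡.cong suc (≡.trans (ℕ.*-comm t 2) (≡.cong (t ℕ.+_) (ℕ.+-identityʳ t))))) 1+i<d)))
          j-bound : suc (j ℕ.* 2) ℕ.+ 2 ℕ.≤ d
          j-bound = ≡.subst₂ ℕ._≤_ (≡.cong suc (ℕ.+-comm 2 (j ℕ.* 2))) (≡.sym d≡) (ℕ.s≤s (ℕ.*-monoˡ-≤ 2 j<t))

    OddMultiples∔K⊆A : OddMultiples b d ∔ K ⊆ A
    OddMultiples∔K⊆A (a , κ , inj₁ a≈0 , κ∈K , x≈) =
      A-resp (sym (trans x≈ (trans (+-congʳ a≈0) (identityˡ κ)))) (K⊆A κ∈K)
    OddMultiples∔K⊆A {x} (a , κ , inj₂ (n , n-odd , n+2≤d , a≈nb) , κ∈K , x≈) =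
      A-resp (begin
        κ + (b + j · g)            ≈⟨ +-congˡ (odd-multiple j) ⟨
        κ + suc (j ℕ.* 2) · b      ≡⟨ ≡.cong (λ m → κ + m · b) (odd≡ {n} n-odd) ⟨
        κ + n · b                  ≈⟨ +-congˡ a≈nb ⟨
        κ + a                      ≈⟨ comm κ a ⟩
        a + κ                      ≈⟨ x≈ ⟨
        x                          ∎) (odd∈A κ∈K j j<t)
      where
      open SetoidReasoning setoid
      j = n ℕ./ 2
      j<t : j ℕ.< t
      j<t = odd-bound n-odd n+2≤d

    -- Outside `K ∔ H` the exceptional case of `step↓` cannot occur: `x + n · g ∈ K` would give
    -- `2 · x ∈ H`. Hence `A` is there a union of cosets of `H`.
    periodic : ∀ {x h} → 2 · x ∉ H → x ∈ A → h ∈ H → x + h ∈ A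
    periodic {x} {h} 2x∉H x∈A h∈H = let n , _ , h≈ng = ⟨⟩⇒· h∈H in A-resp (+-congˡ (sym h≈ng)) (go n)
      where
      open IsSubgroup subgroup
      go : ∀ n → x + n · g ∈ A
      go zero    = A-resp (sym (identityʳ x)) x∈A
      go (suc n) = A-resp (solve 3 (λ x g ng → x ⊕ ng ⊕ g ⊜ x ⊕ (g ⊕ ng)) ≡.refl x g (n · g))
        (decidable-stable (A? _) λ ∉A → [ (λ ∉A → ∉A (go n)) , (λ ∈K → 2x∉H (resp
          (by-hyp (sym ∈K) (solve 2 (λ x y → (⊝ (2 ⊗ y)) ⊕ 2 ⊗ (x ⊕ y) ⊜ 2 ⊗ x ⊕ 𝟘) ≡.refl x (n · g)))
          (-‿closed (·-closed 2 (·∈⟨⟩ n))))) ]′ (step↓ ∉A))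

-- The structure of A and B outside K + H

module _ {A : Set a} where

  lookup-++ˡ : ∀ xs {ys : List A} (j : Fin (length xs)) →
               ∃[ i ] toℕ i ≡ toℕ j × lookup (xs ++ ys) i ≡ lookup xs j
  lookup-++ˡ (x ∷ xs) zero    = zero , ≡.refl , ≡.refl
  lookup-++ˡ (x ∷ xs) (suc j) = let i , i≡j , eq = lookup-++ˡ xs j in suc i , ≡.cong suc i≡j , eq

  lookup-++ʳ : ∀ xs {ys : List A} (j : Fin (length ys)) →
               ∃[ i ] toℕ i ≡ length xs ℕ.+ toℕ j × lookup (xs ++ ys) i ≡ lookup ys j
  lookup-++ʳ []       j = j , ≡.refl , ≡.refl
  lookup-++ʳ (x ∷ xs) j = let i , i≡j , eq = lookup-++ʳ xs j in suc i , ≡.cong suc i≡j , eq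

  module _ {P : Pred A p} where

    lookup-++-< : ∀ {xs} → All P xs → ∀ {ys} (i : Fin (length (xs ++ ys))) →
                  toℕ i ℕ.< length xs → P (lookup (xs ++ ys) i)
    lookup-++-< (px ∷ pxs) zero    _   = px
    lookup-++-< (px ∷ pxs) (suc i) i<n = lookup-++-< pxs i (ℕ.s≤s⁻¹ i<n)

    lookup-++-≥ : ∀ xs {ys} → (∀ j → P (lookup ys j)) → (i : Fin (length (xs ++ ys))) →
                  length xs ℕ.≤ toℕ i → P (lookup (xs ++ ys) i)
    lookup-++-≥ []       pys i       _   = pys i
    lookup-++-≥ (x ∷ xs) pys (suc i) n≤i = lookup-++-≥ xs pys i (ℕ.s≤s⁻¹ n≤i)

    lookup-++-≥-< : ∀ xs {ys} → All P ys → ∀ {zs} (i : Fin (length (xs ++ ys ++ zs))) →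
                    length xs ℕ.≤ toℕ i → toℕ i ℕ.< length xs ℕ.+ length ys → P (lookup (xs ++ ys ++ zs) i)
    lookup-++-≥-< []       pys i       _   i<n = lookup-++-< pys i i<n
    lookup-++-≥-< (x ∷ xs) pys (suc i) n≤i i<n = lookup-++-≥-< xs pys i (ℕ.s≤s⁻¹ n≤i) (ℕ.s≤s⁻¹ i<n)

    lookup-++-≥-≥ : ∀ xs ys {zs} → All P zs → (i : Fin (length (xs ++ ys ++ zs))) →
                    length xs ℕ.+ length ys ℕ.≤ toℕ i → P (lookup (xs ++ ys ++ zs) i)
    lookup-++-≥-≥ []       ys pzs i       n≤i = lookup-++-≥ ys (all-lookup pzs) i n≤i
    lookup-++-≥-≥ (x ∷ xs) ys pzs (suc i) n≤i = lookup-++-≥-≥ xs ys pzs i (ℕ.s≤s⁻¹ n≤i)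

    AllPairs-map : ∀ {R : Rel A q} {R′ : Rel A r} → (∀ {x y} → x ∈ P → y ∈ P → R x y → R′ x y) →
                   ∀ {xs} → All P xs → AllPairs R xs → AllPairs R′ xs
    AllPairs-map R⇒R′ []         []         = []
    AllPairs-map R⇒R′ (px ∷ pxs) (rx ∷ rxs) =
      All.zipWith (λ (py , rxy) → R⇒R′ px py rxy) (pxs , rx) ∷ AllPairs-map R⇒R′ pxs rxs

module _ {c ℓ p : Level} (Γ : FiniteAbelianGroup c ℓ) where
  open FiniteAbelianGroup Γ
  open Subsets Γ

  module Forward
    {A B : Pred Carrier p} (A-resp : A Respects _≈_) (B-resp : B Respects _≈_)
    (A? : Decidable A) (B? : Decidable B) {b : Carrier} (g≉0 : ¬ 2 · b ≈ 0#)
    (bal₀ : Balanced Γ A B _≈_ 0#) (bal₂ : Balanced Γ A B _≈_ (2 · b)) where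
    open AbelianGroupSolver Γ
    open Multiples Γ
    open CyclicSubgroup Γ (2 · b)
    open IsSubgroup subgroup
    open Cardinality finiteSetoid using (members; members-unique; members-all; ∈-members)
    private
      module RA = Reflecting Γ A-resp A? g≉0 bal₀ bal₂
      module RB = Reflecting Γ B-resp B? g≉0 (balanced-swap Γ bal₀) (balanced-swap Γ bal₂)
      module Bal₀ = Balanced bal₀
    open OddOrder Γ b RA.d-odd

    H? : Decidable H
    H? = ⟨ g ⟩?

    Outside : Pred Carrier ℓ
    Outside x = 2 · x ∉ H

    infix 4 _±_
    -- The class of `x` is `(x + H) ∪ (- x + H)`, one term of the required covering; deduplicating
    -- modulo this equivalence therefore yields the elements `x₁, …, xₘ`.
    _±_ : Rel Carrier ℓ
    x ± y = x - y ∈ H ⊎ x + y ∈ H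

    ±-decSetoid : DecSetoid c ℓ
    ±-decSetoid = record
      { Carrier = Carrier ; _≈_ = _±_
      ; isDecEquivalence = record
        { isEquivalence = record { refl = inj₁ (resp (sym (inverseʳ _)) 0∈) ; sym = ±-sym ; trans = ±-trans }
        ; _≟_ = λ x y → H? (x - y) ⊎-dec H? (x + y)
        }
      }
      where
      ±-sym : ∀ {x y} → x ± y → y ± x
      ±-sym {x} {y} (inj₁ h) = inj₁ (resp (solve 2 (λ x y → ⊝ (x ⊝ y) ⊜ y ⊝ x) ≡.refl x y) (-‿closed h))
      ±-sym {x} {y} (inj₂ h) = inj₂ (resp (comm x y) h)
      ±-trans : ∀ {x y z} → x ± y → y ± z → x ± z
      ±-trans {x} {y} {z} (inj₁ h) (inj₁ k) = inj₁ (resp (solve 3 (λ x y z → (x ⊝ y) ⊕ (y ⊝ z) ⊜ x ⊝ z) ≡.refl x y z) (+-closed h k))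
      ±-trans {x} {y} {z} (inj₁ h) (inj₂ k) = inj₂ (resp (solve 3 (λ x y z → (x ⊝ y) ⊕ (y ⊕ z) ⊜ x ⊕ z) ≡.refl x y z) (+-closed h k))
      ±-trans {x} {y} {z} (inj₂ h) (inj₁ k) = inj₂ (resp (solve 3 (λ x y z → (x ⊕ y) ⊝ (y ⊝ z) ⊜ x ⊕ z) ≡.refl x y z) (+-closed h (-‿closed k)))
      ±-trans {x} {y} {z} (inj₂ h) (inj₂ k) = inj₁ (resp (solve 3 (λ x y z → (x ⊕ y) ⊝ (y ⊕ z) ⊜ x ⊝ z) ≡.refl x y z) (+-closed h (-‿closed k)))

    private
      module ± = DecSetoid ±-decSetoid

    reps : {T : Pred Carrier q} → Decidable T → List Carrier
    reps T? = deduplicate ±._≟_ (filter T? elements)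

    reps-unique : {T : Pred Carrier q} (T? : Decidable T) → Unique ±.setoid (reps T?)
    reps-unique T? = UniqueDec.deduplicate-! ±-decSetoid (filter T? elements)

    reps-all : {T : Pred Carrier q} (T? : Decidable T) → All T (reps T?)
    reps-all T? = All.deduplicate⁺ ±._≟_ (All.all-filter T? elements)

    ≈⇒± : ∀ {x y} → x ≈ y → x ± y
    ≈⇒± {x} {y} x≈y = inj₁ (resp (sym (trans (+-congʳ x≈y) (inverseʳ y))) 0∈)

    ∈-reps : {T : Pred Carrier q} (T? : Decidable T) → T Respects _≈_ → ∀ {x} → x ∈ T → Any (x ±_) (reps T?)
    ∈-reps T? T-resp x∈T = Any.deduplicate⁺ ±._≟_ (λ z±y x±y → ±.trans x±y (±.sym z±y))
      (Any.map ≈⇒± (Membershipₚ.∈-filter⁺ setoid T? T-resp (enumeration _) x∈T))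

    Outside-resp : Outside Respects _≈_
    Outside-resp x≈y x∉ = x∉ ∘ resp (2·-cong (sym x≈y))

    Outside-neg : ∀ {x} → x ∈ Outside → - x ∈ Outside
    Outside-neg {x} x∉ = x∉ ∘ resp (solve 1 (λ x → ⊝ (2 ⊗ (⊝ x)) ⊜ 2 ⊗ x) ≡.refl x) ∘ -‿closed

    Outside-shift : ∀ {x h} → x ∈ Outside → h ∈ H → x + h ∈ Outside
    Outside-shift {x} {h} x∉ h∈H = λ ∈H → x∉ (resp
      (solve 2 (λ x h → 2 ⊗ (x ⊕ h) ⊝ 2 ⊗ h ⊜ 2 ⊗ x) ≡.refl x h)
      (+-closed ∈H (-‿closed (·-closed 2 h∈H))))

    -- For x outside K + H, the sets A and B determine which of x₁ … xₖ,
    -- x_{k+1} … x_l and x_{l+1} … x_m represents ±x + H.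
    T₁ T₂ T₃ : Pred Carrier _
    T₁ x = x ∈ Outside × x ∈ A × x ∈ B
    T₂ x = x ∈ Outside × x ∈ A × - x ∈ A
    T₃ x = x ∈ Outside × x ∈ B × - x ∈ B

    T₁? : Decidable T₁
    T₁? x = ¬? (H? (2 · x)) ×-dec (A? x ×-dec B? x)

    T₂? : Decidable T₂
    T₂? x = ¬? (H? (2 · x)) ×-dec (A? x ×-dec A? (- x))

    T₃? : Decidable T₃
    T₃? x = ¬? (H? (2 · x)) ×-dec (B? x ×-dec B? (- x))

    T₁-resp : T₁ Respects _≈_
    T₁-resp x≈y (o , x∈A , x∈B) = Outside-resp x≈y o , A-resp x≈y x∈A , B-resp x≈y x∈B

    T₂-resp : T₂ Respects _≈_
    T₂-resp x≈y (o , x∈A , -x∈A) = Outside-resp x≈y o , A-resp x≈y x∈A , A-resp (⁻¹-cong x≈y) -x∈A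

    T₃-resp : T₃ Respects _≈_
    T₃-resp x≈y (o , x∈B , -x∈B) = Outside-resp x≈y o , B-resp x≈y x∈B , B-resp (⁻¹-cong x≈y) -x∈B

    l₁ l₂ l₃ xs : List Carrier
    l₁ = reps T₁?
    l₂ = reps T₂?
    l₃ = reps T₃?
    xs = l₁ ++ l₂ ++ l₃

    moveᴬ : ∀ {x y} → x ∈ Outside → x ∈ A → y - x ∈ H → y ∈ A
    moveᴬ {x} {y} x∉ x∈A h = A-resp (solve 2 (λ x y → x ⊕ (y ⊝ x) ⊜ y) ≡.refl x y) (RA.periodic x∉ x∈A h)

    moveᴮ : ∀ {x y} → x ∈ Outside → x ∈ B → y - x ∈ H → y ∈ B
    moveᴮ {x} {y} x∉ x∈B h = B-resp (solve 2 (λ x y → x ⊕ (y ⊝ x) ⊜ y) ≡.refl x y) (RB.periodic x∉ x∈B h)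

    K⇒¬Outside : ∀ {x} → x ∈ K → x ∉ Outside
    K⇒¬Outside x∈K x∉ = x∉ (resp (sym x∈K) 0∈)

    -- Members of `A` and `B` with sum zero coincide, and `x = - x` would place `x` in `K`.
    exclusive : ∀ {x} → x ∈ Outside → x ∈ A → - x ∉ B
    exclusive {x} x∉ x∈A -x∈B = K⇒¬Outside (≈-⇒∈K (Bal₀.only (inverseʳ x) x∈A -x∈B)) x∉

    neg-neg : ∀ x → - - x ≈ x
    neg-neg x = solve 1 (λ x → ⊝ (⊝ x) ⊜ x) ≡.refl x

    exclusive′ : ∀ {x} → x ∈ Outside → x ∈ B → - x ∉ A
    exclusive′ {x} x∉ x∈B -x∈A = exclusive (Outside-neg x∉) -x∈A (B-resp (sym (neg-neg x)) x∈B)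

    flip-H : ∀ {x y} → x + y ∈ H → y - (- x) ∈ H
    flip-H {x} {y} = resp (solve 2 (λ x y → x ⊕ y ⊜ y ⊝ (⊝ x)) ≡.refl x y)

    flip-H′ : ∀ {x y} → x - y ∈ H → y - x ∈ H
    flip-H′ {x} {y} h = resp (solve 2 (λ x y → ⊝ (x ⊝ y) ⊜ y ⊝ x) ≡.refl x y) (-‿closed h)

    T₁#T₂ : ∀ {x y} → x ∈ T₁ → y ∈ T₂ → ¬ x ± y
    T₁#T₂ (x∉ , x∈A , x∈B) (y∉ , y∈A , -y∈A) (inj₁ h) = exclusive′ y∉ (moveᴮ x∉ x∈B (flip-H′ h)) -y∈A
    T₁#T₂ {x} {y} (x∉ , x∈A , x∈B) (y∉ , y∈A , -y∈A) (inj₂ h) = exclusive′ x∉ x∈B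
      (moveᴬ y∉ y∈A (resp (solve 2 (λ x y → ⊝ (x ⊕ y) ⊜ (⊝ x) ⊝ y) ≡.refl x y) (-‿closed h)))

    T₁#T₃ : ∀ {x y} → x ∈ T₁ → y ∈ T₃ → ¬ x ± y
    T₁#T₃ (x∉ , x∈A , x∈B) (y∉ , y∈B , -y∈B) (inj₁ h) = exclusive y∉ (moveᴬ x∉ x∈A (flip-H′ h)) -y∈B
    T₁#T₃ {x} {y} (x∉ , x∈A , x∈B) (y∉ , y∈B , -y∈B) (inj₂ h) = exclusive x∉ x∈A
      (moveᴮ y∉ y∈B (resp (solve 2 (λ x y → ⊝ (x ⊕ y) ⊜ (⊝ x) ⊝ y) ≡.refl x y) (-‿closed h)))

    T₂#T₃ : ∀ {x y} → x ∈ T₂ → y ∈ T₃ → ¬ x ± y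
    T₂#T₃ (x∉ , x∈A , -x∈A) (y∉ , y∈B , -y∈B) (inj₁ h) = exclusive y∉ (moveᴬ x∉ x∈A (flip-H′ h)) -y∈B
    T₂#T₃ (x∉ , x∈A , -x∈A) (y∉ , y∈B , -y∈B) (inj₂ h) = exclusive y∉ (moveᴬ (Outside-neg x∉) -x∈A (flip-H h)) -y∈B

    cross : {T : Pred Carrier q} {T′ : Pred Carrier r} → (∀ {x y} → x ∈ T → y ∈ T′ → ¬ x ± y) →
            ∀ {ys zs} → All T ys → All T′ zs → All (λ x → All (λ y → ¬ x ± y) zs) ys
    cross T#T′ ys zs = All.map (λ x∈T → All.map (T#T′ x∈T) zs) ys

    xs-unique : Unique ±.setoid xs
    xs-unique = AllPairs.++⁺ (reps-unique T₁?)
      (AllPairs.++⁺ (reps-unique T₂?) (reps-unique T₃?) (cross T₂#T₃ (reps-all T₂?) (reps-all T₃?)))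
      (All.zipWith (λ (p , q) → All.++⁺ p q)
        (cross T₁#T₂ (reps-all T₁?) (reps-all T₂?) , cross T₁#T₃ (reps-all T₁?) (reps-all T₃?)))

    xs-outside : All Outside xs
    xs-outside = All.++⁺ (All.map proj₁ (reps-all T₁?))
      (All.++⁺ (All.map proj₁ (reps-all T₂?)) (All.map proj₁ (reps-all T₃?)))

    -- By `cover` at zero, each set that misses `x` forces the other one to contain `- x`; the four
    -- possible answers for `A` and `B` at `x` are thereby the four alternatives.
    classify : ∀ {x} → x ∈ Outside → (x ∈ T₁ ⊎ - x ∈ T₁) ⊎ x ∈ T₂ ⊎ x ∈ T₃
    classify {x} x∉ = cases (A? x) (B? x)
      where
      cases : Dec (x ∈ A) → Dec (x ∈ B) → (x ∈ T₁ ⊎ - x ∈ T₁) ⊎ x ∈ T₂ ⊎ x ∈ T₃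
      cases (yes x∈A) (yes x∈B) = inj₁ (inj₁ (x∉ , x∈A , x∈B))
      cases (yes x∈A) (no  x∉B) = inj₂ (inj₁ (x∉ , x∈A , [ id , ⊥-elim ∘ x∉B ]′ (Bal₀.cover (inverseˡ x))))
      cases (no  x∉A) (yes x∈B) = inj₂ (inj₂ (x∉ , x∈B , [ ⊥-elim ∘ x∉A , id ]′ (Bal₀.cover (inverseʳ x))))
      cases (no  x∉A) (no  x∉B) = inj₁ (inj₂ (Outside-neg x∉ ,
        [ id , ⊥-elim ∘ x∉B ]′ (Bal₀.cover (inverseˡ x)) , [ ⊥-elim ∘ x∉A , id ]′ (Bal₀.cover (inverseʳ x))))

    ∈-xs : ∀ {x} → x ∈ Outside → Any (x ±_) xs
    ∈-xs {x} x∉ with classify x∉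
    ... | inj₁ (inj₁ x∈T₁)  = Any.++⁺ˡ (∈-reps T₁? T₁-resp x∈T₁)
    ... | inj₁ (inj₂ -x∈T₁) = Any.++⁺ˡ (Any.map (±.trans
      (inj₂ (resp (sym (inverseʳ x)) 0∈))) (∈-reps T₁? T₁-resp -x∈T₁))
    ... | inj₂ (inj₁ x∈T₂)  = Any.++⁺ʳ l₁ (Any.++⁺ˡ (∈-reps T₂? T₂-resp x∈T₂))
    ... | inj₂ (inj₂ x∈T₃)  = Any.++⁺ʳ l₁ (Any.++⁺ʳ l₂ (∈-reps T₃? T₃-resp x∈T₃))

    k l m : ℕ
    k = length l₁
    l = length l₁ ℕ.+ length l₂
    m = length xs

    x̂ : Fin m → Carrier
    x̂ = lookup xs

    ±-any : ∀ {x ys} → Any (x ±_) ys → ∃[ j ] x ± lookup ys j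
    ±-any any = index any , Any.lookup-index any

    -- The sign is determined in `T₁`: if `x` is in both sets, then `- x` is in neither. This is why
    -- `x₁, …, xₖ` occur without `±`.
    T₁-same : ∀ {x y} → x ∈ T₁ → y ∈ T₁ → x ± y → x - y ∈ H
    T₁-same _ _ (inj₁ h) = h
    T₁-same {x} {y} (x∉ , x∈A , _) (y∉ , _ , y∈B) (inj₂ h) = ⊥-elim (exclusive x∉ x∈A
      (moveᴮ y∉ y∈B (resp (solve 2 (λ x y → ⊝ (x ⊕ y) ⊜ (⊝ x) ⊝ y) ≡.refl x y) (-‿closed h))))

    locate₁ : ∀ {x} → x ∈ T₁ → ∃[ i ] toℕ i ℕ.< k × x - x̂ i ∈ H
    locate₁ {x} x∈T₁ =
      let j , x±y = ±-any (∈-reps T₁? T₁-resp x∈T₁)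
          i , i≡j , eq = lookup-++ˡ l₁ {l₂ ++ l₃} j
      in i , ≡.subst (ℕ._< k) (≡.sym i≡j) (Fin.toℕ<n j) ,
         ≡.subst (λ y → x - y ∈ H) (≡.sym eq) (T₁-same x∈T₁ (all-lookup (reps-all T₁?) j) x±y)

    locate₂ : ∀ {x} → x ∈ T₂ → ∃[ i ] k ℕ.≤ toℕ i × toℕ i ℕ.< l × x ± x̂ i
    locate₂ {x} x∈T₂ =
      let j , x±y = ±-any (∈-reps T₂? T₂-resp x∈T₂)
          i′ , i′≡j , eq′ = lookup-++ˡ l₂ {l₃} j
          i , i≡ , eq = lookup-++ʳ l₁ {l₂ ++ l₃} i′
          i≡k+j = ≡.trans i≡ (≡.cong (k ℕ.+_) i′≡j)
      in i , ≡.subst (k ℕ.≤_) (≡.sym i≡k+j) (ℕ.m≤m+n k _) ,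
         ≡.subst (ℕ._< l) (≡.sym i≡k+j) (ℕ.+-monoʳ-< k (Fin.toℕ<n j)) ,
         ≡.subst (x ±_) (≡.sym (≡.trans eq eq′)) x±y

    locate₃ : ∀ {x} → x ∈ T₃ → ∃[ i ] l ℕ.≤ toℕ i × x ± x̂ i
    locate₃ {x} x∈T₃ =
      let j , x±y = ±-any (∈-reps T₃? T₃-resp x∈T₃)
          i′ , i′≡j , eq′ = lookup-++ʳ l₂ {l₃} j
          i , i≡ , eq = lookup-++ʳ l₁ {l₂ ++ l₃} i′
      in i , ≡.subst (l ℕ.≤_) (≡.sym (≡.trans i≡ (≡.trans (≡.cong (k ℕ.+_) i′≡j) (≡.sym (ℕ.+-assoc k _ _)))))
               (ℕ.m≤m+n l _) ,
         ≡.subst (x ±_) (≡.sym (≡.trans eq eq′)) x±y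

    at₁ : ∀ i → toℕ i ℕ.< k → x̂ i ∈ T₁
    at₁ = lookup-++-< (reps-all T₁?)

    at₂ : ∀ i → k ℕ.≤ toℕ i → toℕ i ℕ.< l → x̂ i ∈ T₂
    at₂ = lookup-++-≥-< l₁ (reps-all T₂?)

    at₃ : ∀ i → l ℕ.≤ toℕ i → x̂ i ∈ T₃
    at₃ = lookup-++-≥-≥ l₁ l₂ (reps-all T₃?)

    open CosetStructure Γ

    OddPart : Pred Carrier _
    OddPart = OddMultiples b d ∔ K

    near : ∀ x y → x ≈ y + (x - y)
    near x y = solve 2 (λ x y → x ⊜ y ⊕ (x ⊝ y)) ≡.refl x y

    near⁻ : ∀ x y → x ≈ - y + (x + y)
    near⁻ x y = solve 2 (λ x y → x ⊜ (⊝ y) ⊕ (x ⊕ y)) ≡.refl x y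

    A⇒ : ∀ {x} → x ∈ A → x ∈ OddPart ⊎ x ∈ Reps-A x̂ k l ∔ H
    A⇒ {x} x∈A = Sum.map (RA.K+H∩A⇒ x∈A) outside (toSum (H? (2 · x)))
      where
      outside : x ∈ Outside → x ∈ Reps-A x̂ k l ∔ H
      outside x∉ = [ both , only-A ]′ (toSum (B? x))
        where
        both : x ∈ B → x ∈ Reps-A x̂ k l ∔ H
        both x∈B = let i , i<k , h = locate₁ (x∉ , x∈A , x∈B)
                   in x̂ i , x - x̂ i , inj₁ (i , i<k , refl) , h , near x (x̂ i)
        only-A : x ∉ B → x ∈ Reps-A x̂ k l ∔ H
        only-A x∉B =
          let i , k≤i , i<l , x±y = locate₂ (x∉ , x∈A , [ id , ⊥-elim ∘ x∉B ]′ (Bal₀.cover (inverseˡ x)))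
          in [ (λ h → x̂ i , x - x̂ i , inj₂ (i , k≤i , i<l , inj₁ refl) , h , near x (x̂ i))
             , (λ h → - x̂ i , x + x̂ i , inj₂ (i , k≤i , i<l , inj₂ refl) , h , near⁻ x (x̂ i)) ]′ x±y

    A⇐ : ∀ {x} → x ∈ OddPart ⊎ x ∈ Reps-A x̂ k l ∔ H → x ∈ A
    A⇐ (inj₁ x∈) = RA.OddMultiples∔K⊆A x∈
    A⇐ (inj₂ (a , h , a∈ , h∈H , x≈)) = A-resp (sym x≈) (let o , a∈A = rep a∈ in RA.periodic o a∈A h∈H)
      where
      rep : ∀ {a} → a ∈ Reps-A x̂ k l → a ∈ Outside × a ∈ A
      rep (inj₁ (i , i<k , a≈)) = let o , ∈A , _ = at₁ i i<k in Outside-resp (sym a≈) o , A-resp (sym a≈) ∈A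
      rep (inj₂ (i , k≤i , i<l , inj₁ a≈)) = let o , ∈A , _ = at₂ i k≤i i<l in Outside-resp (sym a≈) o , A-resp (sym a≈) ∈A
      rep (inj₂ (i , k≤i , i<l , inj₂ a≈)) = let o , _ , ∈A = at₂ i k≤i i<l in Outside-resp (sym a≈) (Outside-neg o) , A-resp (sym a≈) ∈A

    B⇒ : ∀ {x} → x ∈ B → x ∈ OddPart ⊎ x ∈ Reps-B x̂ k l ∔ H
    B⇒ {x} x∈B = Sum.map (RB.K+H∩A⇒ x∈B) outside (toSum (H? (2 · x)))
      where
      outside : x ∈ Outside → x ∈ Reps-B x̂ k l ∔ H
      outside x∉ = [ both , only-B ]′ (toSum (A? x))
        where
        both : x ∈ A → x ∈ Reps-B x̂ k l ∔ H
        both x∈A = let i , i<k , h = locate₁ (x∉ , x∈A , x∈B)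
                   in x̂ i , x - x̂ i , inj₁ (i , i<k , refl) , h , near x (x̂ i)
        only-B : x ∉ A → x ∈ Reps-B x̂ k l ∔ H
        only-B x∉A =
          let i , l≤i , x±y = locate₃ (x∉ , x∈B , [ ⊥-elim ∘ x∉A , id ]′ (Bal₀.cover (inverseʳ x)))
          in [ (λ h → x̂ i , x - x̂ i , inj₂ (i , l≤i , inj₁ refl) , h , near x (x̂ i))
             , (λ h → - x̂ i , x + x̂ i , inj₂ (i , l≤i , inj₂ refl) , h , near⁻ x (x̂ i)) ]′ x±y

    B⇐ : ∀ {x} → x ∈ OddPart ⊎ x ∈ Reps-B x̂ k l ∔ H → x ∈ B
    B⇐ (inj₁ x∈) = RB.OddMultiples∔K⊆A x∈
    B⇐ (inj₂ (a , h , a∈ , h∈H , x≈)) = B-resp (sym x≈) (let o , a∈B = rep a∈ in RB.periodic o a∈B h∈H)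
      where
      rep : ∀ {a} → a ∈ Reps-B x̂ k l → a ∈ Outside × a ∈ B
      rep (inj₁ (i , i<k , a≈)) = let o , _ , ∈B = at₁ i i<k in Outside-resp (sym a≈) o , B-resp (sym a≈) ∈B
      rep (inj₂ (i , l≤i , inj₁ a≈)) = let o , ∈B , _ = at₃ i l≤i in Outside-resp (sym a≈) o , B-resp (sym a≈) ∈B
      rep (inj₂ (i , l≤i , inj₂ a≈)) = let o , _ , ∈B = at₃ i l≤i in Outside-resp (sym a≈) (Outside-neg o) , B-resp (sym a≈) ∈B

    -- Their number L + 2m is the index of H.
    cosets : List Carrier
    cosets = members K? ++ xs ++ map -_ xs

    cosets-distinct : AllPairs (λ x y → x - y ∉ H) cosets
    cosets-distinct = AllPairs.++⁺
      (AllPairs-map (λ {x} {y} x∈K y∈K x≉y x-y∈H → x≉y (by-hyp (K∩H x-y∈H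
          (trans (solve 2 (λ x y → 2 ⊗ (x ⊝ y) ⊜ 2 ⊗ x ⊝ 2 ⊗ y) ≡.refl x y) (trans (minus-cong x∈K y∈K) (inverseʳ 0#))))
          (solve 2 (λ x y → x ⊕ 𝟘 ⊜ y ⊕ (x ⊝ y)) ≡.refl x y)))
        (members-all K?) (members-unique K?))
      (AllPairs.++⁺ (AllPairs.map (_∘ inj₁) xs-unique)
        (AllPairs.map⁺ (AllPairs.map (λ {x} {y} x≁y → x≁y ∘ inj₁ ∘ resp
          (solve 2 (λ x y → ⊝ ((⊝ x) ⊝ (⊝ y)) ⊜ x ⊝ y) ≡.refl x y) ∘ -‿closed) xs-unique))
        (All.tabulate λ x∈ → All.map⁺ (All.tabulate λ y∈ → opposite x∈ y∈)))
      (All.map (λ x∈K → All.map (λ y∉ → y∉ ∘ difference x∈K)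
          (All.++⁺ xs-outside (All.map⁺ (All.map Outside-neg xs-outside))))
        (members-all K?))
      where
      difference : ∀ {x y} → x ∈ K → x - y ∈ H → 2 · y ∈ H
      difference {x} {y} x∈K h = resp (by-hyp (sym x∈K)
        (solve 2 (λ x y → ⊝ (2 ⊗ (x ⊝ y)) ⊕ 2 ⊗ x ⊜ 2 ⊗ y ⊕ 𝟘) ≡.refl x y)) (-‿closed (·-closed 2 h))

      -- Two entries with `x + y ∈ H` are equivalent and so are the same entry, but then
      -- `2 · x ∈ H`, which is false outside `K ∔ H`.
      opposite : ∀ {x y} → x ∈≡ xs → y ∈≡ xs → x - (- y) ∉ H
      opposite {x} {y} x∈ y∈ h = All.lookup xs-outside x∈ (resp
        (solve 1 (λ x → x ⊕ x ⊜ 2 ⊗ x) ≡.refl x)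
        (≡.subst (λ y → x + y ∈ H) (≡.sym (unique⇒≡ ±.setoid xs-unique x∈ y∈ (inj₂ x+y∈H))) x+y∈H))
        where
        x+y∈H : x + y ∈ H
        x+y∈H = resp (solve 2 (λ x y → x ⊝ (⊝ y) ⊜ x ⊕ y) ≡.refl x y) h

    cosets-complete : ∀ x → Any (λ y → x - y ∈ H) cosets
    cosets-complete x = [ inside , outside ]′ (toSum (H? (2 · x)))
      where
      inside : 2 · x ∈ H → Any (λ y → x - y ∈ H) cosets
      inside 2x∈H = let κ , h , κ∈K , h∈H , x≈ = ∈K∔H⁺ 2x∈H in
        Any.++⁺ˡ (Any.map (λ {y} κ≈y → resp (by-hyp (+-cong (sym κ≈y) (sym x≈))
          (solve 4 (λ x y κ h → h ⊕ (κ ⊕ x) ⊜ x ⊝ y ⊕ (y ⊕ (κ ⊕ h))) ≡.refl x y κ h)) h∈H)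
          (∈-members K? K-resp κ∈K))

      outside : x ∈ Outside → Any (λ y → x - y ∈ H) cosets
      outside x∉ = Any.++⁺ʳ (members K?) (
        [ Any.++⁺ˡ , Any.++⁺ʳ xs ∘ Any.map⁺ ∘ Any.map (λ {y} → resp (solve 2 (λ x y → x ⊕ y ⊜ x ⊝ (⊝ y)) ≡.refl x y)) ]′
        (Any.Any-⊎⁻ (∈-xs x∉)))

    m-def : d ℕ.* (2 ℕ.* m ℕ.+ L) ≡ order
    m-def = begin
      d ℕ.* (2 ℕ.* m ℕ.+ L)     ≡⟨ ≡.cong (d ℕ.*_) (≡.trans (ℕ.+-comm _ L) (≡.cong (λ n → L ℕ.+ (m ℕ.+ n)) (ℕ.+-identityʳ m))) ⟩
      d ℕ.* (L ℕ.+ (m ℕ.+ m))   ≡⟨ ≡.cong (d ℕ.*_) length-cosets ⟨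
      d ℕ.* length cosets       ≡⟨ ℕ.*-comm d _ ⟩
      length cosets ℕ.* d       ≡⟨ Lagrange.order≡ Γ H? subgroup cosets-distinct cosets-complete ⟨
      order                     ∎
      where
      open ≡.≡-Reasoning
      length-cosets : length cosets ≡ L ℕ.+ (m ℕ.+ m)
      length-cosets = ≡.trans (List.length-++ (members K?)) (≡.cong (L ℕ.+_)
        (≡.trans (List.length-++ xs) (≡.cong (m ℕ.+_) (List.length-map -_ xs))))

    structure : HasStructure A B
    structure = b , b∈A , b∈B , (RA.d-odd , RA.1<d) , record
      { m = m ; k = k ; l = l
      ; m-def = m-def
      ; k≤l = ℕ.m≤m+n k _
      ; l≤m = ≡.subst (l ℕ.≤_) (≡.sym (≡.trans (List.length-++ l₁) (≡.trans
                (≡.cong (k ℕ.+_) (List.length-++ l₂)) (≡.sym (ℕ.+-assoc k _ _))))) (ℕ.m≤m+n l _)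
      ; x = x̂
      ; x-distinct = λ {i} {j} → lookup-injective ±.setoid xs-unique i j ∘ ≈⇒±
      ; x∉K+H = λ i → all-lookup xs-outside i ∘ ∈K∔H⁻
      ; covering = (λ (_ , x∉) → cover (x∉ ∘ ∈K∔H⁺)) , λ { (i , x∈) → _ , (λ x∈K∔H → uncover i x∈ (∈K∔H⁻ x∈K∔H)) }
      ; A-eq = A⇒ , A⇐
      ; B-eq = B⇒ , B⇐
      }
      where
      b∈AB = Balanced.both bal₂ (+-congˡ (sym (identityʳ b))) refl
      b∈A = proj₁ b∈AB
      b∈B = proj₂ b∈AB

      cover : ∀ {x} → x ∈ Outside → ∃[ i ] (x ∈ x̂ i ⊞ H ⊎ x ∈ (- x̂ i) ⊞ H)
      cover {x} x∉ = let i , x±y = ±-any (∈-xs x∉) in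
        i , Sum.map (λ h → x - x̂ i , h , near x (x̂ i)) (λ h → x + x̂ i , h , near⁻ x (x̂ i)) x±y

      uncover : ∀ i {x} → x ∈ x̂ i ⊞ H ⊎ x ∈ (- x̂ i) ⊞ H → x ∈ Outside
      uncover i (inj₁ (h , h∈H , x≈)) = Outside-resp (sym x≈) (Outside-shift (all-lookup xs-outside i) h∈H)
      uncover i (inj₂ (h , h∈H , x≈)) = Outside-resp (sym x≈) (Outside-shift (Outside-neg (all-lookup xs-outside i)) h∈H)

-- Sets with a coset decomposition

module _ {c ℓ p : Level} (Γ : FiniteAbelianGroup c ℓ) where
  open FiniteAbelianGroup Γ
  open Subsets Γ
  open CosetStructure Γ

  module Converse {A B : Pred Carrier p} {b : Carrier}
    (d-odd : Odd (CyclicSubgroup.d Γ (2 · b))) (1<d : 1 ℕ.< CyclicSubgroup.d Γ (2 · b))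
    (decomposition : HasCosetDecomposition b A B) where
    open CyclicSubgroup Γ (2 · b)
    open AbelianGroupSolver Γ
    open Multiples Γ
    open IsSubgroup subgroup
    open OddOrder Γ b d-odd
    open Cardinality finiteSetoid using (members; ∈-members)
    open HasCosetDecomposition decomposition using (m; k; l; m-def; k≤l; l≤m; x; x∉K+H; covering; A-eq; B-eq)

    private
      Close : Carrier → Carrier → Set _
      Close x y = x - y ∈ H ⊎ x + y ∈ H

    g≉0 : ¬ g ≈ 0#
    g≉0 g≈0 = ·≉0 1 1<d (trans (identityʳ g) g≈0)

    -- If xᵢ and ±xⱼ shared a coset of H, then xᵢ could be dropped from the
    -- covering, and |Γ| would be too small.
    coset-injective : ∀ {m} (x : Fin m → Carrier) → d ℕ.* (2 ℕ.* m ℕ.+ L) ≡ order →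
                      (∀ z → 2 · z ∉ H → ∃[ i ] Close z (x i)) →
                      ∀ i j → Close (x i) (x j) → i ≡ j
    coset-injective {suc m} x m-def cover i j xᵢ~xⱼ = decidable-stable (i Fin.≟ j) λ i≢j →
      ℕ.<⇒≱ (too-small i≢j) (Lagrange.order≤ Γ ⟨ g ⟩? subgroup (cosets i≢j) (complete i≢j))
      where
      module _ (i≢j : ¬ i ≡ j) where
        ys cosets : List Carrier
        ys = tabulate (x ∘ punchIn i)
        cosets = members K? ++ ys ++ map -_ ys

        length-cosets : length cosets ≡ L ℕ.+ (m ℕ.+ m)
        length-cosets = ≡.trans (List.length-++ (members K?)) (≡.cong (L ℕ.+_)
          (≡.trans (List.length-++ ys) (≡.cong₂ ℕ._+_ (List.length-tabulate (x ∘ punchIn i))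
            (≡.trans (List.length-map -_ ys) (List.length-tabulate (x ∘ punchIn i))))))

        from-ys : ∀ {z} i′ → ¬ i ≡ i′ → Close z (x i′) → Any (λ y → z - y ∈ H) cosets
        from-ys {z} i′ i≢i′ = Any.++⁺ʳ (members K?) ∘
          [ Any.++⁺ˡ ∘ at
          , Any.++⁺ʳ ys ∘ Any.map⁺ ∘ Any.map (λ {y} → resp (solve 2 (λ z y → z ⊕ y ⊜ z ⊝ (⊝ y)) ≡.refl z y)) ∘ at
          ]′
          where
          at : {P : Pred Carrier ℓ} → P (x i′) → Any P ys
          at {P} Px = Any.tabulate⁺ (punchOut i≢i′) (≡.subst (P ∘ x) (≡.sym (Fin.punchIn-punchOut i≢i′)) Px)

        -- Whatever the dropped `x i` covered is still covered by `x j`.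
        close-trans : ∀ {z} → Close z (x i) → Close z (x j)
        close-trans {z} p = go p xᵢ~xⱼ
          where
          go : Close z (x i) → Close (x i) (x j) → Close z (x j)
          go (inj₁ h) (inj₁ h′) = inj₁ (resp (solve 3 (λ z a b → z ⊝ a ⊕ (a ⊝ b) ⊜ z ⊝ b) ≡.refl z (x i) (x j)) (+-closed h h′))
          go (inj₁ h) (inj₂ h′) = inj₂ (resp (solve 3 (λ z a b → z ⊝ a ⊕ (a ⊕ b) ⊜ z ⊕ b) ≡.refl z (x i) (x j)) (+-closed h h′))
          go (inj₂ h) (inj₁ h′) = inj₂ (resp (solve 3 (λ z a b → z ⊕ a ⊝ (a ⊝ b) ⊜ z ⊕ b) ≡.refl z (x i) (x j)) (+-closed h (-‿closed h′)))
          go (inj₂ h) (inj₂ h′) = inj₁ (resp (solve 3 (λ z a b → z ⊕ a ⊝ (a ⊕ b) ⊜ z ⊝ b) ≡.refl z (x i) (x j)) (+-closed h (-‿closed h′)))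

        complete : ∀ z → Any (λ y → z - y ∈ H) cosets
        complete z = [ inside , outside ∘ cover z ]′ (toSum (⟨ g ⟩? (2 · z)))
          where
          inside : 2 · z ∈ H → Any (λ y → z - y ∈ H) cosets
          inside 2z∈H = let κ , h , κ∈K , h∈H , z≈ = ∈K∔H⁺ 2z∈H in
            Any.++⁺ˡ (Any.map (λ {y} κ≈y → resp (by-hyp (+-cong (sym κ≈y) (sym z≈))
              (solve 4 (λ z y κ h → h ⊕ (κ ⊕ z) ⊜ z ⊝ y ⊕ (y ⊕ (κ ⊕ h))) ≡.refl z y κ h)) h∈H)
              (∈-members K? K-resp κ∈K))

          outside : ∃[ i′ ] Close z (x i′) → Any (λ y → z - y ∈ H) cosets
          outside (i′ , z~) = [ (λ i≡i′ → from-ys j i≢j (close-trans (≡.subst (Close z ∘ x) (≡.sym i≡i′) z~)))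
                              , (λ i≢i′ → from-ys i′ i≢i′ z~) ]′ (toSum (i Fin.≟ i′))

        too-small : length cosets ℕ.* d ℕ.< order
        too-small = begin-strict
          length cosets ℕ.* d           ≡⟨ ≡.cong (ℕ._* d) length-cosets ⟩
          (L ℕ.+ (m ℕ.+ m)) ℕ.* d       <⟨ ℕ.*-monoˡ-< d {{ℕ.>-nonZero (ℕ.<-trans (ℕ.n<1+n 0) 1<d)}}
            (ℕ.+-monoʳ-< L (ℕ.+-mono-< (ℕ.n<1+n m) (ℕ.n<1+n m))) ⟩
          (L ℕ.+ (suc m ℕ.+ suc m)) ℕ.* d ≡⟨ ≡.cong (ℕ._* d) (≡.trans (ℕ.+-comm L _)
            (≡.cong (λ n → (suc m ℕ.+ n) ℕ.+ L) (≡.sym (ℕ.+-identityʳ (suc m))))) ⟩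
          (2 ℕ.* suc m ℕ.+ L) ℕ.* d     ≡⟨ ℕ.*-comm _ d ⟩
          d ℕ.* (2 ℕ.* suc m ℕ.+ L)     ≡⟨ m-def ⟩
          order                         ∎
          where open ℕ.≤-Reasoning

    private
      2x∉H : ∀ i → 2 · x i ∉ H
      2x∉H i = x∉K+H i ∘ ∈K∔H⁺

      x-injective : ∀ {i j} → Close (x i) (x j) → i ≡ j
      x-injective {i} {j} = coset-injective x m-def cover i j
        where
        cover : ∀ z → 2 · z ∉ H → ∃[ i ] Close z (x i)
        cover z 2z∉H =
          let i , z∈ = proj₁ covering (_ , 2z∉H ∘ ∈K∔H⁻)
          in i , Sum.map
            (λ (h , h∈H , z≈) → resp (by-hyp (sym z≈) (solve 3 (λ z y h → h ⊕ z ⊜ z ⊝ y ⊕ (y ⊕ h)) ≡.refl z (x i) h)) h∈H)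
            (λ (h , h∈H , z≈) → resp (by-hyp (sym z≈) (solve 3 (λ z y h → h ⊕ z ⊜ z ⊕ y ⊕ ((⊝ y) ⊕ h)) ≡.refl z (x i) h)) h∈H)
            z∈

      Signed : Carrier → Fin m → Set _
      Signed a i = a ≈ x i ⊎ a ≈ - x i

      signed-close : ∀ {a a′ i j} → Signed a i → Signed a′ j → a + a′ ∈ H → Close (x i) (x j)
      signed-close (inj₁ a≈) (inj₁ a′≈) h = inj₂ (resp (+-cong a≈ a′≈) h)
      signed-close (inj₁ a≈) (inj₂ a′≈) h = inj₁ (resp (+-cong a≈ a′≈) h)
      signed-close {i = i} {j} (inj₂ a≈) (inj₁ a′≈) h = inj₁ (resp
        (solve 2 (λ y z → ⊝ ((⊝ y) ⊕ z) ⊜ y ⊝ z) ≡.refl (x i) (x j)) (-‿closed (resp (+-cong a≈ a′≈) h)))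
      signed-close {i = i} {j} (inj₂ a≈) (inj₂ a′≈) h = inj₂ (resp
        (solve 2 (λ y z → ⊝ ((⊝ y) ⊝ z) ⊜ y ⊕ z) ≡.refl (x i) (x j)) (-‿closed (resp (+-cong a≈ a′≈) h)))

      signed-outside : ∀ {a i} → Signed a i → 2 · a ∉ H
      signed-outside {i = i} (inj₁ a≈) = 2x∉H i ∘ resp (2·-cong a≈)
      signed-outside {i = i} (inj₂ a≈) = 2x∉H i ∘ resp (solve 1 (λ y → ⊝ (2 ⊗ (⊝ y)) ⊜ 2 ⊗ y) ≡.refl (x i))
        ∘ -‿closed ∘ resp (2·-cong a≈)

      signedᴬ : ∀ {a} → a ∈ Reps-A x k l → ∃[ i ] Signed a i × (toℕ i ℕ.< k × a ≈ x i ⊎ k ℕ.≤ toℕ i × toℕ i ℕ.< l)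
      signedᴬ (inj₁ (i , i<k , a≈))       = i , inj₁ a≈ , inj₁ (i<k , a≈)
      signedᴬ (inj₂ (i , k≤i , i<l , a≈)) = i , a≈ , inj₂ (k≤i , i<l)

      signedᴮ : ∀ {a} → a ∈ Reps-B x k l → ∃[ i ] Signed a i × (toℕ i ℕ.< k × a ≈ x i ⊎ l ℕ.≤ toℕ i)
      signedᴮ (inj₁ (i , i<k , a≈)) = i , inj₁ a≈ , inj₁ (i<k , a≈)
      signedᴮ (inj₂ (i , l≤i , a≈)) = i , a≈ , inj₂ l≤i

      -- A sum in `H` forces the two indices to agree. The index ranges for `A` and `B` meet only
      -- below `k`, where both sets use `x i` with the same sign, so the sum would be `2 · x i`.
      reps-apart : ∀ {a a′} → a ∈ Reps-A x k l → a′ ∈ Reps-B x k l → a + a′ ∉ H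
      reps-apart {a} {a′} a∈ a′∈ h =
        let i , a~ , pos = signedᴬ a∈ ; j , a′~ , pos′ = signedᴮ a′∈
        in clash i j (x-injective (signed-close a~ a′~ h)) pos pos′
        where
        clash : ∀ i j → i ≡ j → toℕ i ℕ.< k × a ≈ x i ⊎ k ℕ.≤ toℕ i × toℕ i ℕ.< l →
                ¬ (toℕ j ℕ.< k × a′ ≈ x j ⊎ l ℕ.≤ toℕ j)
        clash i j ≡.refl (inj₁ (_ , a≈)) (inj₁ (_ , a′≈)) = 2x∉H i (resp
          (trans (+-cong a≈ a′≈) (+-congˡ (sym (identityʳ (x i))))) h)
        clash i j ≡.refl (inj₁ (i<k , _)) (inj₂ l≤i)      = ℕ.<⇒≱ i<k (ℕ.≤-trans k≤l l≤i)
        clash i j ≡.refl (inj₂ (k≤i , _)) (inj₁ (i<k , _)) = ℕ.<⇒≱ i<k k≤i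
        clash i j ≡.refl (inj₂ (_ , i<l)) (inj₂ l≤i)      = ℕ.<⇒≱ i<l l≤i

      -- What remains of the odd part after doubling, which erases `K`: the double is zero or the
      -- odd multiple `(2j + 1)g` with `2j + 1 < d`.
      OddForm : Pred Carrier _
      OddForm z = 2 · z ≈ 0# ⊎ ∃[ j ] j ℕ.< t × 2 · z ≈ g + 2 · j · g

      odd-form : ∀ {z} → z ∈ OddMultiples b d ∔ K → z ∈ OddForm
      odd-form (a , κ , inj₁ a≈0 , κ∈K , z≈) = inj₁ (trans (2·-cong (trans z≈ (trans (+-congʳ a≈0) (identityˡ κ)))) κ∈K)
      odd-form {z} (a , κ , inj₂ (n , n-odd , n+2≤d , a≈nb) , κ∈K , z≈) = inj₂ (j , j<t , by-hyp
        (+-cong (2·-cong (trans z≈ (+-congʳ (trans a≈nb (trans (×-congˡ (odd≡ {n} n-odd)) (odd-multiple j)))))) κ∈K)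
        (solve 4 (λ z b κ jg → 2 ⊗ z ⊕ (2 ⊗ (b ⊕ jg ⊕ κ) ⊕ 𝟘) ⊜ 2 ⊗ b ⊕ 2 ⊗ jg ⊕ (2 ⊗ z ⊕ 2 ⊗ κ)) ≡.refl z b κ (j · g)))
        where
        j = n ℕ./ 2
        j<t : j ℕ.< t
        j<t = odd-bound n-odd n+2≤d

      odd-form-inside : ∀ {z} → z ∈ OddForm → 2 · z ∈ H
      odd-form-inside (inj₁ 2z≈0)         = resp (sym 2z≈0) 0∈
      odd-form-inside (inj₂ (j , _ , 2z≈)) = resp (sym 2z≈) (+-closed g∈H (·-closed 2 (·∈⟨⟩ j)))

      odd≉0 : ∀ {j} → j ℕ.< t → ¬ g + 2 · j · g ≈ 0#
      odd≉0 {j} j<t eq = ·≉0 (suc (j ℕ.* 2)) (odd<d j<t) (trans (+-congˡ (·-2* j g)) eq)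

      2n≉0 : ∀ n .{{_ : ℕ.NonZero n}} → n ℕ.< d → ¬ 2 · n · g ≈ 0#
      2n≉0 n n<d eq = ·≉0 n n<d (K∩H (·∈⟨⟩ n) eq)

      sum<d : ∀ {i j} → i ℕ.< t → j ℕ.< t → suc (i ℕ.+ j) ℕ.< d
      sum<d {i} {j} i<t j<t = ≡.subst (suc (i ℕ.+ j) ℕ.<_)
        (≡.sym (≡.trans d≡ (≡.cong suc (≡.trans (ℕ.*-comm t 2) (≡.cong (t ℕ.+_) (ℕ.+-identityʳ t))))))
        (ℕ.s≤s (ℕ.≤-trans (ℕ.s≤s (ℕ.+-monoʳ-≤ i (ℕ.n≤1+n j))) (ℕ.+-mono-≤ i<t j<t)))

      double-sum : ∀ {y z e} → y + z ≈ e → 2 · y + 2 · z ≈ 2 · e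
      double-sum {y} {z} {e} y+z≈e = trans (solve 2 (λ y z → 2 ⊗ y ⊕ 2 ⊗ z ⊜ 2 ⊗ (y ⊕ z)) ≡.refl y z) (2·-cong y+z≈e)

      -- Doubling the sum leaves a multiple of `g`. One odd form alone gives `(2j + 1)g = 0`, two
      -- give `2(i + j + 1)g = 0`; both contradict the order of `g`, as `i + j + 1 < d` and `d` is
      -- odd.
      zero-sum : ∀ {y z} → y ∈ OddForm → z ∈ OddForm → y + z ≈ 0# → 2 · z ≈ 0#
      zero-sum (inj₁ _) (inj₁ 2z≈0) _ = 2z≈0
      zero-sum {y} {z} (inj₁ 2y≈) (inj₂ (j , j<t , 2z≈)) y+z≈0 = ⊥-elim (odd≉0 j<t
        (by-hyp (+-cong (+-cong (double-sum y+z≈0) (sym 2z≈)) (sym 2y≈))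
          (solve 3 (λ y z o → o ⊕ (𝟘 ⊕ (𝟘 ⊕ 𝟘) ⊕ 2 ⊗ z ⊕ 2 ⊗ y) ⊜ 𝟘 ⊕ (2 ⊗ y ⊕ 2 ⊗ z ⊕ o ⊕ 𝟘)) ≡.refl y z (g + 2 · j · g))))
      zero-sum {y} {z} (inj₂ (j , j<t , 2y≈)) (inj₁ 2z≈0) _ = 2z≈0
      zero-sum {y} {z} (inj₂ (i , i<t , 2y≈)) (inj₂ (j , j<t , 2z≈)) y+z≈0 = ⊥-elim (2n≉0 (suc (i ℕ.+ j)) (sum<d i<t j<t)
        (trans (2·-cong (+-congˡ (×-homo-+ g i j)))
          (by-hyp (+-cong (+-cong (double-sum y+z≈0) (sym 2z≈)) (sym 2y≈))
            (solve 5 (λ y z g ig jg → 2 ⊗ (g ⊕ (ig ⊕ jg)) ⊕ (2 ⊗ 𝟘 ⊕ 2 ⊗ z ⊕ 2 ⊗ y) ⊜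
              𝟘 ⊕ (2 ⊗ y ⊕ 2 ⊗ z ⊕ (g ⊕ 2 ⊗ jg) ⊕ (g ⊕ 2 ⊗ ig))) ≡.refl y z g (i · g) (j · g)))))

      -- Doubling leads to `(2j - 1)g = 0`; the case `j = 0`, with a negative coefficient, is
      -- treated separately.
      mixed-g : ∀ {y z j} → j ℕ.< t → 2 · y ≈ 0# → 2 · z ≈ g + 2 · j · g → ¬ y + z ≈ g
      mixed-g {y} {z} {zero} _ 2y≈ 2z≈ y+z≈g = g≉0
        (by-hyp (+-cong (+-cong (sym (double-sum y+z≈g)) 2z≈) 2y≈)
          (solve 3 (λ y z g → g ⊕ (2 ⊗ y ⊕ 2 ⊗ z ⊕ (g ⊕ 2 ⊗ 𝟘) ⊕ 𝟘) ⊜ 𝟘 ⊕ (2 ⊗ g ⊕ 2 ⊗ z ⊕ 2 ⊗ y)) ≡.refl y z g))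
      mixed-g {y} {z} {suc j} j<t 2y≈ 2z≈ y+z≈g = odd≉0 (ℕ.<-trans (ℕ.n<1+n j) j<t)
        (by-hyp (+-cong (+-cong (double-sum y+z≈g) (sym 2z≈)) (sym 2y≈))
          (solve 4 (λ y z g jg → g ⊕ 2 ⊗ jg ⊕ (2 ⊗ g ⊕ 2 ⊗ z ⊕ 2 ⊗ y) ⊜
            𝟘 ⊕ (2 ⊗ y ⊕ 2 ⊗ z ⊕ (g ⊕ 2 ⊗ (g ⊕ jg)) ⊕ 𝟘)) ≡.refl y z g (j · g)))

      -- Two odd forms give `2(i + j)g = 0`, so `i` and `j` are both zero and each double is `g`;
      -- the other combinations contradict the order of `g`.
      g-sum : ∀ {y z} → y ∈ OddForm → z ∈ OddForm → y + z ≈ g → 2 · z ≈ g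
      g-sum {y} {z} (inj₁ 2y≈) (inj₁ 2z≈) y+z≈g = ⊥-elim (g≉0 (K∩H g∈H
        (trans (sym (double-sum y+z≈g)) (trans (+-cong 2y≈ 2z≈) (identityʳ 0#)))))
      g-sum (inj₁ 2y≈) (inj₂ (j , j<t , 2z≈)) y+z≈g = ⊥-elim (mixed-g j<t 2y≈ 2z≈ y+z≈g)
      g-sum {y} {z} (inj₂ (j , j<t , 2y≈)) (inj₁ 2z≈) y+z≈g = ⊥-elim (mixed-g j<t 2z≈ 2y≈ (trans (comm z y) y+z≈g))
      g-sum {y} {z} (inj₂ (i , i<t , 2y≈)) (inj₂ (j , j<t , 2z≈)) y+z≈g = finish i j i<t j<t
        (trans (2·-cong (×-homo-+ g i j))
          (by-hyp (+-cong (+-cong (double-sum y+z≈g) (sym 2z≈)) (sym 2y≈))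
            (solve 5 (λ y z g ig jg → 2 ⊗ (ig ⊕ jg) ⊕ (2 ⊗ g ⊕ 2 ⊗ z ⊕ 2 ⊗ y) ⊜
              𝟘 ⊕ (2 ⊗ y ⊕ 2 ⊗ z ⊕ (g ⊕ 2 ⊗ jg) ⊕ (g ⊕ 2 ⊗ ig))) ≡.refl y z g (i · g) (j · g)))) 2z≈
        where
        finish : ∀ i j → i ℕ.< t → j ℕ.< t → 2 · (i ℕ.+ j) · g ≈ 0# → 2 · z ≈ g + 2 · j · g → 2 · z ≈ g
        finish zero zero _ _ _ 2z≈ = trans 2z≈ (trans (+-congˡ (·-zeroʳ 2)) (identityʳ g))
        finish zero (suc j) i<t j<t eq _ = ⊥-elim (2n≉0 (suc j) (ℕ.<-trans (ℕ.n<1+n _) (sum<d i<t j<t)) eq)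
        finish (suc i) j i<t j<t eq _ = ⊥-elim (2n≉0 (suc (i ℕ.+ j)) (ℕ.<-trans (ℕ.n<1+n _) (sum<d i<t j<t)) eq)

      -- As the sum is in `H`, the summands lie both inside or both outside `K ∔ H`, and
      -- `reps-apart` rules out the latter.
      inside-or-outside : ∀ {y z e} → e ∈ H → y + z ≈ e → y ∈ A → z ∈ B → y ∈ OddForm × z ∈ OddForm
      inside-or-outside {y} {z} {e} e∈H y+z≈e y∈A z∈B =
        cases (Sum.map₁ odd-form (proj₁ A-eq y∈A)) (Sum.map₁ odd-form (proj₁ B-eq z∈B))
        where
        outside : ∀ {y a h} → 2 · a ∉ H → h ∈ H → y ≈ a + h → 2 · y ∉ H
        outside {y} {a} {h} 2a∉H h∈H y≈ 2y∈H = 2a∉H (resp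
          (by-hyp (2·-cong y≈) (solve 3 (λ y a h → 2 ⊗ y ⊝ 2 ⊗ h ⊕ 2 ⊗ (a ⊕ h) ⊜ 2 ⊗ a ⊕ 2 ⊗ y) ≡.refl y a h))
          (+-closed 2y∈H (-‿closed (·-closed 2 h∈H))))

        other : ∀ {y z} → y + z ≈ e → 2 · y ∈ H → 2 · z ∈ H
        other {y} {z} y+z≈e 2y∈H = resp (by-hyp (2·-cong (sym y+z≈e))
          (solve 3 (λ y z e → 2 ⊗ e ⊝ 2 ⊗ y ⊕ 2 ⊗ (y ⊕ z) ⊜ 2 ⊗ z ⊕ 2 ⊗ e) ≡.refl y z e))
          (+-closed (·-closed 2 e∈H) (-‿closed 2y∈H))

        cases : y ∈ OddForm ⊎ y ∈ Reps-A x k l ∔ H → z ∈ OddForm ⊎ z ∈ Reps-B x k l ∔ H →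
                y ∈ OddForm × z ∈ OddForm
        cases (inj₁ y∈) (inj₁ z∈) = y∈ , z∈
        cases (inj₁ y∈) (inj₂ (a′ , h′ , a′∈ , h′∈H , z≈)) = ⊥-elim (outside
          (signed-outside (proj₁ (proj₂ (signedᴮ a′∈)))) h′∈H z≈ (other y+z≈e (odd-form-inside y∈)))
        cases (inj₂ (a , h , a∈ , h∈H , y≈)) (inj₁ z∈) = ⊥-elim (outside
          (signed-outside (proj₁ (proj₂ (signedᴬ a∈)))) h∈H y≈ (other (trans (comm z y) y+z≈e) (odd-form-inside z∈)))
        cases (inj₂ (a , h , a∈ , h∈H , y≈)) (inj₂ (a′ , h′ , a′∈ , h′∈H , z≈)) = ⊥-elim (reps-apart a∈ a′∈
          (resp (by-hyp (+-cong (sym y+z≈e) (+-cong y≈ z≈)) (solve 7 (λ y z e a a′ h h′ →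
            e ⊝ (h ⊕ h′) ⊕ (y ⊕ z ⊕ (a ⊕ h ⊕ (a′ ⊕ h′))) ⊜ a ⊕ a′ ⊕ (e ⊕ (y ⊕ z))) ≡.refl y z e a a′ h h′))
            (+-closed e∈H (-‿closed (+-closed h∈H h′∈H)))))

      half-sum : ∀ {y z e} → y + z ≈ e → 2 · z ≈ e → y ≈ z
      half-sum {y} {z} {e} y+z≈e 2z≈e = by-hyp (trans y+z≈e (sym 2z≈e))
        (solve 2 (λ y z → y ⊕ 2 ⊗ z ⊜ z ⊕ (y ⊕ z)) ≡.refl y z)

    only₀ : ∀ {y z} → y + z ≈ 0# → y ∈ A → z ∈ B → y ≈ z
    only₀ y+z≈0 y∈A z∈B = let y∈ , z∈ = inside-or-outside 0∈ y+z≈0 y∈A z∈B in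
      half-sum y+z≈0 (zero-sum y∈ z∈ y+z≈0)

    only₂ : ∀ {y z} → y + z ≈ 2 · b → y ∈ A → z ∈ B → y ≈ z
    only₂ y+z≈g y∈A z∈B = let y∈ , z∈ = inside-or-outside g∈H y+z≈g y∈A z∈B in
      half-sum y+z≈g (g-sum y∈ z∈ y+z≈g)

-- From exceptions in G to balanced sets in G/Σ, and back

module _ {c ℓ p : Level} (G : FiniteAbelianGroup c ℓ) where
  open FiniteAbelianGroup G
  open Subsets G

  module Equality
    {A B S : Pred Carrier p}
    (A-resp : A Respects _≈_) (B-resp : B Respects _≈_) (S-resp : S Respects _≈_)
    (A? : Decidable A) (B? : Decidable B) (S? : Decidable S)
    (∣A∣+∣B∣ : ∣ A? ∣ ℕ.+ ∣ B? ∣ ≡ order ℕ.+ Lᴹ S?)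
    (Lᴹ≡ : Lᴹ S? ≡ ∣ S? ∣ ℕ.* L)
    {s bₛ : Carrier} (s∈S : s ∈ S) (z₀∈E : 2 · bₛ + s ∉ A ∧[ S ] B)
    where
    open Exceptions G A-resp B-resp S-resp A? B? S? ∣A∣+∣B∣ Lᴹ≡
    open AbelianGroupSolver G
    open Cardinality finiteSetoid
    open Cosets s∈S

    z₀ : Carrier
    z₀ = 2 · bₛ + s

    Condition : IsSubgroup (S ⊟ s) → Set _
    Condition Σ-sub =
      let
        open Quotient G (⊟-dec S-resp S? s) Σ-sub
        open CosetStructure quotient
        A′ = π[ (A ⊟ bₛ) ⊟ s ]
        B′ = π[ B ⊟ bₛ ]
      in
      HasStructure A′ B′
      × (A ≐ (bₛ + s) ⊞ (π ⊢ A′))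
      × (B ≐ bₛ ⊞ (π ⊢ B′))

    module Forwards (2∣S∣≤∣E∣ : 2 ℕ.* ∣ S? ∣ ℕ.≤ ∣ E? ∣) where
      open Extremal 2∣S∣≤∣E∣

      Σ-sub : IsSubgroup (S ⊟ s)
      Σ-sub = ⊟-subgroup (subtract z₀∈E)

      open IsSubgroup Σ-sub using () renaming (resp to Σ-resp; +-closed to Σ-+)
      open Quotient G (⊟-dec S-resp S? s) Σ-sub

      A′ = π[ (A ⊟ bₛ) ⊟ s ]
      B′ = π[ B ⊟ bₛ ]

      -- The two shifts differ by `s` so that the shifted `x` and `y` have sum `z₀ + (x + y)` and
      -- difference `x - y + s`. Sums are then measured from `z₀`, and a difference in `S` becomes
      -- `x ∼ y`.
      shiftᴬ shiftᴮ : Carrier → Carrier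
      shiftᴬ x = bₛ + s + x
      shiftᴮ x = bₛ + x

      near-z₀ : ∀ {σ} → σ ∈ S ⊟ s → z₀ + σ ∈ E
      near-z₀ {σ} σ∈ = Coset⊆E z₀∈E (S-resp (solve 3 (λ z σ s → σ ⊕ s ⊜ z ⊕ σ ⊝ z ⊕ s) ≡.refl z₀ σ s) (∈⊟⁻ σ∈))

      -- All of `z₀ + Σ` is exceptional. If `shiftᴬ y` is missing, its partner at `z₀` lies in `B`;
      -- that partner meets `shiftᴬ x` at the exception `z₀ + (x - y)`, so their difference is in
      -- `S`. Correcting it by an element of `Σ` and returning to `z₀` puts `shiftᴬ y` into `A`
      -- after all.
      A-periodic : ∀ {x y} → x ∼ y → shiftᴬ x ∈ A → shiftᴬ y ∈ A
      A-periodic {x} {y} x∼y x∈A = decidable-stable (A? _) λ y∉A →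
        let σ∈ : y - x ∈ S ⊟ s
            σ∈ = ∼-sym x∼y
            ∈B : z₀ - shiftᴬ y ∈ B
            ∈B = [ ⊥-elim ∘ y∉A , id ]′ (Balanced.cover (balanced z₀∈E)
                   (solve 2 (λ z u → u ⊕ (z ⊝ u) ⊜ z) ≡.refl z₀ (shiftᴬ y)))
            diff : shiftᴬ x - (z₀ - shiftᴬ y) ∈ S
            diff = Balanced.only (balanced (near-z₀ x∼y))
              (solve 4 (λ b s x y → b ⊕ s ⊕ x ⊕ (2 ⊗ b ⊕ s ⊝ (b ⊕ s ⊕ y)) ⊜ 2 ⊗ b ⊕ s ⊕ (x ⊝ y)) ≡.refl bₛ s x y)
              x∈A ∈B
        in y∉A (proj₁ (Balanced.both (balanced z₀∈E)
             (solve 2 (λ z u → u ⊕ (z ⊝ u) ⊜ z) ≡.refl z₀ (shiftᴬ y))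
             (S-resp (solve 4 (λ b s x y →
                 (b ⊕ s ⊕ x ⊝ (2 ⊗ b ⊕ s ⊝ (b ⊕ s ⊕ y)) ⊝ s ⊕ (y ⊝ x)) ⊕ s ⊜
                 b ⊕ s ⊕ y ⊝ (2 ⊗ b ⊕ s ⊝ (b ⊕ s ⊕ y))) ≡.refl bₛ s x y)
               (∈⊟⁻ (Σ-+ (_ , diff , refl) σ∈)))))

      -- The argument of `A-periodic` with `z₀` and the neighbouring exception interchanged: the
      -- partner of `shiftᴮ x` at `z₀` is now tested at `z₀ + (y - x)`.
      B-periodic : ∀ {x y} → x ∼ y → shiftᴮ x ∈ B → shiftᴮ y ∈ B
      B-periodic {x} {y} x∼y x∈B = [ inA , id ]′ (cover-e sum-e)
        where
        u = z₀ - shiftᴮ x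

        e∈E : z₀ + (y - x) ∈ E
        e∈E = near-z₀ (∼-sym x∼y)

        open Balanced (balanced e∈E) using () renaming (cover to cover-e; both to both-e)

        sum-e : u + shiftᴮ y ≈ z₀ + (y - x)
        sum-e = solve 4 (λ z b x y → z ⊝ (b ⊕ x) ⊕ (b ⊕ y) ⊜ z ⊕ (y ⊝ x)) ≡.refl z₀ bₛ x y

        inA : u ∈ A → shiftᴮ y ∈ B
        inA u∈A = proj₂ (both-e sum-e (S-resp
          (solve 5 (λ z b s x y → z ⊝ (b ⊕ x) ⊝ (b ⊕ x) ⊝ s ⊕ (x ⊝ y) ⊕ s ⊜ z ⊝ (b ⊕ x) ⊝ (b ⊕ y)) ≡.refl z₀ bₛ s x y)
          (∈⊟⁻ (Σ-+ (_ , Balanced.only (balanced z₀∈E)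
            (solve 2 (λ z v → z ⊝ v ⊕ v ⊜ z) ≡.refl z₀ (shiftᴮ x)) u∈A x∈B , refl) x∼y))))

      A′⁺ : ∀ {x} → shiftᴬ x ∈ A → x ∈ A′
      A′⁺ {x} x∈A = x , (bₛ + s + x - bₛ , (bₛ + s + x , x∈A , refl) ,
        solve 3 (λ b s x → x ⊜ b ⊕ s ⊕ x ⊝ b ⊝ s) ≡.refl bₛ s x) , ≈⇒∼ refl

      A′⁻ : ∀ {x} → x ∈ A′ → shiftᴬ x ∈ A
      A′⁻ {x} (y , (v , (u , u∈A , v≈) , y≈) , x∼y) = A-periodic (∼-sym x∼y) (A-resp
        (by-hyp (+-cong (sym v≈) (sym y≈)) (solve 5 (λ u v y b s →
          u ⊕ (v ⊕ y) ⊜ b ⊕ s ⊕ y ⊕ (u ⊝ b ⊕ (v ⊝ s))) ≡.refl u v y bₛ s)) u∈A)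

      B′⁺ : ∀ {x} → shiftᴮ x ∈ B → x ∈ B′
      B′⁺ {x} x∈B = x , (bₛ + x , x∈B , solve 2 (λ b x → x ⊜ b ⊕ x ⊝ b) ≡.refl bₛ x) , ≈⇒∼ refl

      B′⁻ : ∀ {x} → x ∈ B′ → shiftᴮ x ∈ B
      B′⁻ {x} (y , (u , u∈B , y≈) , x∼y) = B-periodic (∼-sym x∼y) (B-resp
        (by-hyp (sym y≈) (solve 3 (λ u y b → u ⊕ y ⊜ b ⊕ y ⊕ (u ⊝ b)) ≡.refl u y bₛ)) u∈B)

      -- Balance at a class of the quotient needs exceptions along its whole coset, since
      -- `x + y ∼ ε` fixes the sum only modulo `Σ`.
      balanced-quotient : ∀ {ε} → (∀ {x y} → x + y ∼ ε → z₀ + (x + y) ∈ E) → Balanced quotient A′ B′ _∼_ ε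
      balanced-quotient exceptional = record
        { both  = λ {x} {y} x+y∼ε x∼y →
            let x∈A , y∈B = Balanced.both (bal x+y∼ε) (sum x y) (S-resp (difference x y) (∈⊟⁻ x∼y))
            in A′⁺ x∈A , B′⁺ y∈B
        ; only  = λ {x} {y} x+y∼ε x∈A′ y∈B′ →
            ∈⊟⁺ (S-resp (sym (difference x y)) (Balanced.only (bal x+y∼ε) (sum x y) (A′⁻ x∈A′) (B′⁻ y∈B′)))
        ; cover = λ {x} {y} x+y∼ε → Sum.map A′⁺ B′⁺ (Balanced.cover (bal x+y∼ε) (sum x y))
        }
        where
        bal = λ {x} {y} x+y∼ε → balanced (exceptional {x} {y} x+y∼ε)

        sum : ∀ x y → shiftᴬ x + shiftᴮ y ≈ z₀ + (x + y)
        sum x y = solve 4 (λ b s x y → b ⊕ s ⊕ x ⊕ (b ⊕ y) ⊜ 2 ⊗ b ⊕ s ⊕ (x ⊕ y)) ≡.refl bₛ s x y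

        difference : ∀ x y → x - y + s ≈ shiftᴬ x - shiftᴮ y
        difference x y = solve 4 (λ b s x y → x ⊝ y ⊕ s ⊜ b ⊕ s ⊕ x ⊝ (b ⊕ y)) ≡.refl bₛ s x y

      w : Carrier
      w = proj₁ (far z₀∈E)

      w∈Far : w ∈ Far z₀
      w∈Far = proj₁ (proj₂ (far z₀∈E))

      half : ∃[ h ] 2 · h ≈ w + s
      half = halves (proj₁ w∈Far) s∈S

      -- Solves `z₀ + 2 · b ≈ w` for the second exception `w`, using the half of `w + s`. It is the
      -- element `b` of condition (ii).
      b : Carrier
      b = proj₁ half - (bₛ + s)

      w≈ : w ≈ z₀ + 2 · b
      w≈ = by-hyp (sym (proj₂ half)) (solve 4 (λ w h b s →
        w ⊕ 2 ⊗ h ⊜ 2 ⊗ b ⊕ s ⊕ 2 ⊗ (h ⊝ (b ⊕ s)) ⊕ (w ⊕ s)) ≡.refl w (proj₁ half) bₛ s)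

      2b≉0 : ¬ 2 · b ∼ 0#
      2b≉0 2b∼0 = proj₂ w∈Far (S-resp (by-hyp (sym w≈)
        (solve 4 (λ w z g s → g ⊝ 𝟘 ⊕ s ⊕ w ⊜ w ⊝ z ⊕ s ⊕ (z ⊕ g)) ≡.refl w z₀ (2 · b) s)) (∈⊟⁻ 2b∼0))

      bal₀ : Balanced quotient A′ B′ _∼_ 0#
      bal₀ = balanced-quotient λ {x} {y} x+y∼0 → near-z₀
        (Σ-resp (solve 1 (λ u → u ⊝ 𝟘 ⊜ u) ≡.refl (x + y)) x+y∼0)

      bal₂ : Balanced quotient A′ B′ _∼_ (2 · b)
      bal₂ = balanced-quotient λ {x} {y} x+y∼2b → Coset⊆E (proj₁ w∈Far) (S-resp
        (by-hyp w≈ (solve 5 (λ u g s z w → u ⊝ g ⊕ s ⊕ (z ⊕ g) ⊜ z ⊕ u ⊝ w ⊕ s ⊕ w) ≡.refl (x + y) (2 · b) s z₀ w))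
        (∈⊟⁻ x+y∼2b))

      condition : Condition Σ-sub
      condition = Forward.structure quotient
          (λ x∼y (u , u∈ , x∼u) → u , u∈ , ∼-trans (∼-sym x∼y) x∼u)
          (λ x∼y (u , u∈ , x∼u) → u , u∈ , ∼-trans (∼-sym x∼y) x∼u)
          -- Membership in a projected set asks about a whole coset of `Σ`; periodicity reduces it
          -- to one point.
          (λ x → map′ A′⁺ A′⁻ (A? (shiftᴬ x))) (λ x → map′ B′⁺ B′⁻ (B? (shiftᴮ x)))
          2b≉0 bal₀ bal₂
        , ((λ {x} x∈A → x - (bₛ + s) , A′⁺ (A-resp (x≈ x (bₛ + s)) x∈A) , x≈ x (bₛ + s))
          , λ (y , y∈A′ , x≈) → A-resp (sym x≈) (A′⁻ y∈A′))
        , ((λ {x} x∈B → x - bₛ , B′⁺ (B-resp (x≈ x bₛ) x∈B) , x≈ x bₛ)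
          , λ (y , y∈B′ , x≈) → B-resp (sym x≈) (B′⁻ y∈B′))
        where
        x≈ : ∀ x v → x ≈ v + (x - v)
        x≈ x v = solve 2 (λ x v → x ⊜ v ⊕ (x ⊝ v)) ≡.refl x v

    module Backwards (Σ-sub : IsSubgroup (S ⊟ s)) where
      open IsSubgroup Σ-sub using () renaming (resp to Σ-resp; -‿closed to Σ-neg; +-closed to Σ-+)
      open Quotient G (⊟-dec S-resp S? s) Σ-sub
      open CosetStructure quotient using (HasStructure; HasCosetDecomposition)

      A′ = π[ (A ⊟ bₛ) ⊟ s ]
      B′ = π[ B ⊟ bₛ ]

      module _ {b : Carrier} (d-odd : Odd (CyclicSubgroup.d quotient (2 · b))) (1<d : 1 ℕ.< CyclicSubgroup.d quotient (2 · b))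
               (decomposition : HasCosetDecomposition b A′ B′)
               (A⊆ : A ⊆ (bₛ + s) ⊞ (π ⊢ A′)) (B⊆ : B ⊆ bₛ ⊞ (π ⊢ B′)) where
        open Converse quotient d-odd 1<d decomposition using (g≉0; only₀; only₂)

        -- A representation of such an `e` as a sum from `A` and `B` descends to one of `ε`, whose
        -- summands agree in the quotient; upstairs their difference is then in `S`.
        Coset⊆E : ∀ {ε} → (∀ {x y} → x + y ∼ ε → x ∈ A′ → y ∈ B′ → x ∼ y) → Coset (z₀ + ε) ⊆ E
        Coset⊆E {ε} only {e} e∈ (u , v , u∈A , v∈B , u-v∉S , e≈u+v) =
          let x , x∈A′ , u≈ = A⊆ u∈A
              y , y∈B′ , v≈ = B⊆ v∈B
              x∼y = only (∈⊟⁺ (S-resp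
                (by-hyp (+-cong e≈u+v (+-cong u≈ v≈)) (solve 8 (λ e u v x y b s ε →
                  e ⊝ (2 ⊗ b ⊕ s ⊕ ε) ⊕ s ⊕ (u ⊕ v ⊕ (b ⊕ s ⊕ x ⊕ (b ⊕ y))) ⊜
                  x ⊕ y ⊝ ε ⊕ s ⊕ (e ⊕ (u ⊕ v))) ≡.refl e u v x y bₛ s ε)) e∈)) x∈A′ y∈B′
          in u-v∉S (S-resp (by-hyp (sym (minus-cong u≈ v≈)) (solve 6 (λ u v x y b s →
               x ⊝ y ⊕ s ⊕ (u ⊝ v) ⊜ u ⊝ v ⊕ (b ⊕ s ⊕ x ⊝ (b ⊕ y))) ≡.refl u v x y bₛ s)) (∈⊟⁻ x∼y))

        2∣S∣≤∣E∣ : 2 ℕ.* ∣ S? ∣ ℕ.≤ ∣ E? ∣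
        2∣S∣≤∣E∣ = begin
          2 ℕ.* ∣ S? ∣                                             ≡⟨ ≡.cong (∣ S? ∣ ℕ.+_) (ℕ.+-identityʳ ∣ S? ∣) ⟩
          ∣ S? ∣ ℕ.+ ∣ S? ∣                                        ≤⟨ ℕ.+-mono-≤ (∣S∣≤∣Coset∣ (z₀ + 0#)) (∣S∣≤∣Coset∣ (z₀ + 2 · b)) ⟩
          ∣ Coset? (z₀ + 0#) ∣ ℕ.+ ∣ Coset? (z₀ + 2 · b) ∣         ≤⟨ card-disjoint (Coset? (z₀ + 0#)) (Coset? (z₀ + 2 · b)) E?
            (Coset-resp (z₀ + 0#)) E-resp (Coset⊆E only₀) (Coset⊆E only₂) disjoint ⟩
          ∣ E? ∣                                                   ∎
          where
          open ℕ.≤-Reasoning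
          -- A common element would make `2 · b` vanish modulo `Σ`, against `d > 1`.
          disjoint : ∀ {e} → e ∈ Coset (z₀ + 0#) → e ∉ Coset (z₀ + 2 · b)
          disjoint {e} e∈₀ e∈₂ = g≉0 (Σ-resp
            (solve 3 (λ e z g → e ⊝ (z ⊕ 𝟘) ⊝ (e ⊝ (z ⊕ g)) ⊜ g ⊝ 𝟘) ≡.refl e z₀ (2 · b))
            (Σ-+ (∈⊟⁺ e∈₀) (Σ-neg (∈⊟⁺ e∈₂))))

    -- Passing to complements, the equality says `|E| = 2|S|`. The bound `|E| ≤ 2|S|` always holds
    -- because `z₀` is in `E`, so either direction concerns only the reverse inequality.
    equivalence : (∣ ∧-dec A-resp S-resp B-resp A? S? B? ∣ ℕ.+ 2 ℕ.* ∣ S? ∣ ≡ order)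
                  ⇔ (Σ[ Σ-sub ∈ IsSubgroup (S ⊟ s) ] Condition Σ-sub)
    equivalence = mk⇔
      (λ eq → let ∣E∣≡ = ℕ.+-cancelˡ-≡ ∣ ∧? ∣ _ _ (≡.trans eq (≡.sym complement))
                  open Forwards (ℕ.≤-reflexive ∣E∣≡)
              in Σ-sub , condition)
      (λ (Σ-sub , (b , _ , _ , (d-odd , 1<d) , decomposition) , A≐ , B≐) →
        ≡.trans (≡.cong (∣ ∧? ∣ ℕ.+_) (ℕ.≤-antisym
          (Backwards.2∣S∣≤∣E∣ Σ-sub d-odd 1<d decomposition (proj₁ A≐) (proj₁ B≐))
          (∣E∣≤2∣S∣ z₀∈E))) complement)
      where
      ∧? = ∧-dec A-resp S-resp B-resp A? S? B?

      complement : ∣ ∧? ∣ ℕ.+ ∣ E? ∣ ≡ order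
      complement = card-complement ∧? ∧-resp

theorem18 : ∀ {c ℓ p} (G : FiniteAbelianGroup c ℓ) →
    let
    open FiniteAbelianGroup G
    open Subsets G
    in
    {A B S : Pred Carrier p}
    (A-resp : A Respects _≈_) (B-resp : B Respects _≈_) (S-resp : S Respects _≈_)
    (A? : Decidable A) (B? : Decidable B) (S? : Decidable S) →
    Satisfiable A → Satisfiable B → Satisfiable S →
    ∣ A? ∣ ℕ.+ ∣ B? ∣ ≡ order ℕ.+ Lᴹ S? →
    Lᴹ S? ≡ ∣ S? ∣ ℕ.* L →
    ∀ {s bₛ} → s ∈ S → bₛ ∈ A ⊟ s → bₛ ∈ B →
    2 · bₛ + s ∈ IsException A S B →
    (∣ ∧-dec A-resp S-resp B-resp A? S? B? ∣ ℕ.+ 2 ℕ.* ∣ S? ∣ ≡ order)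
    ⇔
    (Σ[ Σ-sub ∈ IsSubgroup (S ⊟ s) ]
    let
    open Quotient G (⊟-dec S-resp S? s) Σ-sub
    open CosetStructure quotient
    A′ = π[ (A ⊟ bₛ) ⊟ s ]
    B′ = π[ B ⊟ bₛ ]
    in
    HasStructure A′ B′
    × (A ≐ (bₛ + s) ⊞ (π ⊢ A′))
    × (B ≐ bₛ ⊞ (π ⊢ B′)))
theorem18 G A-resp B-resp S-resp A? B? S? _ _ _ ∣A∣+∣B∣ Lᴹ≡ s∈S _ _ (_ , z₀∈E) =
  Equality.equivalence G A-resp B-resp S-resp A? B? S? ∣A∣+∣B∣ Lᴹ≡ s∈S z₀∈E
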